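{- There exists $\beta_0>0$ such that for every $0<\beta<\beta_0$ and every $0 < \varepsilon \leq 1/2$, there exist $b = b(\varepsilon,\beta)$ and $n_0 = n_0(\varepsilon,\beta)$ such that the following holds. For every $n \geq n_0$ and every graph $G$ on $n$ vertices with minimum degree $\delta(G) \geq (1/2 + \varepsilon)n$, equipped with a proper edge-colouring that is globally $n/8$-bounded, there exists a Hamilton cycle in $G$ with at least $n-bn^{1-\beta}$ distinct colours.
   Context: An edge-colouring is proper if any two edges sharing an endpoint receive different colours; it is globally $b$-bounded if every colour is assigned to at most $b$ edges. $\delta(G)$ is the minimum degree of $G$. -}

module Defs where

open import Data.Nat using (ℕ; zero; suc; _+_; _*_; _∸_; _^_; _≤_; _<_; _≟_)
open import Data.Nat.DivMod using (_%_; m%n<n)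
open import Data.Fin using (Fin; toℕ; fromℕ<)
open import Data.Bool using (Bool; true; false; if_then_else_; _∧_)
open import Data.List using (List; length; map; filter; allFin; cartesianProduct; deduplicate)
open import Data.Product using (_×_; _,_; Σ)
open import Relation.Binary.PropositionalEquality using (_≡_; _≢_)
open import Relation.Nullary.Decidable using (⌊_⌋)
open import Function.Definitions using (Injective)

record Graph (n : ℕ) : Set where
  field
    adj     : Fin n → Fin n → Bool
    sym     : ∀ u v → adj u v ≡ adj v u
    irrefl  : ∀ v → adj v v ≡ false
open Graph public

degree : ∀ {n} → Graph n → Fin n → ℕ
degree G v = length (filter (λ u → adj G v u Data.Bool.≟ true) (allFin _))

-- An edge-colouring: a colour (a natural number) for each unordered pair;
-- only values on edges matter.
record EdgeColouring {n : ℕ} (G : Graph n) : Set where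
  field
    col    : Fin n → Fin n → ℕ
    colSym : ∀ u v → col u v ≡ col v u
open EdgeColouring public

Proper : ∀ {n} {G : Graph n} → EdgeColouring G → Set
Proper {n} {G} c = ∀ (u v w : Fin n) → v ≢ w → adj G u v ≡ true → adj G u w ≡ true →
                   col c u v ≢ col c u w

colourClassSize : ∀ {n} {G : Graph n} → EdgeColouring G → ℕ → ℕ
colourClassSize {n} {G} c k =
  length (filter (λ p → let u = Data.Product.proj₁ p ; v = Data.Product.proj₂ p in
                   (toℕ u Data.Nat.<? toℕ v) Relation.Nullary.Decidable.×-dec
                   ((adj G u v Data.Bool.≟ true) Relation.Nullary.Decidable.×-dec (col c u v ≟ k)))
                 (cartesianProduct (allFin n) (allFin n)))

GloballyNOver8Bounded : ∀ {n} {G : Graph n} → EdgeColouring G → Set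
GloballyNOver8Bounded {n} c = ∀ (k : ℕ) → 8 * colourClassSize c k ≤ n

next : ∀ {n} → Fin n → Fin n
next {suc n} i = fromℕ< (m%n<n (suc (toℕ i)) (suc n))

-- A Hamilton cycle, given as a cyclic ordering σ(0),σ(1),…,σ(n-1) of all
-- vertices (σ injective, hence a bijection), with consecutive vertices
-- (cyclically) adjacent.  Requires n ≥ 3 (a cycle).
record HamiltonCycle {n : ℕ} (G : Graph n) : Set where
  field
    σ       : Fin n → Fin n
    σ-inj   : Injective _≡_ _≡_ σ
    atLeast3 : 3 ≤ n
    σ-adj   : ∀ i → adj G (σ i) (σ (next i)) ≡ true
open HamiltonCycle public

numColours : ∀ {n} {G : Graph n} → EdgeColouring G → HamiltonCycle G → ℕ
numColours {n} c H =
  length (deduplicate _≟_ (map (λ i → col c (σ H i) (σ H (next i))) (allFin n)))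

{-# OPTIONS --safe #-}

-- Since 2 δ(G) ≥ n, there is a set D of arcs u → v with uv ∈ E(G), all out-degrees r = ⌊n/4⌋ and all in-degrees
-- at most r + o(n).  A rainbow linear forest in D is a matching, without directed cycles, in the 3-partite
-- 3-graph on out-copies of vertices, in-copies of vertices and colours whose edges are the arcs.  A colour has
-- degree at most 2 (n/8) ≤ r, so in this linear 3-graph all degrees are at most (1 + o(1)) r, and the
-- out-copies have degree r.
--
-- A derandomised nibble finds a matching missing O(n/h) out-copies, where h ~ n^(1/43).  Time m runs from P
-- down to P/h.  At each step one live edge is taken or one live vertex is discarded, the weights being chosen
-- so that every live vertex disappears with probability exactly 1/m.  Degrees then decay like
-- deg₀ · m²/P² and V = Σ (squared deviations of the degrees) obeys a second moment recursion; a vertex of too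
-- large degree is deleted, which lowers V.  A linear combination of V and the number of lost out-copies does
-- not grow on average, so every step has a choice for which it does not grow.  An edge closing a path into a
-- directed cycle is discarded; there are at most n of these at any time.
--
-- Listing the paths one after another gives a cyclic order of the vertices with O(n/h) non-adjacent
-- consecutive pairs, and since 2 δ(G) ≥ n each of these is removed by reversing a segment, which destroys
-- only one further pair.
module Submission where

import Data.Bool as Bool
open import Data.Bool using (Bool; true; false; _∧_; _∨_; not; if_then_else_)
import Data.Bool.Properties as BoolP
open import Data.Empty using (⊥-elim; ⊥)
import Data.Fin as Fin
open import Data.Fin using (Fin; zero; suc; toℕ; fromℕ<)
open import Data.Fin.Properties using (any?; toℕ<n; toℕ-injective; toℕ-fromℕ<)
import Data.Integer.Properties as ℤP
open import Data.List using (List; []; _∷_; _++_; map; length; filter; allFin; [_]; _∷ʳ_; reverse; deduplicate; concat; cartesianProduct)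
open import Data.List.Membership.Propositional using (_∈_)
open import Data.List.Membership.Propositional.Properties using (∈-++⁻; ∈-map⁻; ∈-allFin; ∈-++⁺ˡ; ∈-++⁺ʳ; ∈-map⁺; ∈-∃++; ∈-filter⁺; ∈-filter⁻; ∈-deduplicate⁺)
open import Data.List.Properties using (map-tabulate; length-tabulate; ++-assoc; unfold-reverse; reverse-++; ∷ʳ-injective; length-map; concat-map-[_]; length-++)
open import Data.List.Relation.Binary.Permutation.Propositional using (_↭_; refl; prep; swap; ↭-sym; ↭-trans; ↭-refl; ↭-reflexive) renaming (trans to ptrans)
open import Data.List.Relation.Binary.Permutation.Propositional.Properties using (∈-resp-↭; All-resp-↭; ++-comm; ++⁺ˡ; ↭-reverse; ↭-length; shifts; map⁺)
import Data.List.Relation.Unary.All as All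
open import Data.List.Relation.Unary.All using (All; []; _∷_)
import Data.List.Relation.Unary.All.Properties as AllP
open import Data.List.Relation.Unary.AllPairs using ([]; _∷_)
open import Data.List.Relation.Unary.Any using (here; there)
open import Data.List.Relation.Unary.Unique.Propositional using (Unique)
import Data.List.Relation.Unary.Unique.Propositional.Properties as UniqueP
import Data.Nat as ℕ
import Data.Nat.DivMod as ℕD
open import Data.Nat.Induction using (<-wellFounded)
import Data.Nat.Properties as ℕP
open import Data.Nat.Tactic.RingSolver using () renaming (solve-∀ to solveℕ)
import Data.Product as Prod
open import Data.Product using (Σ; _×_; _,_; proj₁; proj₂)
open import Data.Sum using (_⊎_; inj₁; inj₂; [_,_]′)
open import Data.Sum.Properties using (≡-dec; inj₁-injective; inj₂-injective)
open import Function using (id; _∘_)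
open import Induction.WellFounded using (Acc; acc)
open import Relation.Binary.Definitions using (DecidableEquality; tri<; tri≈; tri>)
open import Relation.Binary.PropositionalEquality using (_≡_; refl; sym; trans; cong; cong₂; subst; subst₂; _≢_)
open import Relation.Nullary using (yes; no; Dec; ¬_; ¬?)
open import Relation.Nullary.Decidable using (⌊_⌋; _×-dec_)
open import Relation.Unary using (Decidable)

-- A live out-copy at time m is still live at the final time mT = P/h with probability mT/m. This
-- alone leaves about n/h out-copies unmatched. A live out-copy is therefore charged mT/m from the
-- beginning and a lost one 1, so that the ordinary shrinking of the live set costs nothing on
-- average. The obstacle is that out-copies are lost in proportion to the deficits of the live
-- out-degrees below the cap, a linear quantity, whereas V controls only squares. The inequality of
-- arithmetic and geometric means turns the linear deficit into a multiple of V plus a constant. The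
-- mean of V after a step is at most (1 - 2/m) V plus an error, and this gain of 2V/m pays for the
-- multiple of V. Probabilities 1/m need as many units of time as there are vertices, and the number
-- of colours is not bounded in terms of n. This is harmless, since all estimates depend on the
-- ratio h = P/mT only. The number 43 comes from comparing exponents: every size in the nibble
-- except n and r is a power of h, and n lies between h^43 and h^44.

module FiniteSums where

  -- Integer sums, inequalities by certificate, and averaging.

  open import Data.Integer using (ℤ; +_; 0ℤ; 1ℤ; _+_; _*_; _-_; -_; _≤_; _<_; _≤?_; +≤+; -[1+_]; nonNegative; positive)
  open import Data.Integer.Tactic.RingSolver using (solve-∀)

  private
    variable
      A B : Set

  infix 4 _≤by_

  0≤+ : ∀ {a b} → 0ℤ ≤ a → 0ℤ ≤ b → 0ℤ ≤ a + b
  0≤+ p q = ℤP.+-mono-≤ p q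

  0≤* : ∀ {a b} → 0ℤ ≤ a → 0ℤ ≤ b → 0ℤ ≤ a * b
  0≤* {a} {b} p q = subst (_≤ a * b) (ℤP.*-zeroʳ a) (ℤP.*-monoˡ-≤-nonNeg a {{nonNegative p}} q)

  0≤sq : ∀ a → 0ℤ ≤ a * a
  0≤sq (+ n) = 0≤* {+ n} {+ n} (+≤+ ℕ.z≤n) (+≤+ ℕ.z≤n)
  0≤sq (-[1+ n ]) = +≤+ ℕ.z≤n

  0≤n : ∀ n → 0ℤ ≤ + n
  0≤n n = +≤+ ℕ.z≤n

  gap : ∀ {a b} → a ≤ b → 0ℤ ≤ b - a
  gap = ℤP.i≤j⇒0≤j-i

  -- The tool for polynomial inequalities: the difference of the two sides is displayed as a sum of
  -- products of nonnegative quantities, and the ring solver checks the identity. Such a displayed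
  -- difference is the whole content of many proofs below.
  _≤by_ : ∀ {a b c} → 0ℤ ≤ c → b ≡ a + c → a ≤ b
  _≤by_ {a} {b} {c} p e = subst₂ _≤_ (ℤP.+-identityʳ a) (sym e) (ℤP.+-monoʳ-≤ a p)

  ungap : ∀ {a b} → 0ℤ ≤ b - a → a ≤ b
  ungap {a} {b} p = p ≤by lem a b
    where lem : ∀ a b → b ≡ a + (b - a)
          lem = solve-∀

  *-mono-nn : ∀ {a b c d} → 0ℤ ≤ a → 0ℤ ≤ d → a ≤ b → c ≤ d → a * c ≤ b * d
  *-mono-nn {a} {b} {c} {d} p q r s =
    ℤP.≤-trans (ℤP.*-monoˡ-≤-nonNeg a {{nonNegative p}} s) (ℤP.*-monoʳ-≤-nonNeg d {{nonNegative q}} r)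

  *-monoˡ-nn : ∀ {a b c} → 0ℤ ≤ a → b ≤ c → a * b ≤ a * c
  *-monoˡ-nn {a} p q = ℤP.*-monoˡ-≤-nonNeg a {{nonNegative p}} q

  *-monoʳ-nn : ∀ {a b c} → 0ℤ ≤ a → b ≤ c → b * a ≤ c * a
  *-monoʳ-nn {a} p q = ℤP.*-monoʳ-≤-nonNeg a {{nonNegative p}} q

  cancelˡ : ∀ {a b c} → 0ℤ < a → a * b ≤ a * c → b ≤ c
  cancelˡ {a} {b} {c} p q = ℤP.*-cancelˡ-≤-pos b c a {{positive p}} q

  ∑ : List A → (A → ℤ) → ℤ
  ∑ []       f = 0ℤ
  ∑ (x ∷ xs) f = f x + ∑ xs f

  ∑-cong : ∀ (xs : List A) {f g} → (∀ x → f x ≡ g x) → ∑ xs f ≡ ∑ xs g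
  ∑-cong []       e = refl
  ∑-cong (x ∷ xs) e = cong₂ _+_ (e x) (∑-cong xs e)

  ∑-mono : ∀ (xs : List A) {f g} → (∀ x → f x ≤ g x) → ∑ xs f ≤ ∑ xs g
  ∑-mono []       e = ℤP.≤-refl
  ∑-mono (x ∷ xs) e = ℤP.+-mono-≤ (e x) (∑-mono xs e)

  ∑-mono-∈ : ∀ (xs : List A) {f g} → (∀ x → x ∈ xs → f x ≤ g x) → ∑ xs f ≤ ∑ xs g
  ∑-mono-∈ []       e = ℤP.≤-refl
  ∑-mono-∈ (x ∷ xs) e = ℤP.+-mono-≤ (e x (here refl)) (∑-mono-∈ xs (λ y i → e y (there i)))

  ∑-0 : ∀ (xs : List A) → ∑ xs (λ _ → 0ℤ) ≡ 0ℤ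
  ∑-0 []       = refl
  ∑-0 (x ∷ xs) = trans (ℤP.+-identityˡ _) (∑-0 xs)

  ∑-0≤ : ∀ (xs : List A) {f} → (∀ x → 0ℤ ≤ f x) → 0ℤ ≤ ∑ xs f
  ∑-0≤ xs {f} p = subst (_≤ ∑ xs f) (∑-0 xs) (∑-mono xs p)

  ∑-+ : ∀ (xs : List A) f g → ∑ xs (λ x → f x + g x) ≡ ∑ xs f + ∑ xs g
  ∑-+ []       f g = refl
  ∑-+ (x ∷ xs) f g = trans (cong (_+_ (f x + g x)) (∑-+ xs f g)) (lem (f x) (g x) _ _)
    where lem : ∀ a b c d → a + b + (c + d) ≡ a + c + (b + d)
          lem = solve-∀

  ∑-*ˡ : ∀ (xs : List A) c f → ∑ xs (λ x → c * f x) ≡ c * ∑ xs f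
  ∑-*ˡ []       c f = sym (ℤP.*-zeroʳ c)
  ∑-*ˡ (x ∷ xs) c f = trans (cong (_+_ (c * f x)) (∑-*ˡ xs c f)) (sym (ℤP.*-distribˡ-+ c (f x) _))

  ∑-*ʳ : ∀ (xs : List A) c f → ∑ xs (λ x → f x * c) ≡ ∑ xs f * c
  ∑-*ʳ xs c f = trans (∑-cong xs (λ x → ℤP.*-comm (f x) c)) (trans (∑-*ˡ xs c f) (ℤP.*-comm c _))

  ∑-neg : ∀ (xs : List A) f → ∑ xs (λ x → - f x) ≡ - ∑ xs f
  ∑-neg []       f = refl
  ∑-neg (x ∷ xs) f = trans (cong (_+_ (- f x)) (∑-neg xs f)) (sym (ℤP.neg-distrib-+ (f x) _))

  ∑-sub : ∀ (xs : List A) f g → ∑ xs (λ x → f x - g x) ≡ ∑ xs f - ∑ xs g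
  ∑-sub xs f g = trans (∑-+ xs f (λ x → - g x)) (cong (_+_ (∑ xs f)) (∑-neg xs g))

  ∑-swap : ∀ (xs : List A) (ys : List B) (f : A → B → ℤ) →
           ∑ xs (λ x → ∑ ys (f x)) ≡ ∑ ys (λ y → ∑ xs (λ x → f x y))
  ∑-swap []       ys f = sym (∑-0 ys)
  ∑-swap (x ∷ xs) ys f = trans (cong (_+_ (∑ ys (f x))) (∑-swap xs ys f)) (sym (∑-+ ys (f x) _))

  ∑-++ : ∀ (xs ys : List A) f → ∑ (xs ++ ys) f ≡ ∑ xs f + ∑ ys f
  ∑-++ []       ys f = sym (ℤP.+-identityˡ _)
  ∑-++ (x ∷ xs) ys f = trans (cong (_+_ (f x)) (∑-++ xs ys f)) (sym (ℤP.+-assoc (f x) _ _))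

  ∑-map : ∀ (g : A → B) (xs : List A) f → ∑ (map g xs) f ≡ ∑ xs (λ x → f (g x))
  ∑-map g []       f = refl
  ∑-map g (x ∷ xs) f = cong (_+_ (f (g x))) (∑-map g xs f)

  ∑-const : ∀ (xs : List A) c → ∑ xs (λ _ → c) ≡ + length xs * c
  ∑-const []       c = refl
  ∑-const (x ∷ xs) c = trans (cong (_+_ (c)) (∑-const xs c)) (lem (+ length xs) c)
    where lem : ∀ l c → c + l * c ≡ (1ℤ + l) * c
          lem = solve-∀

  ∑-single≤ : ∀ (xs : List A) {f} → (∀ x → 0ℤ ≤ f x) → ∀ {x} → x ∈ xs → f x ≤ ∑ xs f
  ∑-single≤ (x ∷ xs) {f} p (here refl) = ∑-0≤ xs p ≤by refl
  ∑-single≤ (y ∷ xs) {f} p {x} (there i) =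
    ℤP.≤-trans (∑-single≤ xs p i) (p y ≤by ℤP.+-comm (f y) (∑ xs f))

  -- Pigeonhole in place of probability. Over the integers a failure of `F x ≤ B` means
  -- `F x - B ≥ 1`. If every entry of positive weight failed, the weighted excess would be at least
  -- the total weight, hence positive, while the hypothesis makes it at most zero. Positivity of the
  -- chosen weight later certifies that a chosen edge is live.
  ∑-average : ∀ (xs : List A) (w F : A → ℤ) B → (∀ x → 0ℤ ≤ w x) → 0ℤ < ∑ xs w →
              ∑ xs (λ x → w x * F x) ≤ ∑ xs w * B →
              Σ A λ x → x ∈ xs × 0ℤ < w x × F x ≤ B
  ∑-average {A = A} xs w F B w≥0 W>0 le = decide (search xs)
    where
    Found : List A → Set
    Found ys = Σ A λ x → x ∈ ys × 0ℤ < w x × F x ≤ B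
    excess : A → ℤ
    excess x = w x * (F x - B)
    ∑excess≤0 : ∑ xs excess ≤ 0ℤ
    ∑excess≤0 = subst (_≤ 0ℤ) (sym (trans (∑-cong xs (λ x → expand (w x) (F x) B))
            (trans (∑-sub xs _ _) (cong (_-_ (∑ xs (λ x → w x * F x))) (∑-*ʳ xs B w)))))
            (ℤP.i≤j⇒i-j≤0 le)
      where expand : ∀ a b c → a * (b - c) ≡ a * b - a * c
            expand = solve-∀
    test : ∀ y → (0ℤ < w y × F y ≤ B) ⊎ w y ≤ excess y
    test y with 0ℤ ℤP.<? w y | F y ≤? B
    ... | yes q | yes p = inj₁ (q , p)
    ... | no ¬q | _     = inj₂ (subst (λ z → z ≤ z * (F y - B)) (ℤP.≤-antisym (w≥0 y) (ℤP.≮⇒≥ ¬q)) ℤP.≤-refl)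
    ... | yes q | no ¬p = inj₂ (subst (_≤ excess y) (ℤP.*-identityʳ (w y))
          (*-monoˡ-nn (w≥0 y) (ungap (subst (0ℤ ≤_) (shift (F y) B) (gap (ℤP.i<j⇒suc[i]≤j (ℤP.≰⇒> ¬p)))))))
        where shift : ∀ f b → f - (1ℤ + b) ≡ f - b - 1ℤ
              shift = solve-∀
    search : ∀ ys → Found ys ⊎ ∑ ys w ≤ ∑ ys excess
    search [] = inj₂ ℤP.≤-refl
    search (y ∷ ys) with test y | search ys
    ... | inj₁ (q , p) | _ = inj₁ (y , here refl , q , p)
    ... | inj₂ _ | inj₁ (x , i , qp) = inj₁ (x , there i , qp)
    ... | inj₂ a | inj₂ b = inj₂ (ℤP.+-mono-≤ a b)
    decide : Found xs ⊎ ∑ xs w ≤ ∑ xs excess → Found xs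
    decide (inj₁ f) = f
    decide (inj₂ b) = ⊥-elim (ℤP.<⇒≱ W>0 (ℤP.≤-trans b ∑excess≤0))

-- The second moment inequality at a single vertex.

module SecondMoment where
  open FiniteSums
  open import Data.Integer using (ℤ; +_; 0ℤ; 1ℤ; _+_; _*_; _-_; -_; _≤_)
  open import Data.Integer.Tactic.RingSolver using (solve-∀)

  -- q is P² and e is the weighted mean loss of degree at a vertex of degree d.
  module _ (κ m q d d₀ e : ℤ) where
    private
      Y Z g : ℤ
      Y = q * d - d₀ * ((m - 1ℤ) * (m - 1ℤ))
      Z = q * d - d₀ * (m * m)
      g = d₀ * (+ 2 * m - 1ℤ)

    -- Here Z is the deviation at time m, and Y = Z + g is measured against the target of time m - 1
    -- before the loss is subtracted. The left side expands the mean of the new squared deviation,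
    -- with 3 times the loss in place of its square. As e is close to 2κd, the cross term pulls the
    -- degree towards its target, strongly enough to offset the movement of the target and to lower
    -- the factor m - 1 to m - 2.
    second-moment-step : 0ℤ ≤ κ → + 2 ≤ m → 0ℤ ≤ q → 0ℤ ≤ d → d ≤ κ → d ≤ d₀ → 1ℤ ≤ d₀ → d₀ * m ≤ q →
      + 2 * (κ * d) - + 3 * d ≤ e → e ≤ + 2 * (κ * d) →
      (κ * m - κ) * (Y * Y) - + 2 * (q * Y * e) + q * q * (+ 3 * e)
        ≤ κ * ((m - + 2) * (Z * Z) + + 12 * (q * q * d₀))
    -- The sign of Y decides which of the two bounds on e is the useful one in the cross term.
    second-moment-step κ≥0 m≥2 q≥0 d≥0 d≤κ d≤d₀ d₀≥1 d₀m≤q lo hi with ℤP.≤-total 0ℤ Y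
    ... | inj₁ Y≥0 =
      0≤+ (0≤* κ≥0 (0≤+ (0≤+ (0≤+ (0≤+ (0≤* (gap m≥2) (0≤sq g)) (0≤* (0≤n 3) (0≤sq (Y - q))))
              (0≤* (0≤* (0≤n 2) (0≤* (ℤP.≤-trans (0≤n 2) m≥2) (ℤP.≤-trans (0≤n 1) d₀≥1))) Y≥0))
              (0≤* (0≤* (0≤n 6) (0≤sq q)) (gap d≤d₀)))
              (0≤* (0≤* (0≤n 3) (0≤sq q)) (0≤+ (0≤n 1) (0≤* (0≤n 2) (gap d₀≥1))))))
        (0≤+ (0≤+ (0≤* (0≤* (0≤n 2) (0≤* q≥0 Y≥0)) (gap lo))
                  (0≤* (0≤* (0≤n 3) (0≤sq q)) (gap hi)))
             (0≤* (0≤* (0≤n 6) (0≤* q≥0 Y≥0)) (gap d≤κ)))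
      ≤by eq κ m q d d₀ e
      where
      eq : ∀ κ m q d d₀ e →
        κ * ((m - + 2) * ((q * d - d₀ * (m * m)) * (q * d - d₀ * (m * m))) + + 12 * (q * q * d₀)) ≡
        (κ * m - κ) * ((q * d - d₀ * ((m - 1ℤ) * (m - 1ℤ))) * (q * d - d₀ * ((m - 1ℤ) * (m - 1ℤ))))
          - + 2 * (q * (q * d - d₀ * ((m - 1ℤ) * (m - 1ℤ))) * e) + q * q * (+ 3 * e) +
        (κ * ((m - + 2) * ((d₀ * (+ 2 * m - 1ℤ)) * (d₀ * (+ 2 * m - 1ℤ)))
             + + 3 * ((q * d - d₀ * ((m - 1ℤ) * (m - 1ℤ)) - q) * (q * d - d₀ * ((m - 1ℤ) * (m - 1ℤ)) - q))
             + + 2 * (m * d₀) * (q * d - d₀ * ((m - 1ℤ) * (m - 1ℤ)))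
             + + 6 * (q * q) * (d₀ - d) + + 3 * (q * q) * (1ℤ + + 2 * (d₀ - 1ℤ)))
        + (+ 2 * (q * (q * d - d₀ * ((m - 1ℤ) * (m - 1ℤ)))) * (e - (+ 2 * (κ * d) - + 3 * d))
          + + 3 * (q * q) * (+ 2 * (κ * d) - e)
          + + 6 * (q * (q * d - d₀ * ((m - 1ℤ) * (m - 1ℤ)))) * (κ - d)))
      eq = solve-∀
    ... | inj₂ Y≤0 =
      0≤+ (0≤* κ≥0 (0≤+ (0≤+ (0≤+ (0≤+ (0≤+ (0≤* (gap m≥2) (0≤sq g)) (0≤* (0≤n 2) (0≤sq Y))) (0≤sq (Y + q)))
              (0≤* (0≤* (0≤n 2) (gap d₀m≤q)) y≥0))
              (0≤* (0≤* (0≤n 6) (0≤sq q)) (gap d≤d₀)))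
              (0≤* (0≤sq q) (0≤+ (0≤n 5) (0≤* (0≤n 6) (gap d₀≥1))))))
        (0≤+ (0≤* (0≤* (0≤n 2) (0≤* q≥0 y≥0)) (gap hi))
                  (0≤* (0≤* (0≤n 3) (0≤sq q)) (gap hi)))
      ≤by eq κ m q d d₀ e
      where
      y≥0 : 0ℤ ≤ - Y
      y≥0 = ℤP.neg-mono-≤ Y≤0
      eq : ∀ κ m q d d₀ e →
        κ * ((m - + 2) * ((q * d - d₀ * (m * m)) * (q * d - d₀ * (m * m))) + + 12 * (q * q * d₀)) ≡
        (κ * m - κ) * ((q * d - d₀ * ((m - 1ℤ) * (m - 1ℤ))) * (q * d - d₀ * ((m - 1ℤ) * (m - 1ℤ))))
          - + 2 * (q * (q * d - d₀ * ((m - 1ℤ) * (m - 1ℤ))) * e) + q * q * (+ 3 * e) +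
        (κ * ((m - + 2) * ((d₀ * (+ 2 * m - 1ℤ)) * (d₀ * (+ 2 * m - 1ℤ)))
             + + 2 * ((q * d - d₀ * ((m - 1ℤ) * (m - 1ℤ))) * (q * d - d₀ * ((m - 1ℤ) * (m - 1ℤ))))
             + (q * d - d₀ * ((m - 1ℤ) * (m - 1ℤ)) + q) * (q * d - d₀ * ((m - 1ℤ) * (m - 1ℤ)) + q)
             + + 2 * (q - d₀ * m) * (- (q * d - d₀ * ((m - 1ℤ) * (m - 1ℤ))))
             + + 6 * (q * q) * (d₀ - d) + (q * q) * (+ 5 + + 6 * (d₀ - 1ℤ)))
        + (+ 2 * (q * (- (q * d - d₀ * ((m - 1ℤ) * (m - 1ℤ))))) * (+ 2 * (κ * d) - e)
          + + 3 * (q * q) * (+ 2 * (κ * d) - e)))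
      eq = solve-∀

-- Linear 3-uniform hypergraphs and the loss of degree when vertices are killed.

module Hypergraphs where
  open FiniteSums
  open import Data.Integer using (ℤ; +_; 0ℤ; 1ℤ; _+_; _*_; _-_; -_; _≤_; _≤ᵇ_)
  open import Data.Integer.Tactic.RingSolver using (solve-∀)
  open import Data.Bool using (T)

  b2z : Bool → ℤ
  b2z true  = 1ℤ
  b2z false = 0ℤ

  b2z≥0 : ∀ b → 0ℤ ≤ b2z b
  b2z≥0 true  = 0≤n 1
  b2z≥0 false = 0≤n 0

  b2z≤1 : ∀ b → b2z b ≤ 1ℤ
  b2z≤1 true  = ℤP.≤-refl
  b2z≤1 false = 0≤n 1

  private
    every : (Bool → Bool) → Bool
    every P = P true ∧ P false

    every-sound : ∀ P → every P ≡ true → ∀ b → P b ≡ true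
    every-sound P h b with P true in t | P false in f
    every-sound P h true  | true | true = t
    every-sound P h false | true | true = f

  -- For closed `f` and `g` the premise is proved by evaluation of all eight cases.
  truth-table : ∀ (f g : Bool → Bool → Bool → ℤ) → every (λ u → every (λ v → every (λ w → f u v w ≤ᵇ g u v w))) ≡ true →
                ∀ u v w → f u v w ≤ g u v w
  truth-table f g h u v w = ℤP.≤ᵇ⇒≤ (subst T (sym (every-sound (λ w → f u v w ≤ᵇ g u v w) (every-sound (λ v → every (λ w → f u v w ≤ᵇ g u v w))
    (every-sound (λ u → every (λ v → every (λ w → f u v w ≤ᵇ g u v w))) h u) v) w)) _)

  record Hypergraph : Set₁ where
    field
      X E  : Set
      _≟_  : DecidableEquality X
      xs   : List X
      es   : List E
      p₁ p₂ p₃ : E → X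

    δ : X → X → ℤ
    δ x y = b2z ⌊ x ≟ y ⌋

    inc : E → X → ℤ
    inc e x = δ (p₁ e) x + δ (p₂ e) x + δ (p₃ e) x

    field
      xs-complete : ∀ x → x ∈ xs
      once : ∀ y → ∑ xs (δ y) ≡ 1ℤ
      p₁≢p₂ : ∀ e → p₁ e ≢ p₂ e
      p₁≢p₃ : ∀ e → p₁ e ≢ p₃ e
      p₂≢p₃ : ∀ e → p₂ e ≢ p₃ e
      linear : ∀ x y → x ≢ y → ∑ es (λ e → inc e x * inc e y) ≤ 1ℤ

  module HypergraphProperties (H : Hypergraph) where
    open Hypergraph H public

    δ-refl : ∀ x → δ x x ≡ 1ℤ
    δ-refl x with x ≟ x
    ... | yes _ = refl
    ... | no ¬p = ⊥-elim (¬p refl)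

    δ-≢ : ∀ {x y} → x ≢ y → δ x y ≡ 0ℤ
    δ-≢ {x} {y} p with x ≟ y
    ... | yes q = ⊥-elim (p q)
    ... | no _  = refl

    δ-sym : ∀ x y → δ x y ≡ δ y x
    δ-sym x y with x ≟ y
    ... | yes refl = sym (δ-refl x)
    ... | no ¬p = sym (δ-≢ (λ q → ¬p (sym q)))

    ∑-δ : ∀ z (f : X → ℤ) → ∑ xs (λ y → δ z y * f y) ≡ f z
    ∑-δ z f = trans (∑-cong xs pt) (trans (∑-*ʳ xs (f z) (δ z)) (trans (cong (_* f z) (once z)) (ℤP.*-identityˡ _)))
      where pt : ∀ y → δ z y * f y ≡ δ z y * f z
            pt y with z ≟ y
            ... | yes refl = refl
            ... | no _ = refl

    inc≥0 : ∀ e x → 0ℤ ≤ inc e x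
    inc≥0 e x = 0≤+ (0≤+ (b2z≥0 ⌊ p₁ e ≟ x ⌋) (b2z≥0 ⌊ p₂ e ≟ x ⌋)) (b2z≥0 ⌊ p₃ e ≟ x ⌋)

    ∑-inc : ∀ e (f : X → ℤ) → ∑ xs (λ y → inc e y * f y) ≡ f (p₁ e) + f (p₂ e) + f (p₃ e)
    ∑-inc e f = trans (∑-cong xs (λ y → expand (δ (p₁ e) y) (δ (p₂ e) y) (δ (p₃ e) y) (f y)))
      (trans (∑-+ xs _ _) (cong₂ _+_ (trans (∑-+ xs _ _) (cong₂ _+_ (∑-δ _ f) (∑-δ _ f))) (∑-δ _ f)))
      where expand : ∀ a b c d → (a + b + c) * d ≡ a * d + b * d + c * d
            expand = solve-∀

    killₑ : E → X → Bool
    killₑ e y = ⌊ p₁ e ≟ y ⌋ ∨ ⌊ p₂ e ≟ y ⌋ ∨ ⌊ p₃ e ≟ y ⌋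

    killₑ-inc : ∀ e y → b2z (killₑ e y) ≡ inc e y
    killₑ-inc e y with p₁ e ≟ y | p₂ e ≟ y | p₃ e ≟ y
    ... | yes a | yes b | _     = ⊥-elim (p₁≢p₂ e (trans a (sym b)))
    ... | yes a | no _  | yes c = ⊥-elim (p₁≢p₃ e (trans a (sym c)))
    ... | no _  | yes b | yes c = ⊥-elim (p₂≢p₃ e (trans b (sym c)))
    ... | yes _ | no _  | no _  = refl
    ... | no _  | yes _ | no _  = refl
    ... | no _  | no _  | yes _ = refl
    ... | no _  | no _  | no _  = refl

    inc≤1 : ∀ e y → inc e y ≤ 1ℤ
    inc≤1 e y = subst (_≤ 1ℤ) (killₑ-inc e y) (b2z≤1 (killₑ e y))

    inc-elim : ∀ (Q : X → Set) e x → (inc e x ≡ 0ℤ → Q x) → Q (p₁ e) → Q (p₂ e) → Q (p₃ e) → Q x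
    inc-elim Q e x q₀ q₁ q₂ q₃ with p₁ e ≟ x | p₂ e ≟ x | p₃ e ≟ x
    ... | yes refl | _ | _ = q₁
    ... | no _ | yes refl | _ = q₂
    ... | no _ | no _ | yes refl = q₃
    ... | no _ | no _ | no _ = q₀ refl

    inc-mono : ∀ e x (f g : X → ℤ) → f (p₁ e) ≤ g (p₁ e) → f (p₂ e) ≤ g (p₂ e) → f (p₃ e) ≤ g (p₃ e) →
               inc e x * f x ≤ inc e x * g x
    inc-mono e x f g h₁ h₂ h₃ =
      inc-elim (λ y → inc e y * f y ≤ inc e y * g y) e x
        (λ z → subst (λ i → i * f x ≤ i * g x) (sym z) ℤP.≤-refl)
        (*-monoˡ-nn (inc≥0 e _) h₁) (*-monoˡ-nn (inc≥0 e _) h₂) (*-monoˡ-nn (inc≥0 e _) h₃)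

    State : Set
    State = X → Bool

    live : State → E → Bool
    live a e = a (p₁ e) ∧ a (p₂ e) ∧ a (p₃ e)

    deg : State → X → ℤ
    deg a x = ∑ es (λ e → b2z (live a e) * inc e x)

    deg₀ : X → ℤ
    deg₀ x = ∑ es (λ e → inc e x)

    size : State → ℤ
    size a = ∑ es (λ e → b2z (live a e))

    _∖_ : State → (X → Bool) → State
    (a ∖ k) x = a x ∧ not (k x)

    hit : (X → Bool) → E → Bool
    hit k e = k (p₁ e) ∨ k (p₂ e) ∨ k (p₃ e)

    loss : State → (X → Bool) → X → ℤ
    loss a k x = ∑ es (λ e → b2z (live a e) * (inc e x * b2z (hit k e)))

    deg≥0 : ∀ a x → 0ℤ ≤ deg a x
    deg≥0 a x = ∑-0≤ es (λ e → 0≤* (b2z≥0 (live a e)) (inc≥0 e x))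

    deg≤deg₀ : ∀ a x → deg a x ≤ deg₀ x
    deg≤deg₀ a x = ∑-mono es (λ e → subst (b2z (live a e) * inc e x ≤_) (ℤP.*-identityˡ _)
                     (*-monoʳ-nn (inc≥0 e x) (b2z≤1 (live a e))))

    loss≥0 : ∀ a k x → 0ℤ ≤ loss a k x
    loss≥0 a k x = ∑-0≤ es (λ e → 0≤* (b2z≥0 (live a e)) (0≤* (inc≥0 e x) (b2z≥0 (hit k e))))

    live-∖ : ∀ a k e → b2z (live (a ∖ k) e) ≡ b2z (live a e) - b2z (live a e) * b2z (hit k e)
    live-∖ a k e = table (a (p₁ e)) (a (p₂ e)) (a (p₃ e)) (k (p₁ e)) (k (p₂ e)) (k (p₃ e))
      where
      table : ∀ a b c u v w → b2z ((a ∧ not u) ∧ (b ∧ not v) ∧ (c ∧ not w))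
              ≡ b2z (a ∧ b ∧ c) - b2z (a ∧ b ∧ c) * b2z (u ∨ v ∨ w)
      table false _ _ _ _ _ = refl
      table true false _ true _ _ = refl
      table true false _ false _ _ = refl
      table true true false true _ _ = refl
      table true true false false true _ = refl
      table true true false false false _ = refl
      table true true true true _ _ = refl
      table true true true false true _ = refl
      table true true true false false true = refl
      table true true true false false false = refl

    deg-∖ : ∀ a k x → deg (a ∖ k) x ≡ deg a x - loss a k x
    deg-∖ a k x = trans (∑-cong es (λ e → trans (cong (_* inc e x) (live-∖ a k e)) (expand (b2z (live a e)) (b2z (hit k e)) (inc e x)))) (∑-sub es _ _)
      where expand : ∀ l h i → (l - l * h) * i ≡ l * i - l * (i * h)
            expand = solve-∀

    ∑-deg : ∀ a (f : X → ℤ) → ∑ xs (λ x → deg a x * f x)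
            ≡ ∑ es (λ e → b2z (live a e) * (f (p₁ e) + f (p₂ e) + f (p₃ e)))
    ∑-deg a f = trans (∑-cong xs (λ x → sym (∑-*ʳ es (f x) _)))
      (trans (∑-swap xs es _)
      (∑-cong es (λ e → trans (∑-cong xs (λ x → ℤP.*-assoc (b2z (live a e)) (inc e x) (f x)))
        (trans (∑-*ˡ xs (b2z (live a e)) _) (cong (_*_ (b2z (live a e))) (∑-inc e f))))))

    ∑-deg₀ : ∑ xs deg₀ ≡ + 3 * + length es
    ∑-deg₀ = trans (∑-swap xs es (λ x e → inc e x))
      (trans (∑-cong es (λ e → trans (∑-cong xs (λ y → sym (ℤP.*-identityʳ (inc e y)))) (∑-inc e (λ _ → 1ℤ))))
        (trans (∑-const es (+ 3)) (ℤP.*-comm (+ length es) (+ 3))))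

    module _ (k : X → Bool) where
      K : X → ℤ
      K x = b2z (k x)

      surv : X → ℤ
      surv x = 1ℤ - K x

      others : E → X → ℤ
      others e x = K (p₁ e) + K (p₂ e) + K (p₃ e) - K x

      pairs : E → ℤ
      pairs e = K (p₁ e) * K (p₂ e) + K (p₁ e) * K (p₃ e) + K (p₂ e) * K (p₃ e)

      -- Union bound: an edge at a surviving vertex is hit only through one of its two other
      -- vertices.
      hit-upper : ∀ e x → inc e x * (surv x * b2z (hit k e)) ≤ inc e x * others e x
      hit-upper e x = inc-mono e x (λ x → surv x * b2z (hit k e)) (others e) (t₁ k₁ k₂ k₃) (t₂ k₁ k₂ k₃) (t₃ k₁ k₂ k₃)
        where
        k₁ = k (p₁ e)
        k₂ = k (p₂ e)
        k₃ = k (p₃ e)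
        f g : Bool → Bool → Bool → Bool → ℤ
        f x u v w = (1ℤ - b2z x) * b2z (u ∨ v ∨ w)
        g x u v w = b2z u + b2z v + b2z w - b2z x
        t₁ = truth-table (λ u v w → f u u v w) (λ u v w → g u u v w) refl
        t₂ = truth-table (λ u v w → f v u v w) (λ u v w → g v u v w) refl
        t₃ = truth-table (λ u v w → f w u v w) (λ u v w → g w u v w) refl

      -- Second Bonferroni inequality. For a surviving x the product of the two other indicators
      -- would be enough in `pairs`; the remaining two products make the left side nonpositive when
      -- x itself is killed.
      hit-lower : ∀ e x → inc e x * (others e x - pairs e) ≤ inc e x * (surv x * b2z (hit k e))
      hit-lower e x = inc-mono e x (λ x → others e x - pairs e) (λ x → surv x * b2z (hit k e)) (t₁ k₁ k₂ k₃) (t₂ k₁ k₂ k₃) (t₃ k₁ k₂ k₃)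
        where
        k₁ = k (p₁ e)
        k₂ = k (p₂ e)
        k₃ = k (p₃ e)
        f g : Bool → Bool → Bool → Bool → ℤ
        f x u v w = b2z u + b2z v + b2z w - b2z x - (b2z u * b2z v + b2z u * b2z w + b2z v * b2z w)
        g x u v w = (1ℤ - b2z x) * b2z (u ∨ v ∨ w)
        t₁ = truth-table (λ u v w → f u u v w) (λ u v w → g u u v w) refl
        t₂ = truth-table (λ u v w → f v u v w) (λ u v w → g v u v w) refl
        t₃ = truth-table (λ u v w → f w u v w) (λ u v w → g w u v w) refl

      surv*loss : ∀ a x → surv x * loss a k x ≡ ∑ es (λ e → b2z (live a e) * (inc e x * (surv x * b2z (hit k e))))
      surv*loss a x = trans (sym (∑-*ˡ es (surv x) _)) (∑-cong es (λ e → mv (surv x) (b2z (live a e)) (inc e x) (b2z (hit k e))))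
        where mv : ∀ s l i h → s * (l * (i * h)) ≡ l * (i * (s * h))
              mv = solve-∀

      surv*loss≤ : ∀ a x → surv x * loss a k x ≤ ∑ es (λ e → b2z (live a e) * (inc e x * others e x))
      surv*loss≤ a x = subst (_≤ ∑ es (λ e → b2z (live a e) * (inc e x * others e x))) (sym (surv*loss a x)) (∑-mono es (λ e → *-monoˡ-nn (b2z≥0 (live a e)) (hit-upper e x)))

      ≤surv*loss : ∀ a x → ∑ es (λ e → b2z (live a e) * (inc e x * (others e x - pairs e))) ≤ surv x * loss a k x
      ≤surv*loss a x = subst (∑ es (λ e → b2z (live a e) * (inc e x * (others e x - pairs e))) ≤_) (sym (surv*loss a x)) (∑-mono es (λ e → *-monoˡ-nn (b2z≥0 (live a e)) (hit-lower e x)))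

      -- By linearity each killed vertex destroys at most one edge at a surviving vertex.
      surv*loss≤∑K : ∀ a x → surv x * loss a k x ≤ ∑ xs K
      surv*loss≤∑K a x = ℤP.≤-trans (surv*loss≤ a x)
        (ℤP.≤-trans (∑-mono es drop-live)
        (subst (_≤ ∑ xs K) (sym rearrange) (∑-mono xs per-vertex)))
        where
        others' : ∀ e → others e x ≡ ∑ xs (λ y → (inc e y - δ x y) * K y)
        others' e = sym (trans (∑-cong xs (λ y → expand (inc e y) (δ x y) (K y)))
                     (trans (∑-sub xs _ _) (cong₂ _-_ (∑-inc e K) (∑-δ x K))))
          where expand : ∀ a b c → (a - b) * c ≡ a * c - b * c
                expand = solve-∀
        others≥0 : ∀ e → 0ℤ ≤ inc e x * others e x
        others≥0 e = subst (_≤ inc e x * others e x) (ℤP.*-zeroʳ (inc e x))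
          (inc-mono e x (λ _ → 0ℤ) (others e)
            (subst (0ℤ ≤_) (s₁ (K (p₁ e)) (K (p₂ e)) (K (p₃ e))) (0≤+ (b2z≥0 (k (p₂ e))) (b2z≥0 (k (p₃ e)))))
            (subst (0ℤ ≤_) (s₂ (K (p₁ e)) (K (p₂ e)) (K (p₃ e))) (0≤+ (b2z≥0 (k (p₁ e))) (b2z≥0 (k (p₃ e)))))
            (subst (0ℤ ≤_) (s₃ (K (p₁ e)) (K (p₂ e)) (K (p₃ e))) (0≤+ (b2z≥0 (k (p₁ e))) (b2z≥0 (k (p₂ e))))))
          where s₁ : ∀ u v w → v + w ≡ u + v + w - u
                s₁ = solve-∀
                s₂ : ∀ u v w → u + w ≡ u + v + w - v
                s₂ = solve-∀
                s₃ : ∀ u v w → u + v ≡ u + v + w - w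
                s₃ = solve-∀
        drop-live : ∀ e → b2z (live a e) * (inc e x * others e x) ≤ inc e x * others e x
        drop-live e = subst (b2z (live a e) * (inc e x * others e x) ≤_) (ℤP.*-identityˡ _)
                        (*-monoʳ-nn (others≥0 e) (b2z≤1 (live a e)))
        -- Linearity speaks of two distinct vertices only. The correction `δ x y` takes care of y =
        -- x, where every term inc · (inc - 1) is at most 0.
        codeg : X → ℤ
        codeg y = ∑ es (λ e → inc e x * (inc e y - δ x y))
        rearrange : ∑ es (λ e → inc e x * others e x) ≡ ∑ xs (λ y → codeg y * K y)
        rearrange = trans (∑-cong es (λ e → trans (cong (_*_ (inc e x)) (others' e))
                       (trans (sym (∑-*ˡ xs (inc e x) _)) (∑-cong xs (λ y → sym (ℤP.*-assoc (inc e x) _ (K y)))))))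
                     (trans (∑-swap es xs _) (∑-cong xs (λ y → ∑-*ʳ es (K y) _)))
        codeg≤1 : ∀ y → codeg y ≤ 1ℤ
        codeg≤1 y with x ≟ y
        ... | yes refl = ℤP.≤-trans (∑-mono es (λ e → subst (inc e x * (inc e x - 1ℤ) ≤_) (ℤP.*-zeroʳ (inc e x))
                            (*-monoˡ-nn (inc≥0 e x) (ℤP.i≤j⇒i-j≤0 (inc≤1 e x)))))
                            (subst (_≤ 1ℤ) (sym (∑-0 es)) (0≤n 1))
        ... | no ne = subst (_≤ 1ℤ) (∑-cong es (λ e → cong (_*_ (inc e x)) (sym (ℤP.+-identityʳ (inc e y))))) (linear x y ne)
        per-vertex : ∀ y → codeg y * K y ≤ K y
        per-vertex y = subst (codeg y * K y ≤_) (ℤP.*-identityˡ (K y)) (*-monoʳ-nn (b2z≥0 (k y)) (codeg≤1 y))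

-- One random step, its mean effect on the degrees and on V.

module RandomDeletion where
  open FiniteSums
  open SecondMoment
  open Hypergraphs
  open import Data.Integer using (ℤ; +_; 0ℤ; 1ℤ; _+_; _*_; _-_; -_; _≤_; +≤+)
  open import Data.Integer.Tactic.RingSolver using (solve-∀)

  bool-cases : ∀ {C : Set} b → (b ≡ true → C) → (b ≡ false → C) → C
  bool-cases true  f g = f refl
  bool-cases false f g = g refl

  module _ (H : Hypergraph) where
    open HypergraphProperties H

    -- Probabilities are multiplied by κm in order to be integers: `𝔼` is a sum with weights of
    -- total κm, and an event of weight κ has probability 1/m.
    module Sampling (a : State) (κ m : ℤ)
      (cap : ∀ x → a x ≡ true → deg a x ≤ κ) (m≥xs : + length xs ≤ m) (κ≥0 : 0ℤ ≤ κ) where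

      data Item : Set where
        edge : E → Item
        vert : X → Item
        null : Item

      kill : Item → X → Bool
      kill (edge e) = killₑ e
      kill (vert x) y = ⌊ x ≟ y ⌋
      kill null     _ = false

      -- A live vertex of degree d lies in d live edges of weight 1 each. The missing κ - d is put
      -- on discarding the vertex alone, so that it is killed with weight exactly κ.
      vertWeight : X → ℤ
      vertWeight x = b2z (a x) * (κ - deg a x)

      weight : Item → ℤ
      weight (edge e) = b2z (live a e)
      weight (vert x) = vertWeight x
      -- An idle step takes up the rest. It is nonnegative because κ times the number of vertices
      -- already bounds the other weights and m is at least that number.
      weight null     = κ * m - (size a + ∑ xs vertWeight)

      items : List Item
      items = map edge es ++ map vert xs ++ null ∷ []

      𝔼 : (Item → ℤ) → ℤ
      𝔼 φ = ∑ items (λ i → weight i * φ i)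

      𝔼-split : ∀ φ → 𝔼 φ ≡ ∑ es (λ e → b2z (live a e) * φ (edge e))
                           + (∑ xs (λ x → vertWeight x * φ (vert x)) + weight null * φ null)
      𝔼-split φ = trans (∑-++ (map edge es) _ _) (cong₂ _+_ (∑-map edge es _)
        (trans (∑-++ (map vert xs) _ _) (cong₂ _+_ (∑-map vert xs _) (ℤP.+-identityʳ (weight null * φ null)))))

      vertWeight≥0 : ∀ x → 0ℤ ≤ vertWeight x
      vertWeight≥0 x with a x in eq
      ... | true  = 0≤* (0≤n 1) (gap (cap x eq))
      ... | false = ℤP.≤-refl

      alive*deg : ∀ x → b2z (a x) * deg a x ≡ deg a x
      alive*deg x = trans (sym (∑-*ˡ es (b2z (a x)) _)) (∑-cong es (λ e → pt e))
        where
        pt : ∀ e → b2z (a x) * (b2z (live a e) * inc e x) ≡ b2z (live a e) * inc e x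
        pt e = inc-elim (λ y → b2z (a y) * (b2z (live a e) * inc e y) ≡ b2z (live a e) * inc e y) e x
            (λ z → subst (λ i → b2z (a x) * (b2z (live a e) * i) ≡ b2z (live a e) * i) (sym z)
               (trans (cong (_*_ (b2z (a x))) (ℤP.*-zeroʳ (b2z (live a e)))) (trans (ℤP.*-zeroʳ (b2z (a x))) (sym (ℤP.*-zeroʳ (b2z (live a e)))))))
            (trans (sym (ℤP.*-assoc (b2z (a (p₁ e))) _ _)) (cong (_* inc e (p₁ e)) (t₁ (a (p₁ e)) (a (p₂ e)) (a (p₃ e)))))
            (trans (sym (ℤP.*-assoc (b2z (a (p₂ e))) _ _)) (cong (_* inc e (p₂ e)) (t₂ (a (p₁ e)) (a (p₂ e)) (a (p₃ e)))))
            (trans (sym (ℤP.*-assoc (b2z (a (p₃ e))) _ _)) (cong (_* inc e (p₃ e)) (t₃ (a (p₁ e)) (a (p₂ e)) (a (p₃ e)))))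
          where
          t₁ : ∀ u v w → b2z u * b2z (u ∧ v ∧ w) ≡ b2z (u ∧ v ∧ w)
          t₁ false _ _ = refl
          t₁ true v w = ℤP.*-identityˡ _
          t₂ : ∀ u v w → b2z v * b2z (u ∧ v ∧ w) ≡ b2z (u ∧ v ∧ w)
          t₂ u true w = ℤP.*-identityˡ _
          t₂ true false w = refl
          t₂ false false w = refl
          t₃ : ∀ u v w → b2z w * b2z (u ∧ v ∧ w) ≡ b2z (u ∧ v ∧ w)
          t₃ u v true = ℤP.*-identityˡ _
          t₃ true true false = refl
          t₃ true false false = refl
          t₃ false v false = refl

      weight≥0 : ∀ i → 0ℤ ≤ weight i
      weight≥0 (edge e) = b2z≥0 (live a e)
      weight≥0 (vert x) = vertWeight≥0 x
      weight≥0 null = gap (ℤP.≤-trans bound (*-monoˡ-nn κ≥0 m≥xs))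
        where
        alive : ℤ
        alive = ∑ xs (λ x → b2z (a x))
        size≥0 : 0ℤ ≤ size a
        size≥0 = ∑-0≤ es (λ e → b2z≥0 (live a e))
        ∑deg : ∑ xs (deg a) ≡ size a * + 3
        ∑deg = trans (∑-cong xs (λ x → sym (ℤP.*-identityʳ (deg a x))))
                 (trans (∑-deg a (λ _ → 1ℤ)) (∑-*ʳ es (+ 3) _))
        total : size a + ∑ xs vertWeight ≡ alive * κ - + 2 * size a
        total = trans (cong (_+_ (size a)) (trans (∑-cong xs (λ x → trans (expand (b2z (a x)) κ (deg a x)) (cong (_-_ (b2z (a x) * κ)) (alive*deg x))))
                 (trans (∑-sub xs _ _) (cong₂ _-_ (∑-*ʳ xs κ _) ∑deg)))) (collect (size a) (alive * κ))
          where expand : ∀ a k d → a * (k - d) ≡ a * k - a * d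
                expand = solve-∀
                collect : ∀ s y → s + (y - s * + 3) ≡ y - + 2 * s
                collect = solve-∀
        alive≤ : alive ≤ + length xs
        alive≤ = subst (alive ≤_) (trans (∑-const xs 1ℤ) (ℤP.*-identityʳ _)) (∑-mono xs (λ x → b2z≤1 (a x)))
        bound : size a + ∑ xs vertWeight ≤ κ * + length xs
        bound = subst (_≤ κ * + length xs) (sym total)
          (ℤP.≤-trans (0≤* (0≤n 2) size≥0 ≤by slack (alive * κ) (size a))
            (subst (alive * κ ≤_) (ℤP.*-comm (+ length xs) κ) (*-monoʳ-nn κ≥0 alive≤)))
          where slack : ∀ y s → y ≡ y - + 2 * s + + 2 * s
                slack = solve-∀

      𝔼-mono : ∀ {φ ψ} → (∀ i → φ i ≤ ψ i) → 𝔼 φ ≤ 𝔼 ψ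
      𝔼-mono h = ∑-mono items (λ i → *-monoˡ-nn (weight≥0 i) (h i))

      𝔼-cong : ∀ {φ ψ} → (∀ i → φ i ≡ ψ i) → 𝔼 φ ≡ 𝔼 ψ
      𝔼-cong h = ∑-cong items (λ i → cong (_*_ (weight i)) (h i))

      𝔼-+ : ∀ φ ψ → 𝔼 (λ i → φ i + ψ i) ≡ 𝔼 φ + 𝔼 ψ
      𝔼-+ φ ψ = trans (∑-cong items (λ i → ℤP.*-distribˡ-+ (weight i) (φ i) (ψ i))) (∑-+ items _ _)

      𝔼-sub : ∀ φ ψ → 𝔼 (λ i → φ i - ψ i) ≡ 𝔼 φ - 𝔼 ψ
      𝔼-sub φ ψ = trans (∑-cong items (λ i → expand (weight i) (φ i) (ψ i))) (∑-sub items _ _)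
        where expand : ∀ a b c → a * (b - c) ≡ a * b - a * c
              expand = solve-∀

      𝔼-*ˡ : ∀ c φ → 𝔼 (λ i → c * φ i) ≡ c * 𝔼 φ
      𝔼-*ˡ c φ = trans (∑-cong items (λ i → mv (weight i) c (φ i))) (∑-*ˡ items c _)
        where mv : ∀ a b c → a * (b * c) ≡ b * (a * c)
              mv = solve-∀

      𝔼-∑ : ∀ {A : Set} (ys : List A) (φ : A → Item → ℤ) → 𝔼 (λ i → ∑ ys (λ y → φ y i)) ≡ ∑ ys (λ y → 𝔼 (φ y))
      𝔼-∑ ys φ = trans (∑-cong items (λ i → sym (∑-*ˡ ys (weight i) _))) (∑-swap items ys _)

      𝔼-1 : 𝔼 (λ _ → 1ℤ) ≡ κ * m
      𝔼-1 = trans (𝔼-split _) (trans (cong₂ (λ u v → u + (v + weight null * 1ℤ))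
              (∑-cong es (λ e → ℤP.*-identityʳ (b2z (live a e)))) (∑-cong xs (λ x → ℤP.*-identityʳ (vertWeight x))))
              (collect (size a) (∑ xs vertWeight) (κ * m)))
        where collect : ∀ s v k → s + (v + (k - (s + v)) * 1ℤ) ≡ k
              collect = solve-∀

      ∑items : ∑ items weight ≡ κ * m
      ∑items = trans (∑-cong items (λ i → sym (ℤP.*-identityʳ (weight i)))) 𝔼-1

      𝔼-K : ∀ y → a y ≡ true → 𝔼 (λ i → K (kill i) y) ≡ κ
      𝔼-K y ay = trans (𝔼-split _) (trans (cong₂ (λ u v → u + (v + weight null * 0ℤ))
          (∑-cong es (λ e → cong (_*_ (b2z (live a e))) (killₑ-inc e y)))
          (trans (∑-cong xs (λ x → trans (ℤP.*-comm (vertWeight x) (δ x y)) (cong (_* vertWeight x) (δ-sym x y)))) (∑-δ y vertWeight)))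
          (trans (cong (λ b → deg a y + (b2z b * (κ - deg a y) + weight null * 0ℤ)) ay) (collect (deg a y) κ (weight null))))
        where collect : ∀ d k w → d + (1ℤ * (k - d) + w * 0ℤ) ≡ k
              collect = solve-∀

      -- Only an edge through both vertices kills both, and linearity leaves at most one such edge,
      -- of weight 1.
      𝔼-KK : ∀ y z → y ≢ z → 𝔼 (λ i → K (kill i) y * K (kill i) z) ≤ 1ℤ
      𝔼-KK y z y≢z = subst (_≤ 1ℤ) (sym eq) (ℤP.≤-trans
          (∑-mono es (λ e → subst (b2z (live a e) * (inc e y * inc e z) ≤_) (ℤP.*-identityˡ _)
                       (*-monoʳ-nn (0≤* (inc≥0 e y) (inc≥0 e z)) (b2z≤1 (live a e)))))
          (linear y z y≢z))
        where
        δδ : ∀ x → δ x y * δ x z ≡ 0ℤ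
        δδ x with x ≟ y | x ≟ z
        ... | yes refl | yes refl = ⊥-elim (y≢z refl)
        ... | yes _ | no _ = refl
        ... | no _ | _ = refl
        eq : 𝔼 (λ i → K (kill i) y * K (kill i) z) ≡ ∑ es (λ e → b2z (live a e) * (inc e y * inc e z))
        eq = trans (𝔼-split _) (trans (cong₂ (λ u v → u + (v + weight null * 0ℤ))
          (∑-cong es (λ e → cong (_*_ (b2z (live a e))) (cong₂ _*_ (killₑ-inc e y) (killₑ-inc e z))))
          (trans (∑-cong xs (λ x → trans (cong (_*_ (vertWeight x)) (δδ x)) (ℤP.*-zeroʳ (vertWeight x)))) (∑-0 xs)))
          (collect _ (weight null)))
          where collect : ∀ d w → d + (0ℤ + w * 0ℤ) ≡ d
                collect = solve-∀

      ∑K≤3 : ∀ i → ∑ xs (K (kill i)) ≤ + 3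
      ∑K≤3 (edge e) = ℤP.≤-reflexive (trans (∑-cong xs (λ y → trans (killₑ-inc e y) (sym (ℤP.*-identityʳ (inc e y))))) (∑-inc e (λ _ → 1ℤ)))
      ∑K≤3 (vert x) = subst (_≤ + 3) (sym (once x)) (+≤+ (ℕ.s≤s ℕ.z≤n))
      ∑K≤3 null = subst (_≤ + 3) (sym (∑-0 xs)) (+≤+ ℕ.z≤n)

      live-elim : ∀ e {f g : ℤ} → (a (p₁ e) ≡ true → a (p₂ e) ≡ true → a (p₃ e) ≡ true → f ≤ g) →
                  b2z (live a e) * f ≤ b2z (live a e) * g
      live-elim e {f} {g} h with a (p₁ e) in e₁ | a (p₂ e) in e₂ | a (p₃ e) in e₃
      ... | true  | true  | true  = *-monoˡ-nn (0≤n 1) (h refl refl refl)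
      ... | false | _     | _     = ℤP.≤-refl
      ... | true  | false | _     = ℤP.≤-refl
      ... | true  | true  | false = ℤP.≤-refl

      meanLoss : X → ℤ
      meanLoss x = 𝔼 (λ i → surv (kill i) x * loss a (kill i) x)

      module _ (x : X) (ax : a x ≡ true) where
        private
          d : ℤ
          d = deg a x

          𝔼-others : ∀ e → a (p₁ e) ≡ true → a (p₂ e) ≡ true → a (p₃ e) ≡ true →
                     𝔼 (λ i → others (kill i) e x) ≡ + 2 * κ
          𝔼-others e a₁ a₂ a₃ = trans (𝔼-sub _ (λ i → K (kill i) x)) (trans (cong₂ _-_
              (trans (𝔼-+ _ (λ i → K (kill i) (p₃ e))) (cong₂ _+_
                (trans (𝔼-+ (λ i → K (kill i) (p₁ e)) (λ i → K (kill i) (p₂ e))) (cong₂ _+_ (𝔼-K _ a₁) (𝔼-K _ a₂))) (𝔼-K _ a₃)))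
              (𝔼-K x ax)) (collect κ))
            where collect : ∀ k → k + k + k - k ≡ + 2 * k
                  collect = solve-∀

          𝔼-pairs : ∀ e → 𝔼 (λ i → pairs (kill i) e) ≤ + 3
          𝔼-pairs e = subst (_≤ + 3) (sym (trans (𝔼-+ _ (λ i → K (kill i) (p₂ e) * K (kill i) (p₃ e)))
               (cong (_+ 𝔼 (λ i → K (kill i) (p₂ e) * K (kill i) (p₃ e))) (𝔼-+ (λ i → K (kill i) (p₁ e) * K (kill i) (p₂ e)) (λ i → K (kill i) (p₁ e) * K (kill i) (p₃ e))))))
             (ℤP.+-mono-≤ (ℤP.+-mono-≤ (𝔼-KK _ _ (p₁≢p₂ e)) (𝔼-KK _ _ (p₁≢p₃ e))) (𝔼-KK _ _ (p₂≢p₃ e)))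

          𝔼-star : ∀ (φ : E → Item → ℤ) → 𝔼 (λ i → ∑ es (λ e → b2z (live a e) * (inc e x * φ e i)))
                   ≡ ∑ es (λ e → b2z (live a e) * (inc e x * 𝔼 (φ e)))
          𝔼-star φ = trans (𝔼-∑ es _) (∑-cong es (λ e → trans (𝔼-*ˡ (b2z (live a e)) (λ i → inc e x * φ e i))
                       (cong (_*_ (b2z (live a e))) (𝔼-*ˡ (inc e x) (φ e)))))

          star-const : ∀ c → ∑ es (λ e → b2z (live a e) * (inc e x * c)) ≡ d * c
          star-const c = trans (∑-cong es (λ e → sym (ℤP.*-assoc (b2z (live a e)) (inc e x) c))) (∑-*ʳ es c _)

        -- Each of the d live edges at x has two further vertices, both killed with weight κ.
        meanLoss-upper : meanLoss x ≤ + 2 * (κ * d)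
        meanLoss-upper = subst (meanLoss x ≤_) (trans (star-const (+ 2 * κ)) (mv d κ))
          (ℤP.≤-trans (𝔼-mono (λ i → surv*loss≤ (kill i) a x))
            (subst (_≤ ∑ es (λ e → b2z (live a e) * (inc e x * (+ 2 * κ)))) (sym (𝔼-star (λ e i → others (kill i) e x)))
              (∑-mono es (λ e → live-elim e (λ a₁ a₂ a₃ → *-monoˡ-nn (inc≥0 e x) (ℤP.≤-reflexive (𝔼-others e a₁ a₂ a₃)))))))
          where mv : ∀ d k → d * (+ 2 * k) ≡ + 2 * (k * d)
                mv = solve-∀

        -- The Bonferroni correction: for each of the d edges there are three pairs of vertices,
        -- each pair killed together with weight at most 1.
        meanLoss-lower : + 2 * (κ * d) - + 3 * d ≤ meanLoss x
        meanLoss-lower = subst (_≤ meanLoss x) (trans (star-const (+ 2 * κ - + 3)) (mv d κ))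
          (ℤP.≤-trans (subst (∑ es (λ e → b2z (live a e) * (inc e x * (+ 2 * κ - + 3))) ≤_) (sym (𝔼-star (λ e i → others (kill i) e x - pairs (kill i) e)))
              (∑-mono es (λ e → live-elim e (λ a₁ a₂ a₃ → *-monoˡ-nn (inc≥0 e x)
                (subst (+ 2 * κ - + 3 ≤_) (sym (trans (𝔼-sub (λ i → others (kill i) e x) (λ i → pairs (kill i) e)) (cong (_- _) (𝔼-others e a₁ a₂ a₃))))
                  (ℤP.+-monoʳ-≤ (+ 2 * κ) (ℤP.neg-mono-≤ (𝔼-pairs e))))))))
            (𝔼-mono (λ i → ≤surv*loss (kill i) a x)))
          where mv : ∀ d k → d * (+ 2 * k - + 3) ≡ + 2 * (k * d) - + 3 * d
                mv = solve-∀

        𝔼-surv : 𝔼 (λ i → surv (kill i) x) ≡ κ * m - κ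
        𝔼-surv = trans (𝔼-sub (λ _ → 1ℤ) (λ i → K (kill i) x)) (cong₂ _-_ 𝔼-1 (𝔼-K x ax))

        -- A surviving x loses at most as many edges as there are killed vertices, and a step kills
        -- at most three. The second moment of the loss is thereby reduced to its mean.
        surv*loss²≤ : ∀ i → surv (kill i) x * (loss a (kill i) x * loss a (kill i) x) ≤ + 3 * (surv (kill i) x * loss a (kill i) x)
        surv*loss²≤ i = go (kill i x) (ℤP.≤-trans (surv*loss≤∑K (kill i) a x) (∑K≤3 i))
          where
          ℓ : ℤ
          ℓ = loss a (kill i) x
          go : ∀ b → (1ℤ - b2z b) * ℓ ≤ + 3 → (1ℤ - b2z b) * (ℓ * ℓ) ≤ + 3 * ((1ℤ - b2z b) * ℓ)
          go true  _ = ℤP.≤-refl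
          go false h = subst₂ _≤_ (sym (ℤP.*-identityˡ (ℓ * ℓ))) (cong (_*_ (+ 3)) (sym (ℤP.*-identityˡ ℓ)))
                         (*-monoʳ-nn (loss≥0 a (kill i) x) (subst (_≤ + 3) (ℤP.*-identityˡ ℓ) h))

        𝔼-square : ∀ Y q → 0ℤ ≤ q →
          𝔼 (λ i → surv (kill i) x * ((Y - q * loss a (kill i) x) * (Y - q * loss a (kill i) x)))
          ≤ (κ * m - κ) * (Y * Y) - + 2 * (q * Y * meanLoss x) + q * q * (+ 3 * meanLoss x)
        𝔼-square Y q q≥0 = ℤP.≤-trans (𝔼-mono bound) (ℤP.≤-reflexive
            (trans (𝔼-+ _ (λ i → q * q * (+ 3 * sl i))) (cong₂ _+_
              (trans (𝔼-sub _ (λ i → + 2 * (q * Y * sl i))) (cong₂ _-_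
                (trans (𝔼-*ˡ (Y * Y) s) (trans (cong (_*_ (Y * Y)) 𝔼-surv) (ℤP.*-comm (Y * Y) (κ * m - κ))))
                (trans (𝔼-*ˡ (+ 2) (λ i → q * Y * sl i)) (cong (_*_ (+ 2)) (𝔼-*ˡ (q * Y) sl)))))
              (trans (𝔼-*ˡ (q * q) (λ i → + 3 * sl i)) (cong (_*_ (q * q)) (𝔼-*ˡ (+ 3) sl))))))
          where
          s ℓ sl : Item → ℤ
          s i = surv (kill i) x
          ℓ i = loss a (kill i) x
          sl i = s i * ℓ i
          bound : ∀ i → s i * ((Y - q * ℓ i) * (Y - q * ℓ i)) ≤ Y * Y * s i - + 2 * (q * Y * sl i) + q * q * (+ 3 * sl i)
          bound i = 0≤* (0≤sq q) (gap (surv*loss²≤ i)) ≤by expand Y q (s i) (ℓ i)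
            where expand : ∀ Y q s l → Y * Y * s - + 2 * (q * Y * (s * l)) + q * q * (+ 3 * (s * l)) ≡
                           s * ((Y - q * l) * (Y - q * l)) + q * q * (+ 3 * (s * l) - s * (l * l))
                  expand = solve-∀

    module Potential (q : ℤ) where

      -- An edge at a live vertex stays live as long as its two other vertices do, heuristically
      -- with probability (m/P)², so the target degree is deg₀ · m²/P². The factor q = P² clears the
      -- denominator.
      dev : ℤ → State → X → ℤ
      dev m a x = q * deg a x - deg₀ x * (m * m)

      V : ℤ → State → ℤ
      V m a = ∑ xs (λ x → b2z (a x) * (dev m a x * dev m a x))

      V≥0 : ∀ m a → 0ℤ ≤ V m a
      V≥0 m a = ∑-0≤ xs (λ x → 0≤* (b2z≥0 (a x)) (0≤sq (dev m a x)))

      module _ (a : State) (κ m : ℤ)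
        (cap : ∀ x → a x ≡ true → deg a x ≤ κ) (m≥xs : + length xs ≤ m) (κ≥0 : 0ℤ ≤ κ)
        (m≥2 : + 2 ≤ m) (q≥0 : 0ℤ ≤ q) (deg₀m≤q : ∀ x → deg₀ x * m ≤ q) where
        open Sampling a κ m cap m≥xs κ≥0

        private
          Y : X → ℤ
          Y x = q * deg a x - deg₀ x * ((m - 1ℤ) * (m - 1ℤ))

          dev-∖ : ∀ x i → dev (m - 1ℤ) (a ∖ kill i) x ≡ Y x - q * loss a (kill i) x
          dev-∖ x i = trans (cong (λ t → q * t - deg₀ x * ((m - 1ℤ) * (m - 1ℤ))) (deg-∖ a (kill i) x))
                        (expand q (deg a x) (loss a (kill i) x) (deg₀ x * ((m - 1ℤ) * (m - 1ℤ))))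
            where expand : ∀ q d l t → q * (d - l) - t ≡ q * d - t - q * l
                  expand = solve-∀

          term : X → Item → ℤ
          term x i = b2z ((a ∖ kill i) x) * (dev (m - 1ℤ) (a ∖ kill i) x * dev (m - 1ℤ) (a ∖ kill i) x)

          alive-∖ : ∀ x → a x ≡ true → ∀ i → b2z ((a ∖ kill i) x) ≡ surv (kill i) x
          alive-∖ x ax i rewrite ax = neg (kill i x)
            where neg : ∀ b → b2z (not b) ≡ 1ℤ - b2z b
                  neg true = refl
                  neg false = refl

          𝔼-0 : 𝔼 (λ _ → 0ℤ) ≡ 0ℤ
          𝔼-0 = trans (∑-cong items (λ i → ℤP.*-zeroʳ (weight i))) (∑-0 items)

          bound : X → ℤ
          bound x = κ * ((m - + 2) * (b2z (a x) * (dev m a x * dev m a x)) + + 12 * (q * q * deg₀ x))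

          deg₀≥0 : ∀ x → 0ℤ ≤ deg₀ x
          deg₀≥0 x = ∑-0≤ es (λ e → inc≥0 e x)

          dead : ∀ x → a x ≡ false → 𝔼 (term x) ≤ bound x
          dead x ax = subst₂ _≤_ (sym (trans (𝔼-cong (λ i → z i)) 𝔼-0))
              (cong (λ b → κ * ((m - + 2) * (b2z b * (dev m a x * dev m a x)) + + 12 * (q * q * deg₀ x))) (sym ax))
              (0≤* κ≥0 (0≤+ (subst (0ℤ ≤_) (sym (ℤP.*-zeroʳ (m - + 2))) ℤP.≤-refl) (0≤* (0≤n 12) (0≤* (0≤sq q) (deg₀≥0 x)))))
            where z : ∀ i → term x i ≡ 0ℤ
                  z i rewrite ax = refl

          alive : ∀ x → a x ≡ true → 𝔼 (term x) ≤ bound x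
          alive x ax = ℤP.≤-trans (ℤP.≤-trans
                (ℤP.≤-reflexive (𝔼-cong (λ i → cong₂ _*_ (alive-∖ x ax i) (cong₂ _*_ (dev-∖ x i) (dev-∖ x i)))))
                (𝔼-square x ax (Y x) q q≥0))
              (ℤP.≤-trans (main (deg₀ x ℤP.≤? 0ℤ)) (ℤP.≤-reflexive
                (cong (λ b → κ * ((m - + 2) * b + + 12 * (q * q * deg₀ x)))
                   (trans (sym (ℤP.*-identityˡ (dev m a x * dev m a x))) (cong (λ b → b2z b * (dev m a x * dev m a x)) (sym ax))))))
            where
            -- The inequality at one vertex needs deg₀ ≥ 1. At an isolated vertex the degree, the
            -- mean loss and the deviations all vanish.
            main : Dec (deg₀ x ≤ 0ℤ) →
              (κ * m - κ) * (Y x * Y x) - + 2 * (q * Y x * meanLoss x) + q * q * (+ 3 * meanLoss x)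
               ≤ κ * ((m - + 2) * (dev m a x * dev m a x) + + 12 * (q * q * deg₀ x))
            main (no p) = second-moment-step κ m q (deg a x) (deg₀ x) (meanLoss x) κ≥0 m≥2 q≥0 (deg≥0 a x) (cap x ax)
              (deg≤deg₀ a x) (ℤP.i<j⇒suc[i]≤j (ℤP.≰⇒> p)) (deg₀m≤q x) (meanLoss-lower x ax) (meanLoss-upper x ax)
            main (yes p) = zero-case (deg a x) (deg₀ x) (meanLoss x) d₀≡0 d≡0 l≡0
              where
              d₀≡0 : deg₀ x ≡ 0ℤ
              d₀≡0 = ℤP.≤-antisym p (deg₀≥0 x)
              d≡0 : deg a x ≡ 0ℤ
              d≡0 = ℤP.≤-antisym (ℤP.≤-trans (deg≤deg₀ a x) p) (deg≥0 a x)
              l≡0 : meanLoss x ≡ 0ℤ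
              l≡0 = ℤP.≤-antisym
                 (subst (meanLoss x ≤_) (trans (cong (λ t → + 2 * (κ * t)) d≡0) (trans (cong (_*_ (+ 2)) (ℤP.*-zeroʳ κ)) refl)) (meanLoss-upper x ax))
                 (subst (_≤ meanLoss x) (trans (cong (λ t → + 2 * (κ * t) - + 3 * t) d≡0) (trans (cong (λ t → + 2 * t - + 3 * 0ℤ) (ℤP.*-zeroʳ κ)) refl)) (meanLoss-lower x ax))
              zero-case : ∀ d d₀ l → d₀ ≡ 0ℤ → d ≡ 0ℤ → l ≡ 0ℤ →
                (κ * m - κ) * ((q * d - d₀ * ((m - 1ℤ) * (m - 1ℤ))) * (q * d - d₀ * ((m - 1ℤ) * (m - 1ℤ)))) - + 2 * (q * (q * d - d₀ * ((m - 1ℤ) * (m - 1ℤ))) * l) + q * q * (+ 3 * l)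
                 ≤ κ * ((m - + 2) * ((q * d - d₀ * (m * m)) * (q * d - d₀ * (m * m))) + + 12 * (q * q * d₀))
              zero-case _ _ _ refl refl refl = ℤP.≤-reflexive (eq κ m q)
                where eq : ∀ κ m q → (κ * m - κ) * ((q * 0ℤ - 0ℤ * ((m - 1ℤ) * (m - 1ℤ))) * (q * 0ℤ - 0ℤ * ((m - 1ℤ) * (m - 1ℤ)))) - + 2 * (q * (q * 0ℤ - 0ℤ * ((m - 1ℤ) * (m - 1ℤ))) * 0ℤ) + q * q * (+ 3 * 0ℤ)
                        ≡ κ * ((m - + 2) * ((q * 0ℤ - 0ℤ * (m * m)) * (q * 0ℤ - 0ℤ * (m * m))) + + 12 * (q * q * 0ℤ))
                      eq = solve-∀

        -- Compared with the total weight κm the factor κ(m - 2) is a gain of 2κV, which will pay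
        -- for lost out-vertices. The constant is 36 = 12 · 3, as the initial degrees sum to three
        -- times the number of edges.
        𝔼-V : 𝔼 (λ i → V (m - 1ℤ) (a ∖ kill i)) ≤ κ * ((m - + 2) * V m a + + 36 * (q * q * + length es))
        𝔼-V = subst₂ _≤_ (sym (𝔼-∑ xs term)) total (∑-mono xs (λ x → cases x))
          where
          cases : ∀ x → 𝔼 (term x) ≤ bound x
          cases x = bool-cases (a x) (alive x) (dead x)
          total : ∑ xs bound ≡ κ * ((m - + 2) * V m a + + 36 * (q * q * + length es))
          total = trans (∑-*ˡ xs κ _) (cong (_*_ κ) (trans (∑-+ xs _ _) (cong₂ _+_ (∑-*ˡ xs (m - + 2) _)
            (trans (∑-*ˡ xs (+ 12) _) (trans (cong (_*_ (+ 12)) (trans (∑-*ˡ xs (q * q) deg₀) (cong (_*_ (q * q)) ∑-deg₀)))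
               (mv (q * q) (+ length es)))))))
            where mv : ∀ q l → + 12 * (q * (+ 3 * l)) ≡ + 36 * (q * l)
                  mv = solve-∀

      -- Deleting one vertex moves the deviations of its neighbours only by q each.
      V-delete : ∀ (m : ℤ) a x w → 0ℤ ≤ w → a x ≡ true →
        w * V m (a ∖ (λ y → ⌊ x ≟ y ⌋)) ≤ (w + 1ℤ) * (V m a - dev m a x * dev m a x) + (w * w + w) * (q * q * (+ 3 * deg a x))
      V-delete m a x w w≥0 ax = subst₂ _≤_ (∑-*ˡ xs w _) total (∑-mono xs pointwise)
        where
        k : X → Bool
        k y = ⌊ x ≟ y ⌋
        nb Z : X → ℤ
        nb y = loss a k y
        Z y = dev m a y
        pointwise : ∀ y → w * (b2z ((a ∖ k) y) * (dev m (a ∖ k) y * dev m (a ∖ k) y))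
                    ≤ (w + 1ℤ) * (b2z (a y) * (Z y * Z y) - δ x y * (b2z (a y) * (Z y * Z y))) + (w * w + w) * (q * q * nb y)
        pointwise y = ℤP.≤-trans (ℤP.≤-reflexive (cong (λ t → w * (b2z ((a ∖ k) y) * (t * t))) dev-∖))
                        (go (a y) (k y) (ℤP.≤-trans (surv*loss≤∑K k a y) (ℤP.≤-reflexive (once x))))
          where
          dev-∖ : dev m (a ∖ k) y ≡ Z y - q * nb y
          dev-∖ = trans (cong (λ t → q * t - deg₀ y * (m * m)) (deg-∖ a k y))
                        (expand q (deg a y) (nb y) (deg₀ y * (m * m)))
            where expand : ∀ q d l t → q * (d - l) - t ≡ q * d - t - q * l
                  expand = solve-∀
          ww≥0 : 0ℤ ≤ (w * w + w) * (q * q * nb y)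
          ww≥0 = 0≤* (0≤+ (0≤* w≥0 w≥0) w≥0) (0≤* (0≤sq q) (loss≥0 a k y))
          go : ∀ b c → (1ℤ - b2z c) * nb y ≤ 1ℤ → w * (b2z (b ∧ not c) * ((Z y - q * nb y) * (Z y - q * nb y)))
                ≤ (w + 1ℤ) * (b2z b * (Z y * Z y) - b2z c * (b2z b * (Z y * Z y))) + (w * w + w) * (q * q * nb y)
          go false c _ = ww≥0 ≤by eq w (b2z c) (Z y) ((w * w + w) * (q * q * nb y))
            where eq : ∀ w c z t → (w + 1ℤ) * (0ℤ * (z * z) - c * (0ℤ * (z * z))) + t ≡ w * 0ℤ + t
                  eq = solve-∀
          go true true _ = ww≥0 ≤by eq w (Z y) ((w * w + w) * (q * q * nb y))
            where eq : ∀ w z t → (w + 1ℤ) * (1ℤ * (z * z) - 1ℤ * (1ℤ * (z * z))) + t ≡ w * 0ℤ + t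
                  eq = solve-∀
          -- Young's inequality with parameter w, that is, the square of z + wql is nonnegative,
          -- where l is the loss at y. Then l² ≤ l, because y shares at most one edge with the
          -- deleted vertex.
          go true false h = 0≤+ (0≤sq (Z y + w * (q * nb y)))
                                (0≤* (0≤* (0≤+ (0≤* w≥0 w≥0) w≥0) (0≤* (0≤sq q) (loss≥0 a k y))) (gap h)) ≤by eq w (Z y) q (nb y)
            where eq : ∀ w z q l → (w + 1ℤ) * (1ℤ * (z * z) - 0ℤ * (1ℤ * (z * z))) + (w * w + w) * (q * q * l) ≡
                         w * (1ℤ * ((z - q * l) * (z - q * l))) + ((z + w * (q * l)) * (z + w * (q * l)) + (w * w + w) * (q * q * l) * (1ℤ - (1ℤ - 0ℤ) * l))
                  eq = solve-∀
        hit-inc : ∀ e → b2z (hit k e) ≡ inc e x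
        hit-inc e = trans (cong b2z (cong₂ _∨_ (flip (p₁ e)) (cong₂ _∨_ (flip (p₂ e)) (flip (p₃ e))))) (killₑ-inc e x)
          where flip : ∀ y → ⌊ x ≟ y ⌋ ≡ ⌊ y ≟ x ⌋
                flip y with x ≟ y | y ≟ x
                ... | yes _ | yes _ = refl
                ... | no _  | no _  = refl
                ... | yes u | no v  = ⊥-elim (v (sym u))
                ... | no u  | yes v = ⊥-elim (u (sym v))
        -- A live edge through x is counted at each of its three vertices, x included.
        ∑nb : ∑ xs nb ≡ + 3 * deg a x
        ∑nb = trans (∑-swap xs es _) (trans (∑-cong es per-edge) (∑-*ˡ es (+ 3) _))
          where
          per-edge : ∀ e → ∑ xs (λ y → b2z (live a e) * (inc e y * b2z (hit k e))) ≡ + 3 * (b2z (live a e) * inc e x)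
          per-edge e = trans (∑-*ˡ xs (b2z (live a e)) _) (trans (cong (_*_ (b2z (live a e))) (∑-inc e (λ _ → b2z (hit k e))))
                         (trans (cong (λ t → b2z (live a e) * (t + t + t)) (hit-inc e)) (mv (b2z (live a e)) (inc e x))))
            where mv : ∀ l i → l * (i + i + i) ≡ + 3 * (l * i)
                  mv = solve-∀
        total : ∑ xs (λ y → (w + 1ℤ) * (b2z (a y) * (Z y * Z y) - δ x y * (b2z (a y) * (Z y * Z y))) + (w * w + w) * (q * q * nb y))
                ≡ (w + 1ℤ) * (V m a - dev m a x * dev m a x) + (w * w + w) * (q * q * (+ 3 * deg a x))
        total = trans (∑-+ xs _ _) (cong₂ _+_
          (trans (∑-*ˡ xs (w + 1ℤ) _) (cong (_*_ (w + 1ℤ)) (trans (∑-sub xs _ _) (cong (_-_ (V m a))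
             (trans (∑-δ x (λ y → b2z (a y) * (Z y * Z y))) (trans (cong (λ b → b2z b * (Z x * Z x)) ax) (ℤP.*-identityˡ (Z x * Z x))))))))
          (trans (∑-*ˡ xs (w * w + w) _) (cong (_*_ (w * w + w)) (trans (∑-*ˡ xs (q * q) nb) (cong (_*_ (q * q)) ∑nb)))))

-- The derandomised nibble and its invariant.

module Nibble where
  open FiniteSums
  open Hypergraphs
  open RandomDeletion
  open import Data.Integer using (ℤ; +_; 0ℤ; 1ℤ; _+_; _*_; _-_; -_; _≤_; _<_; _≤?_; +≤+; +<+; positive)
  open import Data.Integer.Tactic.RingSolver using (solve-∀)
  open import Data.Nat as ℕ using (ℕ; zero; suc)

  -- Completing the square; the hypothesis says that the quadratic in z has no two distinct real
  -- zeros.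
  amgm : ∀ {α β g} z → 0ℤ < α → g * g ≤ + 4 * (α * β) → - (g * z) ≤ α * (z * z) + β
  amgm {α} {β} {g} z α>0 h = cancelˡ (ℤP.*-monoˡ-<-pos (+ 4) α>0)
    (0≤+ (0≤sq (+ 2 * α * z + g)) (gap h) ≤by eq α β g z)
    where eq : ∀ α β g z → + 4 * α * (α * (z * z) + β) ≡ + 4 * α * (- (g * z)) + ((+ 2 * α * z + g) * (+ 2 * α * z + g) + (+ 4 * (α * β) - g * g))
          eq = solve-∀

  -- For path forests the vetoed edges are those that would close a directed cycle.
  record Growth (H : Hypergraph) (n : ℤ) : Set₁ where
    open HypergraphProperties H
    field
      Str    : Set
      Fits   : Str → State → Set
      count  : Str → ℤ
      veto   : Str → E → Bool
      shrink : ∀ {s a} k → Fits s a → Fits s (a ∖ k)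
      grow   : ∀ {s a e} → Fits s a → e ∈ es → live a e ≡ true → veto s e ≡ false →
               Σ Str λ s′ → Fits s′ (a ∖ killₑ e) × count s′ ≡ count s + 1ℤ
      few    : ∀ {s a} → Fits s a → ∑ es (λ e → b2z (veto s e)) ≤ n

  -- Time m runs from P = h mT down to mT, and D₁ m²/P² caps the degrees at time m.
  record Parameters : Set where
    field
      h mT D₁ : ℕ
      -- There are n out-vertices of degree at least r, M edges and N vertices; initial degrees are
      -- at most D₀, which stays below D₁ by ι. In units of P⁴, Λ is the price of a lost out-vertex,
      -- θ the error allowed to P steps and β the budget. C is the constant term in the use of
      -- `amgm`, and w the parameter in `V-delete`.
      n r D₀ ι w Λ C θ β M N : ℤ
      h≥1  : 1 ℕ.≤ h
      mT≥1 : 1 ℕ.≤ mT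
      D₁≥1 : 1 ℕ.≤ D₁
      n≥0  : 0ℤ ≤ n
      M≥0  : 0ℤ ≤ M
      Λ≥1  : 1ℤ ≤ Λ
      C≥0  : 0ℤ ≤ C
      θ≥0  : 0ℤ ≤ θ
      w≥1  : 1ℤ ≤ w
      ι≥0  : 0ℤ ≤ ι
      D₀≥0 : 0ℤ ≤ D₀
      β≥0  : 0ℤ ≤ β
      r≤D₁ : r ≤ + D₁
      D₀+ι : D₀ + ι ≤ + D₁
      N≤mT : N ≤ + mT
      D₀≤mT : D₀ ≤ + mT
      -- These four conditions serve, in turn, to trade out-degree deficits for V, to fit the
      -- remaining errors of a step into θ, to make the deletion of an overfull vertex pay, and to
      -- start. Powers of h arise because m can be as small as P/h.
      amgm-condition : Λ * Λ * (+ h * + h) ≤ + 8 * (+ D₁ * C)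
      drift-condition : (+ h * (+ h * + h)) * (n * (Λ * (+ D₁ - r + + 2) + C) + + 36 * ((+ D₁ + 1ℤ) * M)) ≤ + D₁ * θ
      delete-condition : (+ h * + h) * (+ h * + h) * (β + (w * w + w) * (+ 3 * D₀) + w * Λ) ≤ w * (ι * ι)
      start-condition : Λ * n + + h * θ ≤ + h * β

  module _ (𝒫 : Parameters) (H : Hypergraph) where
    open Parameters 𝒫
    open HypergraphProperties H

    module Process
      (out : X → Bool)
      (out₁ : ∀ e → out (p₁ e) ≡ true) (out₂ : ∀ e → out (p₂ e) ≡ false) (out₃ : ∀ e → out (p₃ e) ≡ false)
      (∑out : ∑ xs (λ x → b2z (out x)) ≡ n)
      (length-xs : + length xs ≡ N) (length-es : + length es ≡ M)
      (out-deg : ∀ x → out x ≡ true → r ≤ deg₀ x) (deg₀≤D₀ : ∀ x → deg₀ x ≤ D₀)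
      (𝒢 : Growth H n) where

      open Growth 𝒢

      P : ℕ
      P = h ℕ.* mT
      -- `G` is the price of a lost out-vertex, `κ₀` the reserve released in one unit of time, `B`
      -- the budget.
      p q G κ₀ B : ℤ
      p = + P
      q = p * p
      G = Λ * (q * q)
      κ₀ = θ * (p * q)
      B = β * (q * q)

      open Potential H q

      nA : State → ℤ
      nA a = ∑ xs (λ x → b2z (out x) * b2z (a x))

      -- U is the number of unmatched out-vertices, so U - nA of them are lost; multiplying by P⁴ keeps everything in ℤ.
      Inv : ℤ → State → ℤ → Set
      Inv m a U = G * + mT * nA a + m * (G * (U - nA a) + V m a + (m - + mT) * κ₀) ≤ m * B

      h>0 : 0ℤ < + h
      h>0 = +<+ h≥1
      mT>0 : 0ℤ < + mT
      mT>0 = +<+ mT≥1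
      p≡ : p ≡ + h * + mT
      p≡ = ℤP.pos-* h mT
      pos* : ∀ {a b} → 0ℤ < a → 0ℤ < b → 0ℤ < a * b
      pos* {a} {b} x y = subst (_< a * b) (ℤP.*-zeroʳ a) (ℤP.*-monoˡ-<-pos a {{positive x}} y)
      p>0 : 0ℤ < p
      p>0 = subst (0ℤ <_) (sym p≡) (pos* h>0 mT>0)
      q>0 : 0ℤ < q
      q>0 = pos* p>0 p>0
      q≥0 : 0ℤ ≤ q
      q≥0 = ℤP.<⇒≤ q>0
      Λ≥0 : 0ℤ ≤ Λ
      Λ≥0 = ℤP.≤-trans (0≤n 1) Λ≥1
      G≥0 : 0ℤ ≤ G
      G≥0 = 0≤* Λ≥0 (0≤sq q)
      D₁>0 : 0ℤ < + D₁
      D₁>0 = +<+ D₁≥1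
      w>0 : 0ℤ < w
      w>0 = ℤP.<-≤-trans (+<+ (ℕ.s≤s ℕ.z≤n)) w≥1

      nA≥0 : ∀ a → 0ℤ ≤ nA a
      nA≥0 a = ∑-0≤ xs (λ x → 0≤* (b2z≥0 (out x)) (b2z≥0 (a x)))

      nA≤n : ∀ a → nA a ≤ n
      nA≤n a = subst (nA a ≤_) ∑out (∑-mono xs (λ x → subst (b2z (out x) * b2z (a x) ≤_) (ℤP.*-identityʳ _) (*-monoˡ-nn (b2z≥0 (out x)) (b2z≤1 (a x)))))

      nA-∖ : ∀ a k → nA (a ∖ k) ≤ nA a
      nA-∖ a k = ∑-mono xs (λ y → *-monoˡ-nn (b2z≥0 (out y)) (t (a y) (k y)))
        where t : ∀ b c → b2z (b ∧ not c) ≤ b2z b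
              t false _ = ℤP.≤-refl
              t true c = b2z≤1 (not c)

      nA-killₑ : ∀ a e → live a e ≡ true → nA (a ∖ killₑ e) + 1ℤ ≡ nA a
      nA-killₑ a e lv = trans (cong (_+ 1ℤ) (trans (∑-cong xs per) (trans (∑-sub xs _ _) (cong (_-_ (nA a))
          (trans (∑-inc e (λ x → b2z (out x) * b2z (a x))) value))))) (fin (nA a))
        where
        fin : ∀ x → x - 1ℤ + 1ℤ ≡ x
        fin = solve-∀
        per : ∀ x → b2z (out x) * b2z ((a ∖ killₑ e) x) ≡ b2z (out x) * b2z (a x) - inc e x * (b2z (out x) * b2z (a x))
        per x = trans (t (b2z (out x)) (a x) (killₑ e x)) (cong (λ i → b2z (out x) * b2z (a x) - i * (b2z (out x) * b2z (a x))) (killₑ-inc e x))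
          where
          t : ∀ o b c → o * b2z (b ∧ not c) ≡ o * b2z b - b2z c * (o * b2z b)
          t o false c = f o (b2z c)
            where f : ∀ o c → o * 0ℤ ≡ o * 0ℤ - c * (o * 0ℤ)
                  f = solve-∀
          t o true true = f o
            where f : ∀ o → o * 0ℤ ≡ o * 1ℤ - 1ℤ * (o * 1ℤ)
                  f = solve-∀
          t o true false = f o
            where f : ∀ o → o * 1ℤ ≡ o * 1ℤ - 0ℤ * (o * 1ℤ)
                  f = solve-∀
        value : b2z (out (p₁ e)) * b2z (a (p₁ e)) + b2z (out (p₂ e)) * b2z (a (p₂ e)) + b2z (out (p₃ e)) * b2z (a (p₃ e)) ≡ 1ℤ
        value rewrite out₁ e | out₂ e | out₃ e = go (a (p₁ e)) (a (p₂ e)) (a (p₃ e)) lv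
          where go : ∀ u v w → u ∧ v ∧ w ≡ true → 1ℤ * b2z u + 0ℤ + 0ℤ ≡ 1ℤ
                go true _ _ _ = refl
                go false _ _ ()

      size-out : ∀ a → size a ≡ ∑ xs (λ x → deg a x * b2z (out x))
      size-out a = sym (trans (∑-deg a (λ x → b2z (out x))) (∑-cong es (λ e →
        trans (cong (_*_ (b2z (live a e))) (cong₂ _+_ (cong₂ _+_ (cong b2z (out₁ e)) (cong b2z (out₂ e))) (cong b2z (out₃ e)))) (ℤP.*-identityʳ (b2z (live a e))))))

      record Cap (m κ : ℤ) : Set where
        field
          κ>0 : 0ℤ < κ
          lower : + D₁ * (m * m) ≤ κ * q
          upper : κ * q ≤ + D₁ * (m * m) + q

      -- The cap is D₁m²/P² rounded down, plus 1: always positive, and too large by at most 1.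
      findCap : ∀ m → 1 ℕ.≤ m → Σ ℤ (Cap (+ m))
      findCap m m≥1 = + κ , record
          { κ>0 = +<+ (ℕ.s≤s ℕ.z≤n)
          ; lower = subst₂ _≤_ num (trans (ℤP.pos-* κ (P ℕ.* P)) (cong (_*_ (+ κ)) (ℤP.pos-* P P))) (+≤+ lo)
          ; upper = subst₂ _≤_ (trans (ℤP.pos-* κ (P ℕ.* P)) (cong (_*_ (+ κ)) (ℤP.pos-* P P)))
                      (trans (ℤP.pos-+ T (P ℕ.* P)) (cong₂ _+_ num (ℤP.pos-* P P))) (+≤+ hi) }
        where
        T : ℕ
        T = D₁ ℕ.* (m ℕ.* m)
        instance
          nz : ℕ.NonZero (P ℕ.* P)
          nz = ℕ.>-nonZero (ℕP.*-mono-≤ {1} {P} {1} {P} P≥1 P≥1)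
            where P≥1 : 1 ℕ.≤ P
                  P≥1 = ℕP.*-mono-≤ {1} {h} {1} {mT} h≥1 mT≥1
        κ : ℕ
        κ = suc (T ℕD./ (P ℕ.* P))
        num : + T ≡ + D₁ * (+ m * + m)
        num = trans (ℤP.pos-* D₁ (m ℕ.* m)) (cong (_*_ (+ D₁)) (ℤP.pos-* m m))
        split : T ≡ T ℕD.% (P ℕ.* P) ℕ.+ T ℕD./ (P ℕ.* P) ℕ.* (P ℕ.* P)
        split = ℕD.m≡m%n+[m/n]*n T (P ℕ.* P)
        lo : T ℕ.≤ κ ℕ.* (P ℕ.* P)
        lo = subst (ℕ._≤ κ ℕ.* (P ℕ.* P)) (sym split) (ℕP.+-monoˡ-≤ _ (ℕP.<⇒≤ (ℕD.m%n<n T (P ℕ.* P))))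
        hi : κ ℕ.* (P ℕ.* P) ℕ.≤ T ℕ.+ P ℕ.* P
        hi = ℕP.≤-trans (ℕP.≤-reflexive (ℕP.+-comm (P ℕ.* P) _)) (ℕP.+-monoˡ-≤ (P ℕ.* P) (ℕD.m/n*n≤m T (P ℕ.* P)))

      module AtTime (m κ : ℤ) (m>mT : + mT < m) (m≤p : m ≤ p) (c : Cap m κ) where
        open Cap c

        mT≤m : + mT ≤ m
        mT≤m = ℤP.<⇒≤ m>mT
        m>0 : 0ℤ < m
        m>0 = ℤP.<-trans mT>0 m>mT
        m≥0 : 0ℤ ≤ m
        m≥0 = ℤP.<⇒≤ m>0
        m≥2 : + 2 ≤ m
        m≥2 = ℤP.≤-trans (ℤP.+-monoʳ-≤ 1ℤ (ℤP.i<j⇒suc[i]≤j mT>0)) (ℤP.i<j⇒suc[i]≤j m>mT)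
        κ≥0 : 0ℤ ≤ κ
        κ≥0 = ℤP.<⇒≤ κ>0
        p≤hm : p ≤ + h * m
        p≤hm = subst (_≤ + h * m) (sym p≡) (*-monoˡ-nn (ℤP.<⇒≤ h>0) mT≤m)
        m²≤q : m * m ≤ q
        m²≤q = *-mono-nn m≥0 (ℤP.<⇒≤ p>0) m≤p m≤p
        q≤h²m² : q ≤ + h * m * (+ h * m)
        q≤h²m² = *-mono-nn (ℤP.<⇒≤ p>0) (0≤* (ℤP.<⇒≤ h>0) m≥0) p≤hm p≤hm

        -- Since P ≤ hm, the cap never falls below its initial order by more than a factor h².
        D₁≤κh² : + D₁ ≤ κ * (+ h * + h)
        D₁≤κh² = cancelˡ (pos* m>0 m>0) (ℤP.≤-trans (ℤP.≤-reflexive (ℤP.*-comm (m * m) (+ D₁)))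
          (ℤP.≤-trans lower (ℤP.≤-trans (*-monoˡ-nn κ≥0 q≤h²m²) (ℤP.≤-reflexive (mv κ (+ h) m)))))
          where mv : ∀ k h m → k * (h * m * (h * m)) ≡ m * m * (k * (h * h))
                mv = solve-∀

        κ≤D₁+1 : κ ≤ + D₁ + 1ℤ
        κ≤D₁+1 = cancelˡ q>0 (ℤP.≤-trans (ℤP.≤-reflexive (ℤP.*-comm q κ)) (ℤP.≤-trans upper
          (0≤* (ℤP.<⇒≤ D₁>0) (gap m²≤q) ≤by eq q (+ D₁) m)))
          where eq : ∀ q d m → q * (d + 1ℤ) ≡ d * (m * m) + q + d * (q - m * m)
                eq = solve-∀

        Λ²≤8κC : Λ * Λ ≤ + 8 * (κ * C)
        Λ²≤8κC = cancelˡ (pos* h>0 h>0) (ℤP.≤-trans (ℤP.≤-reflexive (ℤP.*-comm (+ h * + h) (Λ * Λ)))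
          (ℤP.≤-trans amgm-condition (0≤* (0≤* (0≤n 8) C≥0) (gap D₁≤κh²) ≤by eq (+ h) κ C (+ D₁))))
          where eq : ∀ h k c d → h * h * (+ 8 * (k * c)) ≡ + 8 * (d * c) + + 8 * c * (k * (h * h) - d)
                eq = solve-∀

        -- In a step nA falls on average by nA/m, and the count rises by at least (size - n)/(κm).
        -- So κ nA - size + n is κm times the mean number of newly lost out-vertices. As size is the
        -- sum of the live out-degrees, κ nA - size is the sum of the deficits κ - deg. Each deficit
        -- is expressed through `dev`, whose linear occurrence `amgm` turns into 2κ times its square
        -- plus a constant. The resulting 2κV is the gain in `𝔼-V`; the reserve pays for the rest.
        drift : ∀ a → G * (κ * nA a - size a + n) + + 36 * (κ * (q * q * M)) ≤ + 2 * (κ * V m a) + κ * (m * κ₀)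
        drift a = cancelˡ q>0 (ℤP.≤-trans step₁ step₂)
          where
          Q : ℤ
          Q = + D₁ - r
          per : ℤ
          per = G * (Q * (m * m) + q) + C * (q * q * q)
          per≥0 : 0ℤ ≤ per
          per≥0 = 0≤+ (0≤* G≥0 (0≤+ (0≤* (gap r≤D₁) (0≤sq m)) q≥0)) (0≤* C≥0 (0≤* (0≤sq q) q≥0))
          2κq : ℤ
          2κq = + 2 * (κ * q)
          2κq>0 : 0ℤ < 2κq
          2κq>0 = pos* {+ 2} {κ * q} (+<+ (ℕ.s≤s ℕ.z≤n)) (pos* κ>0 q>0)
          G²≤ : G * G ≤ + 4 * (2κq * (C * (q * q * q)))
          G²≤ = 0≤* (0≤sq (q * q)) (gap Λ²≤8κC) ≤by eq Λ q κ C
            where eq : ∀ l q k c → + 4 * (+ 2 * (k * q) * (c * (q * q * q))) ≡ l * (q * q) * (l * (q * q)) + q * q * (q * q) * (+ 8 * (k * c) - l * l)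
                  eq = solve-∀
          alive-out : ∀ x → out x ≡ true → G * (κ * q - q * deg a x) ≤ per + 2κq * (dev m a x * dev m a x)
          alive-out x ox = 0≤+ (0≤+ (gap (amgm {2κq} {C * (q * q * q)} {G} (dev m a x) 2κq>0 G²≤)) (0≤* G≥0 (gap upper)))
                             (0≤* (0≤* G≥0 (0≤sq m)) (gap (out-deg x ox)))
                         ≤by eq G κ q (deg a x) (+ D₁) r m (C * (q * q * q)) 2κq (deg₀ x)
            where eq : ∀ G κ q d D r m c k d₀ → G * ((D - r) * (m * m) + q) + c + k * ((q * d - d₀ * (m * m)) * (q * d - d₀ * (m * m))) ≡
                         G * (κ * q - q * d) + (k * ((q * d - d₀ * (m * m)) * (q * d - d₀ * (m * m))) + c - (- (G * (q * d - d₀ * (m * m))))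
                            + G * (D * (m * m) + q - κ * q) + G * (m * m) * (d₀ - r))
                  eq = solve-∀
          Bound : Bool → Bool → X → Set
          Bound o b x = G * (b2z o * b2z b * (κ * q) - q * (deg a x * b2z o)) ≤ b2z o * b2z b * per + 2κq * (b2z b * (dev m a x * dev m a x))
          pointwise : ∀ x → Bound (out x) (a x) x
          pointwise x = go (out x) (a x) refl
            where
            go : ∀ o b → out x ≡ o → Bound o b x
            go true true ox = subst₂ _≤_ (e₁ G (κ * q) q (deg a x)) (e₂ per 2κq (dev m a x * dev m a x)) (alive-out x ox)
              where
              e₁ : ∀ G k q d → G * (k - q * d) ≡ G * (1ℤ * 1ℤ * k - q * (d * 1ℤ))
              e₁ = solve-∀
              e₂ : ∀ p k z → p + k * z ≡ 1ℤ * 1ℤ * p + k * (1ℤ * z)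
              e₂ = solve-∀
            go true false _ = 0≤* G≥0 (0≤* q≥0 (deg≥0 a x)) ≤by eq G (κ * q) q (deg a x) per 2κq (dev m a x * dev m a x)
              where
              eq : ∀ G k q d p t z → 1ℤ * 0ℤ * p + t * (0ℤ * z) ≡ G * (1ℤ * 0ℤ * k - q * (d * 1ℤ)) + G * (q * d)
              eq = solve-∀
            go false b _ = 0≤* (ℤP.<⇒≤ 2κq>0) (0≤* (b2z≥0 b) (0≤sq (dev m a x))) ≤by eq G (κ * q) q (deg a x) per 2κq (b2z b) (dev m a x * dev m a x)
              where
              eq : ∀ G k q d p t b z → 0ℤ * b * p + t * (b * z) ≡ G * (0ℤ * b * k - q * (d * 0ℤ)) + t * (b * z)
              eq = solve-∀
          summed : G * (nA a * (κ * q) - q * size a) ≤ nA a * per + 2κq * V m a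
          summed = subst₂ _≤_
            (trans (∑-*ˡ xs G _) (cong (_*_ G) (trans (∑-sub xs _ _) (cong₂ _-_ (∑-*ʳ xs (κ * q) _) (trans (∑-*ˡ xs q _) (cong (_*_ q) (sym (size-out a))))))))
            (trans (∑-+ xs _ _) (cong₂ _+_ (∑-*ʳ xs per _) (∑-*ˡ xs 2κq _)))
            (∑-mono xs pointwise)
          T : ℤ
          T = n * (Λ * (Q + + 2) + C) + + 36 * ((+ D₁ + 1ℤ) * M)
          T≥0 : 0ℤ ≤ T
          T≥0 = 0≤+ (0≤* n≥0 (0≤+ (0≤* Λ≥0 (0≤+ (gap r≤D₁) (0≤n 2))) C≥0)) (0≤* (0≤n 36) (0≤* (0≤+ (ℤP.<⇒≤ D₁>0) (0≤n 1)) M≥0))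
          step₁ : q * (G * (κ * nA a - size a + n) + + 36 * (κ * (q * q * M))) ≤ + 2 * (κ * q) * V m a + q * q * q * T
          step₁ = 0≤+ (0≤+ (0≤+ (gap summed) (0≤* (gap (nA≤n a)) per≥0)) (0≤* (0≤* n≥0 G≥0) (0≤* (gap r≤D₁) (gap m²≤q))))
                      (0≤* (0≤* (0≤n 36) (0≤* (0≤* (0≤sq q) q≥0) M≥0)) (gap κ≤D₁+1))
              ≤by eq q Λ κ (nA a) (size a) n M (V m a) C (+ D₁) r m
            where eq : ∀ q Λ κ A s n M V C D r m → + 2 * (κ * q) * V + q * q * q * (n * (Λ * (D - r + + 2) + C) + + 36 * ((D + 1ℤ) * M)) ≡
                    q * (Λ * (q * q) * (κ * A - s + n) + + 36 * (κ * (q * q * M))) +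
                    (A * (Λ * (q * q) * ((D - r) * (m * m) + q) + C * (q * q * q)) + + 2 * (κ * q) * V - Λ * (q * q) * (A * (κ * q) - q * s)
                     + (n - A) * (Λ * (q * q) * ((D - r) * (m * m) + q) + C * (q * q * q))
                     + n * (Λ * (q * q)) * ((D - r) * (q - m * m))
                     + + 36 * (q * q * q * M) * (D + 1ℤ - κ))
                  eq = solve-∀
          -- The origin of the factor h³ in `drift-condition`.
          p³≤ : p * q ≤ + h * (+ h * + h) * (m * (m * m))
          p³≤ = ℤP.≤-trans (*-mono-nn (ℤP.<⇒≤ p>0) (0≤* (0≤* (ℤP.<⇒≤ h>0) m≥0) (0≤* (ℤP.<⇒≤ h>0) m≥0)) p≤hm q≤h²m²) (ℤP.≤-reflexive (mv (+ h) m))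
            where mv : ∀ h m → h * m * (h * m * (h * m)) ≡ h * (h * h) * (m * (m * m))
                  mv = solve-∀
          rescaled : T * (p * q) ≤ + D₁ * θ * (m * (m * m))
          rescaled = ℤP.≤-trans (*-monoˡ-nn T≥0 p³≤) (ℤP.≤-trans (ℤP.≤-reflexive (mv T (+ h * (+ h * + h)) (m * (m * m))))
                       (*-monoʳ-nn (0≤* m≥0 (0≤sq m)) drift-condition))
            where mv : ∀ t h m → t * (h * m) ≡ h * t * m
                  mv = solve-∀
          step₂ : + 2 * (κ * q) * V m a + q * q * q * T ≤ q * (+ 2 * (κ * V m a) + κ * (m * κ₀))
          step₂ = 0≤+ (0≤* (0≤* (ℤP.<⇒≤ p>0) q≥0) (gap rescaled)) (0≤* (0≤* m≥0 (0≤* θ≥0 (0≤* (ℤP.<⇒≤ p>0) q≥0))) (gap lower))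
               ≤by eq p κ (V m a) T (+ D₁) θ m
            where eq : ∀ p κ V T D θ m → p * p * (+ 2 * (κ * V) + κ * (m * (θ * (p * (p * p))))) ≡
                    + 2 * (κ * (p * p)) * V + p * p * (p * p) * (p * p) * T +
                    (p * (p * p) * (D * θ * (m * (m * m)) - T * (p * (p * p))) + m * (θ * (p * (p * p))) * (κ * (p * p) - D * (m * m)))
                  eq = solve-∀

        module Choose (a : State) (s : Str) (fits : Fits s a) (cap : ∀ x → a x ≡ true → deg a x ≤ κ) where
          m≥xs : + length xs ≤ m
          m≥xs = subst (_≤ m) (sym length-xs) (ℤP.≤-trans N≤mT mT≤m)
          deg₀m≤q : ∀ x → deg₀ x * m ≤ q
          deg₀m≤q x = *-mono-nn (∑-0≤ es (λ e → inc≥0 e x)) (ℤP.<⇒≤ p>0)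
            (ℤP.≤-trans (deg₀≤D₀ x) (ℤP.≤-trans D₀≤mT (ℤP.≤-trans mT≤m m≤p))) m≤p
          open Sampling H a κ m cap m≥xs κ≥0

          -- A vetoed edge kills its three vertices all the same, so the probabilities stay exact;
          -- it only fails to enter the structure.
          accepts : Item → Bool
          accepts (edge e) = not (veto s e)
          accepts (vert _) = false
          accepts null     = false

          accepted : ℤ
          accepted = 𝔼 (λ i → b2z (accepts i))

          many-accepted : size a - n ≤ accepted
          many-accepted = subst (size a - n ≤_) (sym (trans (𝔼-split _) eq)) (ℤP.+-monoʳ-≤ (size a) (ℤP.neg-mono-≤ vetoed))
            where
            vetoed : ∑ es (λ e → b2z (live a e) * b2z (veto s e)) ≤ n
            vetoed = ℤP.≤-trans (∑-mono es (λ e → subst (b2z (live a e) * b2z (veto s e) ≤_) (ℤP.*-identityˡ _) (*-monoʳ-nn (b2z≥0 (veto s e)) (b2z≤1 (live a e))))) (few fits)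
            neg : ∀ l b → l * b2z (not b) ≡ l - l * b2z b
            neg l true = e l
              where e : ∀ l → l * 0ℤ ≡ l - l * 1ℤ
                    e = solve-∀
            neg l false = e l
              where e : ∀ l → l * 1ℤ ≡ l - l * 0ℤ
                    e = solve-∀
            eq : ∑ es (λ e → b2z (live a e) * b2z (not (veto s e))) + (∑ xs (λ x → vertWeight x * 0ℤ) + weight null * 0ℤ)
                 ≡ size a - ∑ es (λ e → b2z (live a e) * b2z (veto s e))
            eq = trans (cong₂ (λ u v → u + (v + weight null * 0ℤ)) (trans (∑-cong es (λ e → neg (b2z (live a e)) (veto s e))) (∑-sub es _ _))
                   (trans (∑-*ʳ xs 0ℤ vertWeight) (ℤP.*-zeroʳ (∑ xs vertWeight))))
                   (fin _ (weight null))
              where fin : ∀ u w → u + (0ℤ + w * 0ℤ) ≡ u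
                    fin = solve-∀

          𝔼-nA : 𝔼 (λ i → nA (a ∖ kill i)) ≡ κ * (m - 1ℤ) * nA a
          𝔼-nA = trans (𝔼-∑ xs _) (trans (∑-cong xs per) (∑-*ˡ xs (κ * (m - 1ℤ)) _))
            where
            per : ∀ x → 𝔼 (λ i → b2z (out x) * b2z ((a ∖ kill i) x)) ≡ κ * (m - 1ℤ) * (b2z (out x) * b2z (a x))
            per x = trans (𝔼-*ˡ (b2z (out x)) (λ i → b2z ((a ∖ kill i) x)))
              (trans (cong (_*_ (b2z (out x))) (bool-cases (a x) alive dead)) (mv (b2z (out x)) (κ * (m - 1ℤ)) (b2z (a x))))
              where
              mv : ∀ o k b → o * (k * b) ≡ k * (o * b)
              mv = solve-∀
              alive : a x ≡ true → 𝔼 (λ i → b2z ((a ∖ kill i) x)) ≡ κ * (m - 1ℤ) * b2z (a x)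
              alive ax = trans (𝔼-cong (λ i → trans (cong (λ b → b2z (b ∧ not (kill i x))) ax) (neg (kill i x))))
                           (trans (𝔼-surv x ax) (trans (e κ m) (cong (λ b → κ * (m - 1ℤ) * b2z b) (sym ax))))
                where neg : ∀ b → b2z (not b) ≡ 1ℤ - b2z b
                      neg true = refl
                      neg false = refl
                      e : ∀ k m → k * m - k ≡ k * (m - 1ℤ) * 1ℤ
                      e = solve-∀
              dead : a x ≡ false → 𝔼 (λ i → b2z ((a ∖ kill i) x)) ≡ κ * (m - 1ℤ) * b2z (a x)
              dead ax = trans (𝔼-cong (λ i → cong (λ b → b2z (b ∧ not (kill i x))) ax))
                          (trans (trans (∑-cong items (λ i → ℤP.*-zeroʳ (weight i))) (∑-0 items))
                            (trans (sym (ℤP.*-zeroʳ (κ * (m - 1ℤ)))) (cong (λ b → κ * (m - 1ℤ) * b2z b) (sym ax))))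

          module _ (inv : Inv m a (n - count s)) where
            private
              U const : ℤ
              U = n - count s
              const = (m - 1ℤ - + mT) * κ₀
              -- The left side of the invariant at time m - 1, after item i.
              F : Item → ℤ
              F i = G * + mT * nA (a ∖ kill i) + (m - 1ℤ) * (G * (U - b2z (accepts i) - nA (a ∖ kill i)) + V (m - 1ℤ) (a ∖ kill i) + const)
              𝔼-F : 𝔼 F ≡ (G * + mT - (m - 1ℤ) * G) * (κ * (m - 1ℤ) * nA a)
                         + (m - 1ℤ) * (G * (U * (κ * m) - accepted) + 𝔼 (λ i → V (m - 1ℤ) (a ∖ kill i)) + const * (κ * m))
              𝔼-F = trans (𝔼-cong (λ i → re G (+ mT) (nA (a ∖ kill i)) (m - 1ℤ) U (b2z (accepts i)) (V (m - 1ℤ) (a ∖ kill i)) const))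
                (trans (𝔼-+ _ (λ i → (m - 1ℤ) * (G * (U * 1ℤ - b2z (accepts i)) + V (m - 1ℤ) (a ∖ kill i) + const * 1ℤ)))
                  (cong₂ _+_ (trans (𝔼-*ˡ (G * + mT - (m - 1ℤ) * G) (λ i → nA (a ∖ kill i))) (cong (_*_ (G * + mT - (m - 1ℤ) * G)) 𝔼-nA))
                    (trans (𝔼-*ˡ (m - 1ℤ) (λ i → G * (U * 1ℤ - b2z (accepts i)) + V (m - 1ℤ) (a ∖ kill i) + const * 1ℤ)) (cong (_*_ (m - 1ℤ))
                      (trans (𝔼-+ _ (λ i → const * 1ℤ)) (cong₂ _+_
                        (trans (𝔼-+ _ (λ i → V (m - 1ℤ) (a ∖ kill i))) (cong (_+ 𝔼 (λ i → V (m - 1ℤ) (a ∖ kill i)))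
                          (trans (𝔼-*ˡ G (λ i → U * 1ℤ - b2z (accepts i))) (cong (_*_ G)
                            (trans (𝔼-sub (λ _ → U * 1ℤ) (λ i → b2z (accepts i))) (cong (_- accepted) (trans (𝔼-*ˡ U (λ _ → 1ℤ)) (cong (_*_ U) 𝔼-1))))))))
                        (trans (𝔼-*ˡ const (λ _ → 1ℤ)) (cong (_*_ const) 𝔼-1))))))))
                where re : ∀ G t A m U b V c → G * t * A + m * (G * (U - b - A) + V + c) ≡ (G * t - m * G) * A + m * (G * (U * 1ℤ - b) + V + c * 1ℤ)
                      re = solve-∀
              -- The charge for live out-vertices is a martingale, as mT/(m - 1) times (m - 1)/m is
              -- mT/m. What remains is, up to the factor m - 1, the sum of the slacks in the
              -- invariant, in `drift`, in `many-accepted` and in the bound for V.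
              average : 𝔼 F ≤ κ * m * ((m - 1ℤ) * B)
              average = subst (_≤ κ * m * ((m - 1ℤ) * B)) (sym 𝔼-F)
                (0≤* (gap (ℤP.≤-trans (+≤+ (ℕ.s≤s ℕ.z≤n)) m≥2))
                  (0≤+ (0≤+ (0≤* κ≥0 (gap inv)) (gap (drift a)))
                     (0≤+ (0≤* G≥0 (gap many-accepted)) (gap 𝔼V)))
                 ≤by eq G (+ mT) m κ (nA a) U accepted (𝔼 (λ i → V (m - 1ℤ) (a ∖ kill i))) κ₀ B (V m a) (size a) n (q * q * M))
                where
                𝔼V : 𝔼 (λ i → V (m - 1ℤ) (a ∖ kill i)) ≤ κ * ((m - + 2) * V m a + + 36 * (q * q * M))
                𝔼V = subst (λ t → 𝔼 (λ i → V (m - 1ℤ) (a ∖ kill i)) ≤ κ * ((m - + 2) * V m a + + 36 * (q * q * t))) length-es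
                       (𝔼-V a κ m cap m≥xs κ≥0 m≥2 q≥0 deg₀m≤q)
                eq : ∀ G t m κ A U acc EV κ₀ B V s n M →
                  κ * m * ((m - 1ℤ) * B) ≡
                  (G * t - (m - 1ℤ) * G) * (κ * (m - 1ℤ) * A) + (m - 1ℤ) * (G * (U * (κ * m) - acc) + EV + (m - 1ℤ - t) * κ₀ * (κ * m)) +
                  (m - 1ℤ) * (κ * (m * B - (G * t * A + m * (G * (U - A) + V + (m - t) * κ₀)))
                     + (+ 2 * (κ * V) + κ * (m * κ₀) - (G * (κ * A - s + n) + + 36 * (κ * M)))
                     + (G * (acc - (s - n)) + (κ * ((m - + 2) * V + + 36 * M) - EV)))
                eq = solve-∀

            choose : Σ Item λ i → i ∈ items × 0ℤ < weight i × F i ≤ (m - 1ℤ) * B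
            choose = ∑-average items weight F ((m - 1ℤ) * B) weight≥0 (subst (0ℤ <_) (sym ∑items) (pos* κ>0 m>0))
                       (subst (λ t → 𝔼 F ≤ t * ((m - 1ℤ) * B)) (sym ∑items) average)

            next : ∀ i → i ∈ items → 0ℤ < weight i →
                   Σ Str λ s′ → Fits s′ (a ∖ kill i) × count s′ ≡ count s + b2z (accepts i)
            next (vert x) _ _ = s , shrink (kill (vert x)) fits , sym (ℤP.+-identityʳ (count s))
            next null     _ _ = s , shrink (kill null) fits , sym (ℤP.+-identityʳ (count s))
            next (edge e) i∈ w>0 = bool-cases (veto s e)
                (λ v → s , shrink (killₑ e) fits , trans (sym (ℤP.+-identityʳ (count s))) (cong (λ b → count s + b2z (not b)) (sym v)))
                (λ v → let s′ , f , c = grow fits (e∈es (∈-++⁻ (map edge es) i∈)) (is-live (live a e) w>0) v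
                       in s′ , f , trans c (cong (λ b → count s + b2z (not b)) (sym v)))
              where
              is-live : ∀ b → 0ℤ < b2z b → b ≡ true
              is-live true  _ = refl
              is-live false (+<+ ())
              e∈es : edge e ∈ map edge es ⊎ edge e ∈ map vert xs ++ null ∷ [] → e ∈ es
              e∈es (inj₁ j) with ∈-map⁻ edge j
              ... | _ , k , refl = k
              e∈es (inj₂ j) with ∈-++⁻ (map vert xs) j
              ... | inj₁ k with ∈-map⁻ vert k
              ...   | _ , _ , ()
              e∈es (inj₂ j) | inj₂ (here ())
              e∈es (inj₂ j) | inj₂ (there ())

            -- An accepted edge uses up one live out-vertex. Hence the number of lost out-vertices
            -- stays nonnegative, without which the invariant would not bound V by B.
            nA-next : ∀ i → 0ℤ < weight i → nA (a ∖ kill i) + b2z (accepts i) ≤ nA a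
            nA-next (vert x) _ = subst (_≤ nA a) (sym (ℤP.+-identityʳ _)) (nA-∖ a (kill (vert x)))
            nA-next null     _ = subst (_≤ nA a) (sym (ℤP.+-identityʳ _)) (nA-∖ a (kill null))
            nA-next (edge e) w>0 = ℤP.≤-trans (ℤP.+-monoʳ-≤ (nA (a ∖ killₑ e)) (b2z≤1 (not (veto s e)))) (ℤP.≤-reflexive (nA-killₑ a e (is-live (live a e) w>0)))
              where
              is-live : ∀ b → 0ℤ < b2z b → b ≡ true
              is-live true  _ = refl
              is-live false (+<+ ())

            advance : Σ State λ a′ → Σ Str λ s′ → Fits s′ a′ × Inv (m - 1ℤ) a′ (n - count s′)
                      × (0ℤ ≤ n - count s - nA a → 0ℤ ≤ n - count s′ - nA a′)
            advance = finish choose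
              where
              finish : (Σ Item λ i → i ∈ items × 0ℤ < weight i × F i ≤ (m - 1ℤ) * B) → _
              finish (i , i∈ , w>0 , le) = a ∖ kill i , proj₁ nx , proj₁ (proj₂ nx) , inv′ , λ h →
                  0≤+ h (gap (nA-next i w>0)) ∣ trans (cong (λ t → n - t - nA (a ∖ kill i)) (proj₂ (proj₂ nx))) (eq n (count s) (nA a) (nA (a ∖ kill i)) (b2z (accepts i)))
                where
                nx : Σ Str λ s′ → Fits s′ (a ∖ kill i) × count s′ ≡ count s + b2z (accepts i)
                nx = next i i∈ w>0
                _∣_ : ∀ {x y} → 0ℤ ≤ x → y ≡ x → 0ℤ ≤ y
                u ∣ v = subst (0ℤ ≤_) (sym v) u
                eq : ∀ n c A A′ b → n - (c + b) - A′ ≡ n - c - A + (A - (A′ + b))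
                eq = solve-∀
                inv′ : Inv (m - 1ℤ) (a ∖ kill i) (n - count (proj₁ nx))
                inv′ = subst (λ t → G * + mT * nA (a ∖ kill i) + (m - 1ℤ) * (G * (t - nA (a ∖ kill i)) + V (m - 1ℤ) (a ∖ kill i) + const) ≤ (m - 1ℤ) * B)
                         (trans (assoc n (count s) (b2z (accepts i))) (cong (_-_ n) (sym (proj₂ (proj₂ nx))))) le
                  where assoc : ∀ n c b → n - c - b ≡ n - (c + b)
                        assoc = solve-∀

        V≤B : ∀ a U → 0ℤ ≤ U - nA a → Inv m a U → V m a ≤ B
        V≤B a U U≥ inv = cancelˡ m>0 (ℤP.≤-trans
          (0≤+ (0≤* (0≤* G≥0 (ℤP.<⇒≤ mT>0)) (nA≥0 a)) (0≤* m≥0 (0≤+ (0≤* G≥0 U≥) (0≤* (gap mT≤m) κ₀≥0)))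
            ≤by eq (G * + mT * nA a) m (G * (U - nA a)) (V m a) ((m - + mT) * κ₀)) inv)
          where
          κ₀≥0 : 0ℤ ≤ κ₀
          κ₀≥0 = 0≤* θ≥0 (0≤* (ℤP.<⇒≤ p>0) q≥0)
          eq : ∀ A m g V k → A + m * (g + V + k) ≡ m * V + (A + m * (g + k))
          eq = solve-∀

        -- An overfull vertex has deviation at least ιm², because κq is at least D₁m² and initial
        -- degrees are at most D₁ - ι. The removal of this square from V outweighs the price of one
        -- out-vertex and the shift at the neighbours. The factor (w + 1)/w of `V-delete` costs V/w
        -- at most, and V is at most B.
        deletion : ∀ a U x → 0ℤ ≤ U - nA a → Inv m a U → a x ≡ true → κ < deg a x →
                   Inv m (a ∖ (λ y → ⌊ x ≟ y ⌋)) U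
        deletion a U x U≥ inv ax over =
          ℤP.≤-trans (0≤+ (0≤* (0≤* G≥0 (gap mT≤m)) (gap nA-drop)) (0≤+ (0≤* m≥0 (gap V-drop)) (0≤* G≥0 (ℤP.<⇒≤ mT>0)))
            ≤by eq G (+ mT) m (nA a) (nA a′) U (V m a) (V m a′) ((m - + mT) * κ₀)) inv
          where
          a′ : State
          a′ = a ∖ (λ y → ⌊ x ≟ y ⌋)
          eq : ∀ G t m A A′ U V V′ k → G * t * A + m * (G * (U - A) + V + k) ≡
               G * t * A′ + m * (G * (U - A′) + V′ + k) + (G * (m - t) * (A′ + 1ℤ - A) + (m * (V - (V′ + G)) + G * t))
          eq = solve-∀
          nA-drop : nA a ≤ nA a′ + 1ℤ
          nA-drop = subst (nA a ≤_) (trans (∑-+ xs _ _) (cong (_+_ (nA a′)) (once x))) (∑-mono xs (λ y → t (out y) (a y) (⌊ x ≟ y ⌋)))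
            where t : ∀ o b c → b2z o * b2z b ≤ b2z o * b2z (b ∧ not c) + b2z c
                  t false b c = b2z≥0 c ≤by refl
                  t true false c = b2z≥0 c ≤by refl
                  t true true true = ℤP.≤-refl
                  t true true false = ℤP.≤-refl
          z : ℤ
          z = dev m a x
          z≥ : ι * (m * m) ≤ z
          z≥ = 0≤+ (0≤+ (0≤* q≥0 (gap (ℤP.<⇒≤ over))) (gap lower)) (0≤+ (0≤* (0≤sq m) (gap (deg₀≤D₀ x))) (0≤* (0≤sq m) (gap D₀+ι)))
                 ≤by e q (deg a x) κ (deg₀ x) m D₀ (+ D₁) ι
            where e : ∀ q d κ d₀ m D₀ D₁ ι → q * d - d₀ * (m * m) ≡ ι * (m * m) + (q * (d - κ) + (κ * q - D₁ * (m * m)) + (m * m * (D₀ - d₀) + m * m * (D₁ - (D₀ + ι))))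
                  e = solve-∀
          ιm²≥0 : 0ℤ ≤ ι * (m * m)
          ιm²≥0 = 0≤* ι≥0 (0≤sq m)
          z²≥ : ι * (m * m) * (ι * (m * m)) ≤ z * z
          z²≥ = *-mono-nn ιm²≥0 (ℤP.≤-trans ιm²≥0 z≥) z≥ z≥
          big : ℤ
          big = β + (w * w + w) * (+ 3 * D₀) + w * Λ
          w≥0 : 0ℤ ≤ w
          w≥0 = ℤP.<⇒≤ w>0
          big≥0 : 0ℤ ≤ big
          big≥0 = 0≤+ (0≤+ β≥0 (0≤* (0≤+ (0≤* w≥0 w≥0) w≥0) (0≤* (0≤n 3) D₀≥0))) (0≤* w≥0 Λ≥0)
          q²≤ : q * q ≤ + h * m * (+ h * m) * (+ h * m * (+ h * m))
          q²≤ = *-mono-nn q≥0 (0≤sq (+ h * m)) q≤h²m² q≤h²m²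
          q²big : q * q * big ≤ w * (z * z)
          q²big = ℤP.≤-trans (*-monoʳ-nn big≥0 q²≤) (ℤP.≤-trans (ℤP.≤-reflexive (e₁ (+ h) m big))
            (ℤP.≤-trans (*-monoʳ-nn (0≤sq (m * m)) delete-condition) (ℤP.≤-trans (ℤP.≤-reflexive (e₂ w ι m)) (*-monoˡ-nn w≥0 z²≥))))
            where e₁ : ∀ h m b → h * m * (h * m) * (h * m * (h * m)) * b ≡ (h * h) * (h * h) * b * (m * m * (m * m))
                  e₁ = solve-∀
                  e₂ : ∀ w i m → w * (i * i) * (m * m * (m * m)) ≡ w * (i * (m * m) * (i * (m * m)))
                  e₂ = solve-∀
          V-drop : V m a′ + G ≤ V m a
          V-drop = cancelˡ w>0 (0≤+ (0≤+ (gap (V-delete m a x w w≥0 ax)) (0≤* (0≤* (0≤+ (0≤* w≥0 w≥0) w≥0) (0≤* (0≤n 3) (0≤sq q))) (gap (ℤP.≤-trans (deg≤deg₀ a x) (deg₀≤D₀ x)))))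
                     (0≤+ (0≤+ (gap q²big) (gap (V≤B a U U≥ inv))) (0≤sq z))
                   ≤by e w (V m a) (V m a′) z q (deg a x) D₀ β Λ)
            where e : ∀ w V V′ z q d D₀ β Λ → w * V ≡ w * (V′ + Λ * (q * q)) +
                       ((w + 1ℤ) * (V - z * z) + (w * w + w) * (q * q * (+ 3 * d)) - w * V′ + (w * w + w) * (+ 3 * (q * q)) * (D₀ - d)
                       + (w * (z * z) - q * q * (β + (w * w + w) * (+ 3 * D₀) + w * Λ) + (β * (q * q) - V) + z * z))
                  e = solve-∀

      alive : State → ℤ
      alive a = ∑ xs (λ x → b2z (a x))

      overfull? : ∀ a κ → (Σ X λ x → a x ≡ true × κ < deg a x) ⊎ (∀ x → a x ≡ true → deg a x ≤ κ)
      overfull? a κ = finish (search xs)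
        where
        search : ∀ ys → (Σ X λ x → a x ≡ true × κ < deg a x) ⊎ (∀ x → x ∈ ys → a x ≡ true → deg a x ≤ κ)
        search [] = inj₂ (λ _ ())
        search (y ∷ ys) with search ys
        ... | inj₁ found = inj₁ found
        ... | inj₂ ok with deg a y ≤? κ
        ...   | yes le = inj₂ λ { x (here refl) _ → le ; x (there i) → ok x i }
        ...   | no nle = bool-cases (a y) (λ ay → inj₁ (y , ay , ℤP.≰⇒> nle))
                           (λ ay → inj₂ λ { x (here refl) ax → ⊥-elim (clash (trans (sym ay) ax)) ; x (there i) → ok x i })
          where clash : false ≢ true
                clash ()
        finish : (Σ X λ x → a x ≡ true × κ < deg a x) ⊎ (∀ x → x ∈ xs → a x ≡ true → deg a x ≤ κ) → _
        finish (inj₁ f) = inj₁ f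
        finish (inj₂ g) = inj₂ (λ x → g x (xs-complete x))

      alive-delete : ∀ a x → a x ≡ true → alive (a ∖ (λ y → ⌊ x ≟ y ⌋)) + 1ℤ ≡ alive a
      alive-delete a x ax = trans (cong (_+ 1ℤ) (trans (∑-cong xs (λ y → t (a y) (⌊ x ≟ y ⌋))) (trans (∑-sub xs _ _)
          (cong (_-_ (alive a)) (trans (∑-δ x (λ y → b2z (a y))) (cong b2z ax)))))) (e (alive a))
        where t : ∀ b c → b2z (b ∧ not c) ≡ b2z b - b2z c * b2z b
              t true true = refl
              t true false = refl
              t false true = refl
              t false false = refl
              e : ∀ x → x - 1ℤ + 1ℤ ≡ x
              e = solve-∀

      module _ (m κ : ℤ) (m>mT : + mT < m) (m≤p : m ≤ p) (cp : Cap m κ) (s : Str) where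
        -- Deletions take no time: m and κ stay fixed, while c bounds the number of live vertices
        -- and makes the recursion end.
        trim : ∀ c a → Fits s a → Inv m a (n - count s) → 0ℤ ≤ n - count s - nA a → alive a ≤ + c →
               Σ State λ a′ → Fits s a′ × Inv m a′ (n - count s) × 0ℤ ≤ n - count s - nA a′ × (∀ x → a′ x ≡ true → deg a′ x ≤ κ)
        trim c a fits inv U≥ al with overfull? a κ
        ... | inj₂ cap = a , fits , inv , U≥ , cap
        trim zero a fits inv U≥ al | inj₁ (x , ax , over) =
          ⊥-elim (absurd (ℤP.≤-trans (subst (_≤ alive a) (cong b2z ax) (∑-single≤ xs (λ y → b2z≥0 (a y)) (xs-complete x))) al))
          where absurd : ¬ (1ℤ ≤ 0ℤ)
                absurd (+≤+ ())
        trim (suc c) a fits inv U≥ al | inj₁ (x , ax , over) =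
          trim c (a ∖ k) (shrink k fits) (AtTime.deletion m κ m>mT m≤p cp a (n - count s) x U≥ inv ax over)
            (ℤP.≤-trans U≥ (ℤP.+-monoʳ-≤ (n - count s) (ℤP.neg-mono-≤ (nA-∖ a k))))
            (ungap (subst (0ℤ ≤_) (trans (cong (_-_ (+ suc c)) (sym (alive-delete a x ax))) (e (+ c) (alive (a ∖ k)))) (gap al)))
          where k : X → Bool
                k y = ⌊ x ≟ y ⌋
                e : ∀ c b → 1ℤ + c - (b + 1ℤ) ≡ c - b
                e = solve-∀

      -- At m = mT the charge mT/m of a live out-vertex has reached 1 and the reserve is used up.
      -- The invariant then reads G U + V ≤ B.
      run : ∀ t a s → mT ℕ.+ t ℕ.≤ P → Fits s a → Inv (+ (mT ℕ.+ t)) a (n - count s) → 0ℤ ≤ n - count s - nA a →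
            Σ Str λ s′ → Σ State λ a′ → Fits s′ a′ × G * (n - count s′) ≤ B
      run zero a s _ fits inv U≥ = s , a , fits , cancelˡ mT>0 (ℤP.≤-trans
          (0≤* (ℤP.<⇒≤ mT>0) (V≥0 (+ mT) a) ≤by eq G (+ mT) (nA a) (n - count s) (V (+ mT) a) κ₀)
          (subst (λ k → Inv (+ k) a (n - count s)) (ℕP.+-identityʳ mT) inv))
        where eq : ∀ G t A U V k → G * t * A + t * (G * (U - A) + V + (t - t) * k) ≡ t * (G * U) + t * V
              eq = solve-∀
      run (suc t) a s mt≤P fits inv U≥ =
        let κ , cp = findCap (mT ℕ.+ suc t) (ℕP.≤-trans mT≥1 (ℕP.m≤m+n mT (suc t)))
            a₁ , f₁ , i₁ , u₁ , cap = trim m κ m>mT (+≤+ mt≤P) cp s (length xs) a fits inv U≥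
              (subst (alive a ≤_) (trans (∑-const xs 1ℤ) (ℤP.*-identityʳ _)) (∑-mono xs (λ x → b2z≤1 (a x))))
            a₂ , s₂ , f₂ , i₂ , u₂ = AtTime.Choose.advance m κ m>mT (+≤+ mt≤P) cp a₁ s f₁ cap i₁
        in run t a₂ s₂ (ℕP.≤-trans (ℕP.+-monoʳ-≤ mT (ℕP.n≤1+n t)) mt≤P) f₂ (subst (λ k → Inv k a₂ (n - count s₂)) m-1 i₂) (u₂ u₁)
        where
        m : ℤ
        m = + (mT ℕ.+ suc t)
        m>mT : + mT < m
        m>mT = +<+ (ℕP.m<m+n mT (ℕ.s≤s ℕ.z≤n))
        m-1 : m - 1ℤ ≡ + (mT ℕ.+ t)
        m-1 = cong (_- 1ℤ) (cong +_ (ℕP.+-suc mT t))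

      near-perfect : ∀ s₀ → Fits s₀ (λ _ → true) → count s₀ ≡ 0ℤ →
                     Σ Str λ s → Σ State λ a → Fits s a × Λ * (n - count s) ≤ β
      near-perfect s₀ fits₀ c₀ = let s , a , f , le = run (P ℕ.∸ mT) (λ _ → true) s₀ (ℕP.≤-reflexive P≡) fits₀
                                            (subst (λ k → Inv (+ k) (λ _ → true) (n - count s₀)) (sym P≡) start) U≥
                                 in s , a , f , cancelˡ (pos* q>0 q>0) (subst₂ _≤_ (mv Λ (q * q) (n - count s)) (ℤP.*-comm β (q * q)) le)
        where
        mv : ∀ l q u → l * q * u ≡ q * (l * u)
        mv = solve-∀
        P≡ : mT ℕ.+ (P ℕ.∸ mT) ≡ P
        P≡ = ℕP.m+[n∸m]≡n (subst (ℕ._≤ P) (ℕP.+-identityʳ mT) (ℕP.*-monoˡ-≤ mT h≥1))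
        all : State
        all _ = true
        nA-all : nA all ≡ n
        nA-all = trans (∑-cong xs (λ x → ℤP.*-identityʳ (b2z (out x)))) ∑out
        U≥ : 0ℤ ≤ n - count s₀ - nA all
        U≥ = subst (0ℤ ≤_) (sym (trans (cong₂ (λ c b → n - c - b) c₀ nA-all) (e n))) ℤP.≤-refl
          where e : ∀ n → n - 0ℤ - n ≡ 0ℤ
                e = solve-∀
        -- At time P the target is the initial degree, so V starts at 0.
        dev-all : ∀ x → dev p all x ≡ 0ℤ
        dev-all x = trans (cong (λ t → q * t - deg₀ x * q) (∑-cong es (λ e → ℤP.*-identityˡ (inc e x)))) (e q (deg₀ x))
          where e : ∀ q d → q * d - d * q ≡ 0ℤ
                e = solve-∀
        V-all : V p all ≡ 0ℤ
        V-all = trans (∑-cong xs (λ x → cong (λ t → 1ℤ * (t * t)) (dev-all x))) (∑-0 xs)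
        start : Inv p all (n - count s₀)
        start = subst₂ (λ c v → G * + mT * nA all + p * (G * (n - c - nA all) + v + (p - + mT) * κ₀) ≤ p * B) (sym c₀) (sym V-all)
          (subst (λ b → G * + mT * b + p * (G * (n - 0ℤ - b) + 0ℤ + (p - + mT) * κ₀) ≤ p * B) (sym nA-all)
            (subst (λ t → Λ * (t * t * (t * t)) * + mT * n + t * (Λ * (t * t * (t * t)) * (n - 0ℤ - n) + 0ℤ + (t - + mT) * (θ * (t * (t * t)))) ≤ t * (β * (t * t * (t * t)))) (sym p≡)
              (0≤+ (0≤* (0≤* (ℤP.<⇒≤ mT>0) (0≤sq (t₀ * t₀))) (gap start-condition)) (0≤* (0≤* (ℤP.<⇒≤ mT>0) (0≤sq (t₀ * t₀))) θ≥0)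
                ≤by e (+ h) (+ mT) Λ n θ β)))
          where
          t₀ : ℤ
          t₀ = + h * + mT
          e : ∀ h m Λ n θ β → h * m * (β * (h * m * (h * m) * (h * m * (h * m)))) ≡
              Λ * (h * m * (h * m) * (h * m * (h * m))) * m * n + h * m * (Λ * (h * m * (h * m) * (h * m * (h * m))) * (n - 0ℤ - n) + 0ℤ + (h * m - m) * (θ * (h * m * (h * m * (h * m)))))
              + (m * (h * m * (h * m) * (h * m * (h * m))) * (h * β - (Λ * n + h * θ)) + m * (h * m * (h * m) * (h * m * (h * m))) * θ)
          e = solve-∀

-- An out-regular set of arcs with almost regular in-degrees.

module NearRegularFactor where
  open FiniteSums
  open Hypergraphs using (b2z; b2z≥0; b2z≤1)
  open RandomDeletion using (bool-cases)
  open import Data.Integer using (ℤ; +_; 0ℤ; 1ℤ; _+_; _*_; _-_; -_; _≤_; _<_; _≤?_; +≤+; +<+; ∣_∣; -≤+; -<+)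
  open import Data.Integer.Tactic.RingSolver using (solve-∀)
  open import Data.Nat as ℕ using (ℕ; zero; suc)

  length-filter-∑ : ∀ {A : Set} {P : A → Set} (P? : Decidable P) xs → + length (filter P? xs) ≡ ∑ xs (λ x → b2z ⌊ P? x ⌋)
  length-filter-∑ P? [] = refl
  length-filter-∑ P? (x ∷ xs) with P? x
  ... | yes _ = cong (_+_ 1ℤ) (length-filter-∑ P? xs)
  ... | no _  = trans (length-filter-∑ P? xs) (sym (ℤP.+-identityˡ _))

  ⌊≟true⌋ : ∀ b → ⌊ b Bool.≟ true ⌋ ≡ b
  ⌊≟true⌋ true  = refl
  ⌊≟true⌋ false = refl

  ∑-allFin-suc : ∀ n (f : Fin (suc n) → ℤ) → ∑ (allFin (suc n)) f ≡ f zero + ∑ (allFin n) (f ∘ suc)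
  ∑-allFin-suc n f = cong (_+_ (f zero)) (trans (cong (λ l → ∑ l f) (sym (map-tabulate id suc))) (∑-map suc (allFin n) f))

  Fδ : ∀ {n} → Fin n → Fin n → ℤ
  Fδ x y = b2z ⌊ x Fin.≟ y ⌋

  ∑-Fδ-1 : ∀ {n} (x : Fin n) → ∑ (allFin n) (Fδ x) ≡ 1ℤ
  ∑-Fδ-1 {suc n} zero = trans (∑-allFin-suc n (Fδ zero)) (cong (_+_ 1ℤ) (∑-0 (allFin n)))
  ∑-Fδ-1 {suc n} (suc x) = trans (∑-allFin-suc n (Fδ (suc x))) (trans (ℤP.+-identityˡ _)
    (trans (∑-cong (allFin n) shift) (∑-Fδ-1 x)))
    where shift : ∀ y → Fδ (suc x) (suc y) ≡ Fδ x y
          shift y with x Fin.≟ y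
          ... | yes _ = refl
          ... | no _ = refl

  ∑-Fδ : ∀ {n} (x : Fin n) (f : Fin n → ℤ) → ∑ (allFin n) (λ y → Fδ x y * f y) ≡ f x
  ∑-Fδ {n} x f = trans (∑-cong (allFin n) pt) (trans (∑-*ʳ (allFin n) (f x) (Fδ x)) (trans (cong (_* f x) (∑-Fδ-1 x)) (ℤP.*-identityˡ _)))
    where pt : ∀ y → Fδ x y * f y ≡ Fδ x y * f x
          pt y with x Fin.≟ y
          ... | yes refl = refl
          ... | no _ = refl

  ∑-allFin-1 : ∀ n → ∑ (allFin n) (λ _ → 1ℤ) ≡ + n
  ∑-allFin-1 n = trans (∑-const (allFin n) 1ℤ) (trans (ℤP.*-identityʳ _) (cong +_ (length-tabulate {n = n} id)))

  subselect : ∀ n (f : Fin n → Bool) r → + r ≤ ∑ (allFin n) (λ v → b2z (f v)) →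
              Σ (Fin n → Bool) λ g → (∀ v → g v ≡ true → f v ≡ true) × ∑ (allFin n) (λ v → b2z (g v)) ≡ + r
  subselect n f zero _ = (λ _ → false) , (λ _ ()) , ∑-0 (allFin n)
  subselect zero f (suc r) (+≤+ ())
  subselect (suc n) f (suc r) le = bool-cases (f zero) yes-case no-case
    where
    le′ : + suc r ≤ b2z (f zero) + ∑ (allFin n) (λ v → b2z (f (suc v)))
    le′ = subst (+ suc r ≤_) (∑-allFin-suc n (λ v → b2z (f v))) le
    extend : ∀ b {k} → (b ≡ true → f zero ≡ true) → (Σ (Fin n → Bool) λ g → (∀ v → g v ≡ true → f (suc v) ≡ true) × ∑ (allFin n) (λ v → b2z (g v)) ≡ + k) →
             Σ (Fin (suc n) → Bool) λ g → (∀ v → g v ≡ true → f v ≡ true) × ∑ (allFin (suc n)) (λ v → b2z (g v)) ≡ b2z b + + k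
    extend b {k} h (g , sub , eq) = g′ , sub′ , trans (∑-allFin-suc n (λ v → b2z (g′ v))) (cong (_+_ (b2z b)) eq)
      where g′ : Fin (suc n) → Bool
            g′ zero = b
            g′ (suc v) = g v
            sub′ : ∀ v → g′ v ≡ true → f v ≡ true
            sub′ zero = h
            sub′ (suc v) = sub v
    yes-case : f zero ≡ true → _
    yes-case e = extend true (λ _ → e) (subselect n (f ∘ suc) r
       (ungap (subst (0ℤ ≤_) (trans (cong (λ b → b2z b + S - + suc r) e) (shift S (+ r))) (gap le′))))
      where S : ℤ
            S = ∑ (allFin n) (λ v → b2z (f (suc v)))
            shift : ∀ s r → 1ℤ + s - (1ℤ + r) ≡ s - r
            shift = solve-∀
    no-case : f zero ≡ false → _
    no-case e = extend false (λ ()) (subselect n (f ∘ suc) (suc r)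
       (subst (+ suc r ≤_) (trans (cong (λ b → b2z b + ∑ (allFin n) (λ v → b2z (f (suc v)))) e) (ℤP.+-identityˡ _)) le′))

  module RegularFactor (n : ℕ) (adj : Fin n → Fin n → Bool) (adj-sym : ∀ u v → adj u v ≡ adj v u)
    (dirac : ∀ u → + n ≤ + 2 * ∑ (allFin n) (λ v → b2z (adj u v)))
    (r : ℕ) (4r≤n : + 4 * + r ≤ + n) where

    Σv : (Fin n → ℤ) → ℤ
    Σv = ∑ (allFin n)

    card : (Fin n → Bool) → ℤ
    card X = Σv (λ v → b2z (X v))

    card≥0 : ∀ X → 0ℤ ≤ card X
    card≥0 X = ∑-0≤ (allFin n) (λ v → b2z≥0 (X v))

    card≤n : ∀ X → card X ≤ + n
    card≤n X = subst (card X ≤_) (∑-allFin-1 n) (∑-mono (allFin n) (λ v → b2z≤1 (X v)))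

    edges : (Fin n → Bool) → (Fin n → Bool) → ℤ
    edges X Z = Σv (λ u → Σv (λ v → b2z (X u) * (b2z (adj u v) * b2z (Z v))))

    edges≥0 : ∀ X Z → 0ℤ ≤ edges X Z
    edges≥0 X Z = ∑-0≤ (allFin n) (λ u → ∑-0≤ (allFin n) (λ v → 0≤* (b2z≥0 (X u)) (0≤* (b2z≥0 (adj u v)) (b2z≥0 (Z v)))))

    edges-sym : ∀ X Z → edges X Z ≡ edges Z X
    edges-sym X Z = trans (∑-swap (allFin n) (allFin n) _) (∑-cong (allFin n) (λ v → ∑-cong (allFin n) (λ u →
       trans (mv (b2z (X u)) (b2z (adj u v)) (b2z (Z v))) (cong (λ b → b2z (Z v) * (b2z b * b2z (X u))) (adj-sym u v)))))
      where mv : ∀ x a z → x * (a * z) ≡ z * (a * x)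
            mv = solve-∀

    -- A vertex of X has at least n/2 neighbours, of which at most n - |Z| lie outside Z.
    edges-lower : ∀ X Z → card X * (+ 2 * card Z - + n) ≤ + 2 * edges X Z
    edges-lower X Z = subst₂ _≤_ (∑-*ʳ (allFin n) (+ 2 * card Z - + n) _) (∑-*ˡ (allFin n) (+ 2) _) (∑-mono (allFin n) per)
      where
      per : ∀ u → b2z (X u) * (+ 2 * card Z - + n) ≤ + 2 * Σv (λ v → b2z (X u) * (b2z (adj u v) * b2z (Z v)))
      per u = subst (b2z (X u) * (+ 2 * card Z - + n) ≤_)
          (trans (mv (b2z (X u)) _) (cong (_*_ (+ 2)) (sym (∑-*ˡ (allFin n) (b2z (X u)) _))))
          (*-monoˡ-nn (b2z≥0 (X u)) inner)
        where
        mv : ∀ x s → x * (+ 2 * s) ≡ + 2 * (x * s)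
        mv = solve-∀
        d : ℤ
        d = Σv (λ v → b2z (adj u v))
        both : d + card Z - + n ≤ Σv (λ v → b2z (adj u v) * b2z (Z v))
        both = subst (_≤ Σv (λ v → b2z (adj u v) * b2z (Z v)))
            (trans (∑-sub (allFin n) _ _) (cong₂ _-_ (∑-+ (allFin n) _ _) (∑-allFin-1 n)))
            (∑-mono (allFin n) (λ v → t (adj u v) (Z v)))
          where t : ∀ a b → b2z a + b2z b - 1ℤ ≤ b2z a * b2z b
                t true true = ℤP.≤-refl
                t true false = ℤP.≤-refl
                t false true = ℤP.≤-refl
                t false false = -≤+
        inner : + 2 * card Z - + n ≤ + 2 * Σv (λ v → b2z (adj u v) * b2z (Z v))
        inner = 0≤+ (0≤* (0≤n 2) (gap both)) (gap (dirac u)) ≤by e (card Z) (+ n) (Σv (λ v → b2z (adj u v) * b2z (Z v))) d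
          where e : ∀ z n s d → + 2 * s ≡ + 2 * z - n + (+ 2 * (s - (d + z - n)) + (+ 2 * d - n))
                e = solve-∀

    private
      -- The difference 2x(2z - n) - n(x + z - n) equals (2x - n)(2z - n) + n(z - x), and also 2(n -
      -- 2x)(n - z) + n(x + z - n). The former is visibly nonnegative for 2x ≥ n, the latter for 2x
      -- ≤ n.
      cut-arith : ∀ x z n e → 0ℤ ≤ x → x ≤ z → z ≤ n → n ≤ x + z → x * (+ 2 * z - n) ≤ + 2 * e → n * (x + z - n) ≤ + 4 * e
      cut-arith x z n e x≥0 x≤z z≤n n≤x+z h with ℤP.≤-total n (+ 2 * x)
      ... | inj₁ n≤2x = 0≤+ (0≤* (0≤n 2) (gap h)) (0≤+ (0≤* (gap n≤2x) (0≤+ (gap n≤2x) (0≤* (0≤n 2) (gap x≤z)))) (0≤* (ℤP.≤-trans x≥0 (ℤP.≤-trans x≤z z≤n)) (gap x≤z))) ≤by eq x z n e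
        where eq : ∀ x z n e → + 4 * e ≡ n * (x + z - n) + (+ 2 * (+ 2 * e - x * (+ 2 * z - n)) + ((+ 2 * x - n) * (+ 2 * x - n + + 2 * (z - x)) + n * (z - x)))
              eq = solve-∀
      ... | inj₂ 2x≤n = 0≤+ (0≤* (0≤n 2) (gap h)) (0≤+ (0≤* (0≤n 2) (0≤* (gap 2x≤n) (gap z≤n))) (0≤* (ℤP.≤-trans x≥0 (ℤP.≤-trans x≤z z≤n)) (gap n≤x+z))) ≤by eq x z n e
        where eq : ∀ x z n e → + 4 * e ≡ n * (x + z - n) + (+ 2 * (+ 2 * e - x * (+ 2 * z - n)) + (+ 2 * ((n - + 2 * x) * (n - z)) + n * (x + z - n)))
              eq = solve-∀

    -- The cut condition for an r-regular spanning digraph: of the r|X| arcs leaving X at most r(n -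
    -- |Z|) can end outside Z. That it holds for r ≤ n/4 is the reason for the choice r = ⌊n/4⌋.
    cut : ∀ X Z → + r * (card X + card Z - + n) ≤ edges X Z
    cut X Z with ℤP.≤-total (+ n) (card X + card Z)
    ... | inj₂ small = ℤP.≤-trans (subst (+ r * (card X + card Z - + n) ≤_) (ℤP.*-zeroʳ (+ r)) (*-monoˡ-nn (0≤n r) (ℤP.i≤j⇒i-j≤0 small))) (edges≥0 X Z)
    ... | inj₁ large = cancelˡ {+ 4} (+<+ (ℕ.s≤s ℕ.z≤n)) (ℤP.≤-trans
        (subst (_≤ + n * (card X + card Z - + n)) (ℤP.*-assoc (+ 4) (+ r) _) (*-monoʳ-nn (gap large) 4r≤n)) main)
      where
      main : + n * (card X + card Z - + n) ≤ + 4 * edges X Z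
      main with ℤP.≤-total (card X) (card Z)
      ... | inj₁ le = cut-arith (card X) (card Z) (+ n) (edges X Z) (card≥0 X) le (card≤n Z) large (edges-lower X Z)
      ... | inj₂ ge = subst₂ (λ s e → + n * (s - + n) ≤ + 4 * e) (ℤP.+-comm (card Z) (card X)) (edges-sym Z X)
          (cut-arith (card Z) (card X) (+ n) (edges Z X) (card≥0 Z) ge (card≤n X) (subst (+ n ≤_) (ℤP.+-comm (card X) (card Z)) large) (edges-lower Z X))

    indeg : (Fin n → Fin n → Bool) → Fin n → ℤ
    indeg D v = Σv (λ u → b2z (D u v))

    record OutRegular : Set where
      field
        D   : Fin n → Fin n → Bool
        sub : ∀ u v → D u v ≡ true → adj u v ≡ true
        out : ∀ u → Σv (λ v → b2z (D u v)) ≡ + r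
    open OutRegular

    -- Redirecting an arc to a head whose in-degree is smaller by at least 2 lowers this sum. A
    -- local minimum under such moves already has in-degrees close to r, so no maximum flow is
    -- constructed.
    energy : OutRegular → ℤ
    energy R = Σv (λ v → indeg (D R) v * indeg (D R) v)

    initial : OutRegular
    initial = record { D = λ u → proj₁ (pick u) ; sub = λ u → proj₁ (proj₂ (pick u)) ; out = λ u → proj₂ (proj₂ (pick u)) }
      where
      pick : ∀ u → Σ (Fin n → Bool) λ g → (∀ v → g v ≡ true → adj u v ≡ true) × Σv (λ v → b2z (g v)) ≡ + r
      pick u = subselect n (adj u) r (cancelˡ {+ 4} (+<+ (ℕ.s≤s ℕ.z≤n)) (ℤP.≤-trans 4r≤n
         (0≤+ (gap (dirac u)) (0≤* (0≤n 2) (∑-0≤ (allFin n) (λ v → b2z≥0 (adj u v)))) ≤by e (+ n) (Σv (λ v → b2z (adj u v))))))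
        where e : ∀ n s → + 4 * s ≡ n + (+ 2 * s - n + + 2 * s)
              e = solve-∀

    Improvable : OutRegular → Fin n → Fin n → Fin n → Set
    Improvable R u v v′ = D R u v ≡ true × D R u v′ ≡ false × adj u v′ ≡ true × indeg (D R) v′ + + 2 ≤ indeg (D R) v

    module Swap (R : OutRegular) (u v v′ : Fin n) (imp : Improvable R u v v′) where
      D′ : Fin n → Fin n → Bool
      D′ x y = if ⌊ u Fin.≟ x ⌋ then (if ⌊ v Fin.≟ y ⌋ then false else (if ⌊ v′ Fin.≟ y ⌋ then true else D R x y)) else D R x y

      D′-b2z : ∀ x y → b2z (D′ x y) ≡ b2z (D R x y) + Fδ u x * (Fδ v′ y - Fδ v y)
      D′-b2z x y with u Fin.≟ x
      ... | no _ = sym (ℤP.+-identityʳ _)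
      ... | yes refl with v Fin.≟ y | v′ Fin.≟ y
      ...   | no _ | no _ = sym (ℤP.+-identityʳ _)
      ...   | no _ | yes refl = cong (λ b → b2z b + 1ℤ) (sym (proj₁ (proj₂ imp)))
      ...   | yes refl | no _ = cong (λ b → b2z b + 1ℤ * (0ℤ - 1ℤ)) (sym (proj₁ imp))
      ...   | yes refl | yes refl with trans (sym (proj₁ imp)) (proj₁ (proj₂ imp))
      ...     | ()

      indeg′ : ∀ y → indeg D′ y ≡ indeg (D R) y + (Fδ v′ y - Fδ v y)
      indeg′ y = trans (∑-cong (allFin n) (λ x → D′-b2z x y)) (trans (∑-+ (allFin n) _ _) (cong (_+_ (indeg (D R) y))
                   (∑-Fδ u (λ _ → Fδ v′ y - Fδ v y))))

      R′ : OutRegular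
      R′ = record { D = D′ ; sub = sub′ ; out = out′ }
        where
        sub′ : ∀ x y → D′ x y ≡ true → adj x y ≡ true
        sub′ x y with u Fin.≟ x
        ... | no _ = sub R x y
        ... | yes refl with v Fin.≟ y | v′ Fin.≟ y
        ...   | yes _ | _ = λ ()
        ...   | no _ | yes refl = λ _ → proj₁ (proj₂ (proj₂ imp))
        ...   | no _ | no _ = sub R x y
        out′ : ∀ x → Σv (λ y → b2z (D′ x y)) ≡ + r
        out′ x = trans (∑-cong (allFin n) (D′-b2z x)) (trans (∑-+ (allFin n) _ _) (trans (cong₂ _+_ (out R x)
            (trans (∑-*ˡ (allFin n) (Fδ u x) _) (cong (_*_ (Fδ u x)) (trans (∑-sub (allFin n) _ _) (cong₂ _-_ (∑-Fδ-1 v′) (∑-Fδ-1 v))))))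
            (trans (cong (_+_ (+ r)) (ℤP.*-zeroʳ (Fδ u x))) (ℤP.+-identityʳ (+ r)))))

      energy′ : energy R′ < energy R
      energy′ = ℤP.≤-<-trans bound (subst (energy R - 1ℤ <_) (ℤP.+-identityʳ (energy R)) (ℤP.+-monoʳ-< (energy R) -<+))
        where
        i : Fin n → ℤ
        i = indeg (D R)
        v≢v′ : v ≢ v′
        v≢v′ refl with trans (sym (proj₁ imp)) (proj₁ (proj₂ imp))
        ... | ()
        pt : ∀ y → indeg D′ y * indeg D′ y ≡ i y * i y + (Fδ v′ y * (+ 2 * i y + 1ℤ) - Fδ v y * (+ 2 * i y - 1ℤ))
        pt y = trans (cong (λ t → t * t) (indeg′ y)) (table y)
          where
          table : ∀ y → (i y + (Fδ v′ y - Fδ v y)) * (i y + (Fδ v′ y - Fδ v y)) ≡ i y * i y + (Fδ v′ y * (+ 2 * i y + 1ℤ) - Fδ v y * (+ 2 * i y - 1ℤ))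
          table y with v′ Fin.≟ y | v Fin.≟ y
          ... | yes refl | yes refl = ⊥-elim (v≢v′ refl)
          ... | yes _ | no _ = e (i y)
            where e : ∀ t → (t + (1ℤ - 0ℤ)) * (t + (1ℤ - 0ℤ)) ≡ t * t + (1ℤ * (+ 2 * t + 1ℤ) - 0ℤ * (+ 2 * t - 1ℤ))
                  e = solve-∀
          ... | no _ | yes _ = e (i y)
            where e : ∀ t → (t + (0ℤ - 1ℤ)) * (t + (0ℤ - 1ℤ)) ≡ t * t + (0ℤ * (+ 2 * t + 1ℤ) - 1ℤ * (+ 2 * t - 1ℤ))
                  e = solve-∀
          ... | no _ | no _ = e (i y)
            where e : ∀ t → (t + (0ℤ - 0ℤ)) * (t + (0ℤ - 0ℤ)) ≡ t * t + (0ℤ * (+ 2 * t + 1ℤ) - 0ℤ * (+ 2 * t - 1ℤ))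
                  e = solve-∀
        value : energy R′ ≡ energy R + ((+ 2 * i v′ + 1ℤ) - (+ 2 * i v - 1ℤ))
        value = trans (∑-cong (allFin n) pt) (trans (∑-+ (allFin n) _ _) (cong (_+_ (energy R)) (trans (∑-sub (allFin n) _ _)
                  (cong₂ _-_ (∑-Fδ v′ (λ y → + 2 * i y + 1ℤ)) (∑-Fδ v (λ y → + 2 * i y - 1ℤ))))))
        bound : energy R′ ≤ energy R - 1ℤ
        bound = subst (_≤ energy R - 1ℤ) (sym value)
          (0≤+ (0≤n 1) (0≤* (0≤n 2) (gap (proj₂ (proj₂ (proj₂ imp))))) ≤by e (energy R) (i v) (i v′))
          where e : ∀ E a b → E - 1ℤ ≡ E + (+ 2 * b + 1ℤ - (+ 2 * a - 1ℤ)) + (1ℤ + + 2 * (a - (b + + 2)))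
                e = solve-∀

    energy≥0 : ∀ R → 0ℤ ≤ energy R
    energy≥0 R = ∑-0≤ (allFin n) (λ v → 0≤sq (indeg (D R) v))

    Optimal : OutRegular → Set
    Optimal R = ∀ u v v′ → ¬ Improvable R u v v′

    descend : ∀ R → Acc ℕ._<_ ∣ energy R ∣ → Σ OutRegular Optimal
    descend R (acc rec) with any? (λ u → any? (λ v → any? (λ v′ →
          (D R u v Bool.≟ true) ×-dec ((D R u v′ Bool.≟ false) ×-dec ((adj u v′ Bool.≟ true) ×-dec (indeg (D R) v′ + + 2 ≤? indeg (D R) v))))))
    ... | yes (u , v , v′ , imp) = descend (Swap.R′ R u v v′ imp) (rec (drop (energy≥0 (Swap.R′ R u v v′ imp)) (Swap.energy′ R u v v′ imp)))
      where drop : ∀ {a b} → 0ℤ ≤ a → a < b → ∣ a ∣ ℕ.< ∣ b ∣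
            drop (+≤+ _) (+<+ lt) = lt
    ... | no none = R , λ u v v′ imp → none (u , v , v′ , imp)

    optimum : Σ OutRegular Optimal
    optimum = descend initial (<-wellFounded _)

    module Levels (R : OutRegular) (opt : Optimal R) where
      level : ℤ → Fin n → Bool
      level k v = ⌊ k ≤? indeg (D R) v ⌋

      below : ℤ → Fin n → Bool
      below k v = not (level k v)

      card-below : ∀ k → card (below k) ≡ + n - card (level k)
      card-below k = trans (∑-cong (allFin n) (λ v → t (level k v))) (trans (∑-sub (allFin n) _ _) (cong (_- card (level k)) (∑-allFin-1 n)))
        where t : ∀ b → b2z (not b) ≡ 1ℤ - b2z b
              t true = refl
              t false = refl

      -- Optimality forces all arcs from the in-neighbours X of level k to the vertices below level k - 1 into D.
      level-step : ∀ k → k * card (level k) ≤ + r * card (level (k - 1ℤ))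
      -- The r|X| arcs leaving X include at least k|Y| arcs into Y and all of the edges from X to Z.
      -- By `cut` the latter are at least r(|X| + |Z| - n), where n - |Z| is the size of the level k
      -- - 1.
      level-step k = 0≤+ (gap flow) (gap (cut X Z)) ≤by e (+ r) (card X) (card Y) (card (level (k - 1ℤ))) (card Z) k (+ n) (edges X Z) (card-below (k - 1ℤ))
        where
        Y Z X : Fin n → Bool
        Y = level k
        Z = below (k - 1ℤ)
        X u = ⌊ any? (λ v → (D R u v Bool.≟ true) ×-dec (Y v Bool.≟ true)) ⌋
        e : ∀ r x y y′ z k n E → z ≡ n - y′ → r * y′ ≡ k * y + (r * x - (k * y + E) + (E - r * (x + z - n)))
        e r x y y′ _ k n E refl = e′ r x y y′ k n E
          where e′ : ∀ r x y y′ k n E → r * y′ ≡ k * y + (r * x - (k * y + E) + (E - r * (x + (n - y′) - n)))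
                e′ = solve-∀
        level⇒ : ∀ k v → level k v ≡ true → k ≤ indeg (D R) v
        level⇒ k v with k ≤? indeg (D R) v
        ... | yes p = λ _ → p
        ... | no _ = λ ()
        below⇒ : ∀ k v → below k v ≡ true → indeg (D R) v < k
        below⇒ k v with k ≤? indeg (D R) v
        ... | yes _ = λ ()
        ... | no p = λ _ → ℤP.≰⇒> p
        X⇐ : ∀ u v → D R u v ≡ true → Y v ≡ true → X u ≡ true
        X⇐ u v d y with any? (λ v → (D R u v Bool.≟ true) ×-dec (Y v Bool.≟ true))
        ... | yes _ = refl
        ... | no p = ⊥-elim (p (v , d , y))
        X⇒ : ∀ u → X u ≡ true → Σ (Fin n) λ v → D R u v ≡ true × Y v ≡ true
        X⇒ u with any? (λ v → (D R u v Bool.≟ true) ×-dec (Y v Bool.≟ true))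
        ... | yes p = λ _ → p
        ... | no _ = λ ()
        saturated : ∀ u v → X u ≡ true → Z v ≡ true → adj u v ≡ true → D R u v ≡ true
        saturated u v x z a = bool-cases (D R u v) id (λ d → let v₀ , d₀ , y₀ = X⇒ u x in
          ⊥-elim (opt u v₀ v (d₀ , d , a , ℤP.≤-trans (far (indeg (D R) v) k (below⇒ (k - 1ℤ) v z)) (level⇒ k v₀ y₀))))
          where far : ∀ i k → i < k - 1ℤ → i + + 2 ≤ k
                far i k lt = ungap (subst (0ℤ ≤_) (e₂ i k) (gap (ℤP.i<j⇒suc[i]≤j lt)))
                  where e₂ : ∀ i k → k - 1ℤ - (1ℤ + i) ≡ k - (i + + 2)
                        e₂ = solve-∀
        disjoint : ∀ v → Y v ≡ true → Z v ≡ true → ⊥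
        disjoint v y z = ℤP.<-irrefl refl (ℤP.<-≤-trans (below⇒ (k - 1ℤ) v z) (ℤP.≤-trans (ℤP.i≤j⇒i-k≤j 1ℤ ℤP.≤-refl) (level⇒ k v y)))
        pointwise : ∀ u v → b2z (D R u v) * b2z (Y v) + b2z (X u) * (b2z (adj u v) * b2z (Z v)) ≤ b2z (X u) * b2z (D R u v)
        pointwise u v = t (X u) (D R u v) (adj u v) (Y v) (Z v) (X⇐ u v) (saturated u v) (disjoint v)
          where
          t : ∀ x d a y z → (d ≡ true → y ≡ true → x ≡ true) → (x ≡ true → z ≡ true → a ≡ true → d ≡ true) → (y ≡ true → z ≡ true → ⊥) →
              b2z d * b2z y + b2z x * (b2z a * b2z z) ≤ b2z x * b2z d
          t x d a true true f g h = ⊥-elim (h refl refl)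
          t true true a true false f g h = ℤP.≤-reflexive (e₁ (b2z a))
            where e₁ : ∀ a → 1ℤ * 1ℤ + 1ℤ * (a * 0ℤ) ≡ 1ℤ * 1ℤ
                  e₁ = solve-∀
          t true false a true false f g h = ℤP.≤-reflexive (e₁ (b2z a))
            where e₁ : ∀ a → 0ℤ * 1ℤ + 1ℤ * (a * 0ℤ) ≡ 1ℤ * 0ℤ
                  e₁ = solve-∀
          t false true a true false f g h with f refl refl
          ... | ()
          t false false a true false f g h = ℤP.≤-refl
          t false true a false z f g h = ℤP.≤-refl
          t false false a false z f g h = ℤP.≤-refl
          t true true true false true f g h = ℤP.≤-refl
          t true true false false true f g h = +≤+ ℕ.z≤n
          t true true true false false f g h = +≤+ ℕ.z≤n
          t true true false false false f g h = +≤+ ℕ.z≤n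
          t true false true false true f g h with g refl refl refl
          ... | ()
          t true false false false true f g h = ℤP.≤-refl
          t true false true false false f g h = ℤP.≤-refl
          t true false false false false f g h = ℤP.≤-refl
        flow : k * card Y + edges X Z ≤ + r * card X
        flow = ℤP.≤-trans (ℤP.+-monoˡ-≤ (edges X Z) weighted) (subst₂ _≤_ split total (∑-mono (allFin n) (λ u → ∑-mono (allFin n) (pointwise u))))
          where
          weighted : k * card Y ≤ Σv (λ v → b2z (Y v) * indeg (D R) v)
          weighted = subst (_≤ Σv (λ v → b2z (Y v) * indeg (D R) v)) (trans (∑-*ʳ (allFin n) k _) (ℤP.*-comm (card Y) k))
            (∑-mono (allFin n) (λ v → bool-cases (Y v)
               (λ y → *-monoˡ-nn (b2z≥0 (Y v)) (level⇒ k v y))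
               (λ y → subst (λ b → b2z b * k ≤ b2z b * indeg (D R) v) (sym y) ℤP.≤-refl)))
          split : Σv (λ u → Σv (λ v → b2z (D R u v) * b2z (Y v) + b2z (X u) * (b2z (adj u v) * b2z (Z v))))
                  ≡ Σv (λ v → b2z (Y v) * indeg (D R) v) + edges X Z
          split = trans (∑-cong (allFin n) (λ u → ∑-+ (allFin n) _ _)) (trans (∑-+ (allFin n) _ _) (cong (_+ edges X Z)
                    (trans (∑-swap (allFin n) (allFin n) _) (∑-cong (allFin n) (λ v → trans (∑-*ʳ (allFin n) (b2z (Y v)) _) (ℤP.*-comm (indeg (D R) v) (b2z (Y v))))))))
          total : Σv (λ u → Σv (λ v → b2z (X u) * b2z (D R u v))) ≡ + r * card X
          total = trans (∑-cong (allFin n) (λ u → trans (∑-*ˡ (allFin n) (b2z (X u)) _) (trans (cong (_*_ (b2z (X u))) (out R u)) (ℤP.*-comm (b2z (X u)) (+ r)))))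
                    (∑-*ˡ (allFin n) (+ r) _)

      -- From in-degree r + j on, `level-step` shrinks each level at least by the factor r/(r + j).
      level-decay : ∀ j i → + ((r ℕ.+ j) ℕ.^ i) * card (level (+ (r ℕ.+ j ℕ.+ i))) ≤ + (r ℕ.^ i) * + n
      level-decay j zero = *-monoˡ-nn (0≤n 1) (card≤n _)
      level-decay j (suc i) = ℤP.≤-trans (ℤP.≤-reflexive (trans (cong (_* c′) (ℤP.pos-* (r ℕ.+ j) ((r ℕ.+ j) ℕ.^ i))) (e₁ (+ (r ℕ.+ j)) A c′)))
        (ℤP.≤-trans (*-monoˡ-nn (0≤n ((r ℕ.+ j) ℕ.^ i)) one)
        (ℤP.≤-trans (ℤP.≤-reflexive (e₂ A (+ r) c)) (ℤP.≤-trans (*-monoˡ-nn (0≤n r) (level-decay j i))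
          (ℤP.≤-reflexive (trans (sym (ℤP.*-assoc (+ r) (+ (r ℕ.^ i)) (+ n))) (cong (_* + n) (sym (ℤP.pos-* r (r ℕ.^ i)))))))))
        where
        A c c′ : ℤ
        A = + ((r ℕ.+ j) ℕ.^ i)
        c = card (level (+ (r ℕ.+ j ℕ.+ i)))
        c′ = card (level (+ (r ℕ.+ j ℕ.+ suc i)))
        e₁ : ∀ k a c → k * a * c ≡ a * (k * c)
        e₁ = solve-∀
        e₂ : ∀ a r c → a * (r * c) ≡ r * (a * c)
        e₂ = solve-∀
        one : + (r ℕ.+ j) * c′ ≤ + r * c
        one = ℤP.≤-trans (*-monoʳ-nn (card≥0 _) (+≤+ (ℕP.m≤m+n (r ℕ.+ j) (suc i))))
          (subst (λ k → + (r ℕ.+ j ℕ.+ suc i) * c′ ≤ + r * card (level k)) (cong (λ t → + t - 1ℤ) (ℕP.+-suc (r ℕ.+ j) i)) (level-step (+ (r ℕ.+ j ℕ.+ suc i))))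

      -- The growth hypothesis leaves fewer than one vertex in the level r + 2j.
      indeg-bound : ∀ j → r ℕ.^ j ℕ.* n ℕ.< (r ℕ.+ j) ℕ.^ j → ∀ v → indeg (D R) v ≤ + (r ℕ.+ j ℕ.+ j)
      indeg-bound j growth v with indeg (D R) v ≤? + (r ℕ.+ j ℕ.+ j)
      ... | yes p = p
      ... | no p = ⊥-elim (ℤP.<-irrefl refl (ℤP.<-≤-trans (+<+ growth) (ℤP.≤-trans
          (ℤP.≤-trans (ℤP.≤-reflexive (sym (ℤP.*-identityʳ _))) (*-monoˡ-nn (0≤n ((r ℕ.+ j) ℕ.^ j)) one≤))
          (ℤP.≤-trans (level-decay j j) (ℤP.≤-reflexive (sym (ℤP.pos-* (r ℕ.^ j) n)))))))
        where
        one≤ : 1ℤ ≤ card (level (+ (r ℕ.+ j ℕ.+ j)))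
        one≤ = subst (_≤ card (level (+ (r ℕ.+ j ℕ.+ j)))) (cong b2z in-level) (∑-single≤ (allFin n) (λ y → b2z≥0 (level (+ (r ℕ.+ j ℕ.+ j)) y)) (∈-allFin v))
          where
          in-level : level (+ (r ℕ.+ j ℕ.+ j)) v ≡ true
          in-level with + (r ℕ.+ j ℕ.+ j) ≤? indeg (D R) v
          ... | yes _ = refl
          ... | no q = ⊥-elim (q (ℤP.<⇒≤ (ℤP.≰⇒> p)))

    factor : ∀ j → r ℕ.^ j ℕ.* n ℕ.< (r ℕ.+ j) ℕ.^ j → Σ OutRegular λ R → ∀ v → indeg (D R) v ≤ + (r ℕ.+ j ℕ.+ j)
    factor j growth = let R , opt = optimum in R , Levels.indeg-bound R opt j growth

-- Cyclic orders and the removal of non-adjacent consecutive pairs.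

module CyclicOrders where
  open FiniteSums
  open Hypergraphs using (b2z; b2z≥0)
  open RandomDeletion using (bool-cases)
  open import Data.Integer using (ℤ; +_; 0ℤ; 1ℤ; _+_; _*_; _-_; -_; _≤_; +≤+; +<+)
  open import Data.Integer.Tactic.RingSolver using (solve-∀)
  open import Data.List.Relation.Binary.Permutation.Propositional.Properties using (shift)
  open import Data.Nat as ℕ using (ℕ; zero; suc)

  private
    variable
      A : Set

  +-cancelˡ-≤ : ∀ k {a b} → k + a ≤ k + b → a ≤ b
  +-cancelˡ-≤ k {a} {b} le = ungap (subst (0ℤ ≤_) (e k a b) (gap le))
    where e : ∀ k a b → k + b - (k + a) ≡ b - a
          e = solve-∀

  ∑-↭ : ∀ {xs ys : List A} f → xs ↭ ys → ∑ xs f ≡ ∑ ys f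
  ∑-↭ f refl = refl
  ∑-↭ f (prep x p) = cong (_+_ (f x)) (∑-↭ f p)
  ∑-↭ f (swap {xs} {ys} x y p) = trans (cong (λ t → f x + (f y + t)) (∑-↭ f p)) (e (f x) (f y) (∑ ys f))
    where e : ∀ a b c → a + (b + c) ≡ b + (a + c)
          e = solve-∀
  ∑-↭ f (ptrans p q) = trans (∑-↭ f p) (∑-↭ f q)

  Unique-resp-↭ : ∀ {xs ys : List A} → xs ↭ ys → Unique xs → Unique ys
  Unique-resp-↭ refl u = u
  Unique-resp-↭ (prep x p) (a ∷ u) = All-resp-↭ p a ∷ Unique-resp-↭ p u
  Unique-resp-↭ (swap x y p) ((x≢y ∷ a) ∷ b ∷ u) = ((λ e → x≢y (sym e)) ∷ All-resp-↭ p b) ∷ All-resp-↭ p a ∷ Unique-resp-↭ p u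
  Unique-resp-↭ (ptrans p q) u = Unique-resp-↭ q (Unique-resp-↭ p u)

  Unique-⊆-length : ∀ {xs ys : List A} → Unique xs → (∀ {x} → x ∈ xs → x ∈ ys) → length xs ℕ.≤ length ys
  Unique-⊆-length {xs = []} u sub = ℕ.z≤n
  Unique-⊆-length {xs = x ∷ xs} (a ∷ u) sub with ∈-∃++ (sub (here refl))
  ... | ps , qs , refl = subst (suc (length xs) ℕ.≤_) (sym (↭-length (shift x ps qs)))
      (ℕ.s≤s (Unique-⊆-length u (λ {y} i → drop i (∈-resp-↭ (shift x ps qs) (sub (there i))))))
    where drop : ∀ {y} → y ∈ xs → y ∈ x ∷ ps ++ qs → y ∈ ps ++ qs
          drop i (here refl) = ⊥-elim (All.lookup a i refl)
          drop i (there j) = j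

  Unique-without : ∀ c (C : List ℕ) → Unique C → length C ℕ.≤ suc (length (filter (λ d → ¬? (d ℕP.≟ c)) C))
  Unique-without c C u = Unique-⊆-length {ys = c ∷ filter (λ d → ¬? (d ℕP.≟ c)) C} u sub
    where
    sub : ∀ {x} → x ∈ C → x ∈ c ∷ filter (λ d → ¬? (d ℕP.≟ c)) C
    sub {x} i with x ℕP.≟ c
    ... | yes refl = here refl
    ... | no ne = there (∈-filter⁺ (λ d → ¬? (d ℕP.≟ c)) i ne)

  steps : List A → List (A × A)
  steps [] = []
  steps (x ∷ []) = []
  steps (x ∷ y ∷ l) = (x , y) ∷ steps (y ∷ l)

  steps-++ : ∀ (xs : List A) z ys → steps (xs ++ z ∷ ys) ≡ steps (xs ∷ʳ z) ++ steps (z ∷ ys)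
  steps-++ [] z ys = refl
  steps-++ (x ∷ []) z ys = refl
  steps-++ (x ∷ y ∷ xs) z ys = cong ((x , y) ∷_) (steps-++ (y ∷ xs) z ys)

  steps-reverse : ∀ (l : List A) → steps (reverse l) ↭ map Prod.swap (steps l)
  steps-reverse [] = ↭-refl
  steps-reverse (x ∷ []) = ↭-refl
  steps-reverse (x ∷ y ∷ l) = ↭-trans (↭-reflexive eq) (↭-trans (++-comm (steps (reverse (y ∷ l))) [ (y , x) ]) (prep (y , x) (steps-reverse (y ∷ l))))
    where
    eq : steps (reverse (x ∷ y ∷ l)) ≡ steps (reverse (y ∷ l)) ++ [ (y , x) ]
    eq = trans (cong steps (trans (unfold-reverse x (y ∷ l)) (trans (cong (_∷ʳ x) (unfold-reverse y l)) (++-assoc (reverse l) [ y ] [ x ]))))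
           (trans (steps-++ (reverse l) y [ x ]) (cong (λ t → steps t ++ [ (y , x) ]) (sym (unfold-reverse y l))))

  steps-split : ∀ {l : List A} {a b} → (a , b) ∈ steps l → Σ (List A) λ p → Σ (List A) λ s → l ≡ p ++ a ∷ b ∷ s
  steps-split {l = x ∷ y ∷ l} (here refl) = [] , l , refl
  steps-split {l = x ∷ y ∷ l} (there i) with steps-split {l = y ∷ l} i
  ... | p , s , e = x ∷ p , s , cong (x ∷_) e

  ∑-steps₁ : ∀ (f : A → ℤ) T x → ∑ (steps (T ∷ʳ x)) (λ e → f (proj₁ e)) + f x ≡ ∑ (T ∷ʳ x) f
  ∑-steps₁ f [] x = trans (ℤP.+-identityˡ (f x)) (sym (ℤP.+-identityʳ (f x)))
  ∑-steps₁ f (y ∷ []) x = e (f y) (f x)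
    where e : ∀ a b → a + 0ℤ + b ≡ a + (b + 0ℤ)
          e = solve-∀
  ∑-steps₁ f (y ∷ z ∷ T) x = trans (ℤP.+-assoc (f y) _ _) (cong (_+_ (f y)) (∑-steps₁ f (z ∷ T) x))

  ∑-steps₂ : ∀ (f : A → ℤ) y t → f y + ∑ (steps (y ∷ t)) (λ e → f (proj₂ e)) ≡ ∑ (y ∷ t) f
  ∑-steps₂ f y [] = refl
  ∑-steps₂ f y (z ∷ t) = cong (_+_ (f y)) (∑-steps₂ f z t)

  length-steps : ∀ (y : A) t → length (steps (y ∷ t)) ≡ length t
  length-steps y [] = refl
  length-steps y (z ∷ t) = cong suc (length-steps z t)

  cyc : List A → List (A × A)
  cyc [] = []
  cyc (y ∷ t) = steps (y ∷ t ∷ʳ y)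

  snoc-view : ∀ (y : A) t → Σ (List A) λ T → Σ A λ x → y ∷ t ≡ T ∷ʳ x
  snoc-view y [] = [] , y , refl
  snoc-view y (z ∷ t) with snoc-view z t
  ... | T , x , e = y ∷ T , x , cong (y ∷_) e

  -- Turns the cyclic order until the chosen pair is the seam, from the last element a back to the
  -- first element b. A gap is then always treated as the two ends of a path.
  rotate : ∀ (y : A) t {a b} → (a , b) ∈ cyc (y ∷ t) →
    Σ (List A) λ t′ → Σ (List A) λ T → b ∷ t′ ≡ T ∷ʳ a × (b ∷ t′ ↭ y ∷ t) × (cyc (b ∷ t′) ↭ cyc (y ∷ t))
  rotate {A} y t {a} {b} i with steps-split i
  ... | p , s , e = go s e
    where
    go : ∀ s → y ∷ t ∷ʳ y ≡ p ++ a ∷ b ∷ s → Σ (List A) λ t′ → Σ (List A) λ T → b ∷ t′ ≡ T ∷ʳ a × (b ∷ t′ ↭ y ∷ t) × (cyc (b ∷ t′) ↭ cyc (y ∷ t))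
    go [] e with ∷ʳ-injective (y ∷ t) (p ∷ʳ a) (trans e (sym (++-assoc p [ a ] [ b ])))
    ... | e₁ , refl = t , p , e₁ , ↭-refl , ↭-refl
    go (c ∷ s) e with snoc-view c s
    ... | S , d , eS with ∷ʳ-injective (y ∷ t) (p ++ a ∷ b ∷ S) (trans e (trans (cong (λ u → p ++ a ∷ b ∷ u) eS) (sym (++-assoc p (a ∷ b ∷ S) [ d ]))))
    ...   | e₁ , refl = S ++ p ∷ʳ a , b ∷ S ++ p , cong (b ∷_) (sym (++-assoc S p [ a ])) ,
              ↭-trans (++-comm (b ∷ S) (p ∷ʳ a)) (↭-reflexive (trans (++-assoc p [ a ] (b ∷ S)) (sym e₁))) ,
              ↭-trans (↭-reflexive new) (↭-trans (++-comm (steps (b ∷ S ∷ʳ y)) (steps (p ∷ʳ a) ++ [ (a , b) ])) (↭-reflexive (sym old)))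
      where
      old : cyc (y ∷ t) ≡ (steps (p ∷ʳ a) ++ [ (a , b) ]) ++ steps (b ∷ S ∷ʳ y)
      old = trans (cong steps (trans (cong (_∷ʳ y) e₁) (++-assoc p (a ∷ b ∷ S) [ y ])))
              (trans (steps-++ p a (b ∷ S ∷ʳ y)) (sym (++-assoc (steps (p ∷ʳ a)) [ (a , b) ] _)))
      starts : Σ (List A) λ p′ → p ∷ʳ a ≡ y ∷ p′
      starts = head≡ p e₁
        where head≡ : ∀ p → y ∷ t ≡ p ++ a ∷ b ∷ S → Σ (List A) λ p′ → p ∷ʳ a ≡ y ∷ p′
              head≡ [] refl = [] , refl
              head≡ (_ ∷ p) refl = p ∷ʳ a , refl
      new : cyc (b ∷ S ++ p ∷ʳ a) ≡ steps (b ∷ S ∷ʳ y) ++ (steps (p ∷ʳ a) ++ [ (a , b) ])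
      new = trans (cong steps (cong (b ∷_) (trans (++-assoc S (p ∷ʳ a) [ b ]) (cong (λ u → S ++ u ∷ʳ b) (proj₂ starts)))))
              (trans (steps-++ (b ∷ S) y (proj₁ starts ∷ʳ b)) (cong (steps (b ∷ S ∷ʳ y) ++_)
                (trans (cong (λ u → steps (u ∷ʳ b)) (sym (proj₂ starts))) (trans (cong steps (++-assoc p [ a ] [ b ])) (steps-++ p a [ b ])))))

  module Closing (n : ℕ) (adj : Fin n → Fin n → Bool) (adj-sym : ∀ u v → adj u v ≡ adj v u) (adj-irrefl : ∀ v → adj v v ≡ false)
    (col : Fin n → Fin n → ℕ) (col-sym : ∀ u v → col u v ≡ col v u)
    (dirac : ∀ u → + n ≤ + 2 * ∑ (allFin n) (λ v → b2z (adj u v))) where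

    Pair : Set
    Pair = Fin n × Fin n

    isEdge : Pair → Bool
    isEdge (u , v) = adj u v

    gaps : List Pair → ℤ
    gaps E = ∑ E (λ e → b2z (not (isEdge e)))

    Shows : List Pair → ℕ → Set
    Shows E c = Σ Pair λ e → e ∈ E × isEdge e ≡ true × col (proj₁ e) (proj₂ e) ≡ c

    -- Dirac's count. In the absence of loops all neighbours of the last vertex x occur as first
    -- members of consecutive pairs, and all neighbours of the first vertex y as second members. The
    -- two degrees add up to at least n, and there are only n - 1 pairs, so some pair is counted
    -- twice.
    crossing : ∀ y t T x → y ∷ t ≡ T ∷ʳ x → (y ∷ t ↭ allFin n) →
               Σ Pair λ e → e ∈ steps (y ∷ t) × adj x (proj₁ e) ≡ true × adj y (proj₂ e) ≡ true
    crossing y t T x eq perm = search (steps (y ∷ t)) sum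
      where
      f : Pair → ℤ
      f e = b2z (adj x (proj₁ e)) + b2z (adj y (proj₂ e))
      first : ∑ (steps (y ∷ t)) (λ e → b2z (adj x (proj₁ e))) ≡ ∑ (allFin n) (λ v → b2z (adj x v))
      first = trans (sym (ℤP.+-identityʳ _)) (trans (cong (λ b → ∑ (steps (y ∷ t)) (λ e → b2z (adj x (proj₁ e))) + b2z b) (sym (adj-irrefl x)))
        (trans (trans (cong (λ l → ∑ (steps l) (λ e → b2z (adj x (proj₁ e))) + b2z (adj x x)) eq) (trans (∑-steps₁ (λ v → b2z (adj x v)) T x) (cong (λ l → ∑ l (λ v → b2z (adj x v))) (sym eq)))) (∑-↭ _ perm)))
      second : ∑ (steps (y ∷ t)) (λ e → b2z (adj y (proj₂ e))) ≡ ∑ (allFin n) (λ v → b2z (adj y v))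
      second = trans (sym (ℤP.+-identityˡ _)) (trans (cong (λ b → b2z b + ∑ (steps (y ∷ t)) (λ e → b2z (adj y (proj₂ e)))) (sym (adj-irrefl y)))
        (trans (∑-steps₂ (λ v → b2z (adj y v)) y t) (∑-↭ _ perm)))
      len : + n ≡ 1ℤ + + length (steps (y ∷ t))
      len = cong +_ (trans (sym (length-tabulate {n = n} (λ i → i))) (trans (sym (↭-length perm)) (cong suc (sym (length-steps y t)))))
      sum : 1ℤ + + length (steps (y ∷ t)) ≤ ∑ (steps (y ∷ t)) f
      sum = subst (_≤ ∑ (steps (y ∷ t)) f) len
        (cancelˡ {+ 2} (+<+ (ℕ.s≤s ℕ.z≤n)) (0≤+ (gap (dirac x)) (gap (dirac y)) ≤by
          trans (cong (_*_ (+ 2)) (trans (∑-+ (steps (y ∷ t)) _ _) (cong₂ _+_ first second))) (e (+ n) (∑ (allFin n) (λ v → b2z (adj x v))) (∑ (allFin n) (λ v → b2z (adj y v))))))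
        where e : ∀ n a b → + 2 * (a + b) ≡ + 2 * n + (+ 2 * a - n + (+ 2 * b - n))
              e = solve-∀
      search : ∀ E → 1ℤ + + length E ≤ ∑ E f → Σ Pair λ e → e ∈ E × adj x (proj₁ e) ≡ true × adj y (proj₂ e) ≡ true
      search [] (+≤+ ())
      search (e ∷ E) le with adj x (proj₁ e) in e₁ | adj y (proj₂ e) in e₂
      ... | true | true = e , here refl , e₁ , e₂
      ... | true | false = let e′ , i , r = search E (+-cancelˡ-≤ 1ℤ le) in e′ , there i , r
      ... | false | true = let e′ , i , r = search E (+-cancelˡ-≤ 1ℤ le) in e′ , there i , r
      ... | false | false = let e′ , i , r = search E (+-cancelˡ-≤ 1ℤ (ℤP.≤-trans le (ℤP.+-monoˡ-≤ (∑ E f) (0≤n 1)))) in e′ , there i , r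

    gaps-swap : ∀ E → gaps (map Prod.swap E) ≡ gaps E
    gaps-swap E = trans (∑-map Prod.swap E _) (∑-cong E (λ e → cong (λ b → b2z (not b)) (adj-sym (proj₂ e) (proj₁ e))))

    -- `lost` is the colour of the pair that the reversal breaks up; all other colours stay visible
    -- on edges.
    record Improved (E : List Pair) : Set where
      field
        l′ : List (Fin n)
        perm′ : l′ ↭ allFin n
        lost : ℕ
        fewer : gaps (cyc l′) + 1ℤ ≤ gaps E
        keeps : ∀ {c} → c ≢ lost → Shows E c → Shows (cyc l′) c

    -- With x, y the ends and x ~ a, y ~ b for a consecutive pair a, b, reversing the part from b on
    -- replaces the pairs ab and xy by ax and by.
    improve : ∀ y t T x → y ∷ t ≡ T ∷ʳ x → (y ∷ t ↭ allFin n) → adj x y ≡ false → Improved (cyc (y ∷ t))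
    improve y t T x eq perm gap-xy with crossing y t T x eq perm
    ... | (a , b) , i , xa , yb with steps-split i
    ...   | p , s , e₀ = record { l′ = l′ ; perm′ = perm′ ; lost = col a b ; fewer = fewer ; keeps = keeps }
      where
      l′ : List (Fin n)
      l′ = p ++ a ∷ reverse (b ∷ s)
      perm′ : l′ ↭ allFin n
      perm′ = ↭-trans (++⁺ˡ p (prep a (↭-reverse (b ∷ s)))) (↭-trans (↭-reflexive (sym e₀)) perm)
      last-form : Σ (List (Fin n)) λ C → b ∷ s ≡ C ∷ʳ x
      last-form with snoc-view b s
      ... | C , z , eC with ∷ʳ-injective T (p ++ a ∷ C) (trans (sym eq) (trans e₀ (trans (cong (λ u → p ++ a ∷ u) eC) (sym (++-assoc p (a ∷ C) [ z ])))))
      ...   | _ , refl = C , eC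
      C : List (Fin n)
      C = proj₁ last-form
      old : cyc (y ∷ t) ≡ steps (p ∷ʳ a) ++ (a , b) ∷ steps (b ∷ s) ++ [ (x , y) ]
      old = trans (cong steps (trans (cong (_∷ʳ y) e₀) (++-assoc p (a ∷ b ∷ s) [ y ])))
              (trans (steps-++ p a (b ∷ s ∷ʳ y)) (cong (λ u → steps (p ∷ʳ a) ++ (a , b) ∷ u)
                (trans (cong (λ u → steps (u ∷ʳ y)) (proj₂ last-form)) (trans (cong steps (++-assoc C [ x ] [ y ])) (trans (steps-++ C x [ y ])
                  (cong (λ u → steps u ++ [ (x , y) ]) (sym (proj₂ last-form))))))))
      -- The new order still begins with y, also when p is empty; its closing pair therefore ends in
      -- y.
      starts : Σ (List (Fin n)) λ p′ → (∀ u → p ++ a ∷ u ≡ y ∷ p′ ++ u)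
      starts = head≡ p e₀
        where head≡ : ∀ p → y ∷ t ≡ p ++ a ∷ b ∷ s → Σ (List (Fin n)) λ p′ → (∀ u → p ++ a ∷ u ≡ y ∷ p′ ++ u)
              head≡ [] refl = [] , λ u → refl
              head≡ (_ ∷ p) refl = p ∷ʳ a , λ u → cong (y ∷_) (sym (++-assoc p [ a ] u))
      cyc-l′ : cyc l′ ≡ steps (l′ ∷ʳ y)
      cyc-l′ = trans (cong cyc (proj₂ starts (reverse (b ∷ s)))) (cong (λ u → steps (u ∷ʳ y)) (sym (proj₂ starts (reverse (b ∷ s)))))
      new : cyc l′ ≡ steps (p ∷ʳ a) ++ (a , x) ∷ steps (reverse (b ∷ s)) ++ [ (b , y) ]
      new = trans cyc-l′ (trans (cong steps (++-assoc p (a ∷ reverse (b ∷ s)) [ y ])) (trans (steps-++ p a (reverse (b ∷ s) ∷ʳ y)) (cong (steps (p ∷ʳ a) ++_)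
          (trans (cong (λ u → steps (a ∷ u ∷ʳ y)) rev-x) (cong ((a , x) ∷_)
            (trans (cong (λ u → steps (u ∷ʳ y)) (trans (sym rev-x) (unfold-reverse b s))) (trans (cong steps (++-assoc (reverse s) [ b ] [ y ])) (trans (steps-++ (reverse s) b [ y ])
              (cong (λ u → steps u ++ [ (b , y) ]) (sym (unfold-reverse b s)))))))))))
        where rev-x : reverse (b ∷ s) ≡ x ∷ reverse C
              rev-x = trans (cong reverse (proj₂ last-form)) (reverse-++ C [ x ])
      ax : adj a x ≡ true
      ax = trans (adj-sym a x) xa
      by-edge : adj b y ≡ true
      by-edge = trans (adj-sym b y) yb
      fewer : gaps (cyc l′) + 1ℤ ≤ gaps (cyc (y ∷ t))
      fewer = subst₂ (λ u v → gaps u + 1ℤ ≤ gaps v) (sym new) (sym old)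
          (subst₂ (λ u v → u + 1ℤ ≤ v) (sym value-new) (sym value-old) (b2z≥0 (not (adj a b)) ≤by arith S R (b2z (not (adj a b)))))
        where
        S R : ℤ
        S = gaps (steps (p ∷ʳ a))
        R = gaps (steps (b ∷ s))
        arith : ∀ S R e → S + (e + (R + (1ℤ + 0ℤ))) ≡ S + (0ℤ + (R + (0ℤ + 0ℤ))) + 1ℤ + e
        arith = solve-∀
        value-old : gaps (steps (p ∷ʳ a) ++ (a , b) ∷ steps (b ∷ s) ++ [ (x , y) ]) ≡ S + (b2z (not (adj a b)) + (R + (1ℤ + 0ℤ)))
        value-old = trans (∑-++ (steps (p ∷ʳ a)) _ _) (cong (λ u → S + (b2z (not (adj a b)) + u)) (trans (∑-++ (steps (b ∷ s)) _ _) (cong (λ c → R + (b2z (not c) + 0ℤ)) gap-xy)))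
        value-new : gaps (steps (p ∷ʳ a) ++ (a , x) ∷ steps (reverse (b ∷ s)) ++ [ (b , y) ]) ≡ S + (0ℤ + (R + (0ℤ + 0ℤ)))
        value-new = trans (∑-++ (steps (p ∷ʳ a)) _ _) (cong₂ (λ c u → S + (b2z (not c) + u)) ax (trans (∑-++ (steps (reverse (b ∷ s))) _ _)
          (cong₂ (λ v c → v + (b2z (not c) + 0ℤ)) (trans (∑-↭ _ (steps-reverse (b ∷ s))) (gaps-swap (steps (b ∷ s)))) by-edge)))
      keeps : ∀ {c} → c ≢ col a b → Shows (cyc (y ∷ t)) c → Shows (cyc l′) c
      keeps {c} c≢ (e , i , ie , ce) = subst (λ E → Shows E c) (sym new) (place (∈-++⁻ (steps (p ∷ʳ a)) (subst (e ∈_) old i)))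
        where
        New : List Pair
        New = steps (p ∷ʳ a) ++ (a , x) ∷ steps (reverse (b ∷ s)) ++ [ (b , y) ]
        place : e ∈ steps (p ∷ʳ a) ⊎ e ∈ (a , b) ∷ steps (b ∷ s) ++ [ (x , y) ] → Shows New c
        place (inj₁ j) = e , ∈-++⁺ˡ j , ie , ce
        place (inj₂ (here refl)) = ⊥-elim (c≢ (sym ce))
        place (inj₂ (there j)) with ∈-++⁻ (steps (b ∷ s)) j
        ... | inj₁ k = Prod.swap e , ∈-++⁺ʳ (steps (p ∷ʳ a)) (there (∈-++⁺ˡ (∈-resp-↭ (↭-sym (steps-reverse (b ∷ s))) (∈-map⁺ Prod.swap k))))
                     , trans (adj-sym (proj₂ e) (proj₁ e)) ie , trans (col-sym (proj₂ e) (proj₁ e)) ce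
        ... | inj₂ (here refl) with trans (sym gap-xy) ie
        ...   | ()

    Closed : List Pair → Set
    Closed E = ∀ {e} → e ∈ E → isEdge e ≡ true

    findGap : ∀ E → Closed E ⊎ (Σ Pair λ e → e ∈ E × isEdge e ≡ false)
    findGap [] = inj₁ (λ ())
    findGap (e ∷ E) = bool-cases (isEdge e)
      (λ g → [ (λ ok → inj₁ λ { (here refl) → g ; (there i) → ok i }) , (λ (e′ , i , b) → inj₂ (e′ , there i , b)) ]′ (findGap E))
      (λ g → inj₂ (e , here refl , g))

    record Outcome (k : ℕ) : Set where
      field
        l : List (Fin n)
        perm : l ↭ allFin n
        closed : Closed (cyc l)
        C : List ℕ
        unique : Unique C
        shows : All (Shows (cyc l)) C
        enough : k ℕ.≤ length C

    -- A round removes at least one gap and at most one entry of C, so a bound g on the gaps bounds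
    -- both the rounds and the lost colours.
    close-up : ∀ g l (C : List ℕ) → l ↭ allFin n → gaps (cyc l) ≤ + g → Unique C → All (Shows (cyc l)) C → Outcome (length C ℕ.∸ g)
    close-up g [] C perm _ u sh = record { l = [] ; perm = perm ; closed = λ () ; C = C ; unique = u ; shows = sh ; enough = ℕP.m∸n≤m (length C) g }
    close-up g (y ∷ t) C perm le u sh with findGap (cyc (y ∷ t))
    ... | inj₁ ok = record { l = y ∷ t ; perm = perm ; closed = ok ; C = C ; unique = u ; shows = sh ; enough = ℕP.m∸n≤m (length C) g }
    close-up zero (y ∷ t) C perm le u sh | inj₂ (e , i , bad) = ⊥-elim (absurd (ℤP.≤-trans
        (subst (_≤ gaps (cyc (y ∷ t))) (cong (λ b → b2z (not b)) bad) (∑-single≤ (cyc (y ∷ t)) (λ e → b2z≥0 (not (isEdge e))) i)) le))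
      where absurd : ¬ (1ℤ ≤ 0ℤ)
            absurd (+≤+ ())
    close-up (suc g) (y ∷ t) C perm le u sh | inj₂ ((a , b) , i , bad) with rotate y t i
    ... | t′ , T , eT , pT , cT = finish (close-up g l′ C′ perm′ le′ (UniqueP.filter⁺ keep? u) sh′)
      where
      open Improved (improve b t′ T a eT (↭-trans pT perm) bad)
      keep? = λ d → ¬? (d ℕP.≟ lost)
      C′ : List ℕ
      C′ = filter keep? C
      le′ : gaps (cyc l′) ≤ + g
      le′ = +-cancelˡ-≤ 1ℤ (ℤP.≤-trans (ℤP.≤-reflexive (ℤP.+-comm 1ℤ (gaps (cyc l′))))
              (ℤP.≤-trans fewer (ℤP.≤-trans (ℤP.≤-reflexive (∑-↭ _ cT)) le)))
      transport : ∀ {c} → Shows (cyc (y ∷ t)) c → Shows (cyc (b ∷ t′)) c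
      transport (e , j , r) = e , ∈-resp-↭ (↭-sym cT) j , r
      sh′ : All (Shows (cyc l′)) C′
      sh′ = All.tabulate (λ {c} j → let k , ne = ∈-filter⁻ keep? j in keeps ne (transport (All.lookup sh k)))
      finish : Outcome (length C′ ℕ.∸ g) → Outcome (length C ℕ.∸ suc g)
      finish o = record { Outcome o ; enough = ℕP.≤-trans (ℕP.∸-monoˡ-≤ (suc g) (Unique-without lost C u)) (Outcome.enough o) }

-- From closed cyclic orders to Hamilton cycles.

module HamiltonCycles where
  open import Defs hiding (sym)
  open FiniteSums
  open Hypergraphs using (b2z)
  open CyclicOrders
  open import Data.Integer using (+_) renaming (_≤_ to _≤ℤ_; _*_ to _*ℤ_)
  open import Data.Nat as ℕ using (ℕ; zero; suc)

  private
    variable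
      A : Set

  -- Out of range, nth returns its first argument; for a cyclic list this is its first element.
  nth : A → List A → ℕ → A
  nth d [] _ = d
  nth d (x ∷ l) zero = x
  nth d (x ∷ l) (suc i) = nth d l i

  nth-∈ : ∀ (d : A) l i → i ℕ.< length l → nth d l i ∈ l
  nth-∈ d (x ∷ l) zero _ = here refl
  nth-∈ d (x ∷ l) (suc i) (ℕ.s≤s lt) = there (nth-∈ d l i lt)

  nth-length : ∀ (d : A) l → nth d l (length l) ≡ d
  nth-length d [] = refl
  nth-length d (x ∷ l) = nth-length d l

  nth-injective : ∀ (d : A) {l} → Unique l → ∀ i j → i ℕ.< length l → j ℕ.< length l → nth d l i ≡ nth d l j → i ≡ j
  nth-injective d {x ∷ l} (a ∷ u) zero zero _ _ _ = refl
  nth-injective d {x ∷ l} (a ∷ u) zero (suc j) _ (ℕ.s≤s q) e = ⊥-elim (All.lookup a (nth-∈ d l j q) e)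
  nth-injective d {x ∷ l} (a ∷ u) (suc i) zero (ℕ.s≤s p) _ e = ⊥-elim (All.lookup a (nth-∈ d l i p) (sym e))
  nth-injective d {x ∷ l} (a ∷ u) (suc i) (suc j) (ℕ.s≤s p) (ℕ.s≤s q) e = cong suc (nth-injective d u i j p q e)

  steps-nth : ∀ (d z : A) t i → i ℕ.< length (z ∷ t) → (nth d (z ∷ t) i , nth d (z ∷ t) (suc i)) ∈ steps (z ∷ t ∷ʳ d)
  steps-nth d z [] zero _ = here refl
  steps-nth d z [] (suc i) (ℕ.s≤s ())
  steps-nth d z (w ∷ t) zero _ = here refl
  steps-nth d z (w ∷ t) (suc i) (ℕ.s≤s lt) = there (steps-nth d w t i lt)

  nth-steps : ∀ (d z : A) t {e} → e ∈ steps (z ∷ t ∷ʳ d) → Σ ℕ λ i → i ℕ.< length (z ∷ t) × e ≡ (nth d (z ∷ t) i , nth d (z ∷ t) (suc i))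
  nth-steps d z [] (here refl) = 0 , ℕ.s≤s ℕ.z≤n , refl
  nth-steps d z (w ∷ t) (here refl) = 0 , ℕ.s≤s ℕ.z≤n , refl
  nth-steps d z (w ∷ t) (there i) with nth-steps d w t i
  ... | k , lt , e = suc k , ℕ.s≤s lt , e

  module _ {k : ℕ} (G : Graph (suc k)) (c : EdgeColouring G) (n≥3 : 3 ℕ.≤ suc k)
    (dirac : ∀ u → + suc k ≤ℤ + 2 *ℤ ∑ (allFin (suc k)) (λ v → b2z (adj G u v))) where
    open Closing (suc k) (adj G) (Graph.sym G) (Graph.irrefl G) (col c) (colSym c) dirac

    hamilton : ∀ {b} → Outcome b → Σ (HamiltonCycle G) λ H → b ℕ.≤ numColours c H
    hamilton {b} record { l = l ; perm = perm ; closed = closed ; C = C ; unique = unique ; shows = shows ; enough = enough } =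
      build l (trans (↭-length perm) (length-tabulate {n = suc k} (λ i → i))) (Unique-resp-↭ (↭-sym perm) (UniqueP.allFin⁺ (suc k))) closed shows
      where
      build : ∀ l → length l ≡ suc k → Unique l → Closed (cyc l) → All.All (Shows (cyc l)) C → Σ (HamiltonCycle G) λ H → b ℕ.≤ numColours c H
      build (y ∷ t) len uniq cl sh = H , ℕP.≤-trans enough (Unique-⊆-length unique present)
        where
        tour : Fin (suc k) → Fin (suc k)
        tour i = nth y (y ∷ t) (toℕ i)
        in-range : ∀ (i : Fin (suc k)) → toℕ i ℕ.< length (y ∷ t)
        in-range i = subst (toℕ i ℕ.<_) (sym len) (toℕ<n i)
        tour-next : ∀ i → tour (next i) ≡ nth y (y ∷ t) (suc (toℕ i))
        tour-next i with suc (toℕ i) ℕP.<? suc k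
        ... | yes lt = cong (nth y (y ∷ t)) (trans (toℕ-fromℕ< _) (ℕD.m<n⇒m%n≡m lt))
        ... | no nlt = trans (cong (nth y (y ∷ t)) (trans (toℕ-fromℕ< _) (trans (cong (ℕD._% suc k) end) (ℕD.n%n≡0 (suc k)))))
                         (trans (sym (nth-length y (y ∷ t))) (cong (nth y (y ∷ t)) (trans len (sym end))))
          where end : suc (toℕ i) ≡ suc k
                end = ℕP.≤-antisym (toℕ<n i) (ℕP.≮⇒≥ nlt)
        pair-∈ : ∀ i → (tour i , tour (next i)) ∈ cyc (y ∷ t)
        pair-∈ i = subst (λ v → (tour i , v) ∈ cyc (y ∷ t)) (sym (tour-next i)) (steps-nth y y t (toℕ i) (in-range i))
        H : HamiltonCycle G
        H = record
          { σ = tour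
          ; σ-inj = λ {i} {j} e → toℕ-injective (nth-injective y uniq (toℕ i) (toℕ j) (in-range i) (in-range j) e)
          ; atLeast3 = n≥3
          ; σ-adj = λ i → cl (pair-∈ i) }
        colours : List ℕ
        colours = map (λ i → col c (tour i) (tour (next i))) (allFin (suc k))
        present : ∀ {x} → x ∈ C → x ∈ deduplicate ℕ._≟_ colours
        present {x} x∈C with All.lookup sh x∈C
        ... | e , e∈ , _ , ce with nth-steps y y t e∈
        ...   | i , lt , refl = ∈-deduplicate⁺ ℕ._≟_ (subst (_∈ colours) colour≡ (∈-map⁺ _ (∈-allFin j)))
          where j : Fin (suc k)
                j = fromℕ< (subst (i ℕ.<_) len lt)
                j≡i : toℕ j ≡ i
                j≡i = toℕ-fromℕ< (subst (i ℕ.<_) len lt)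
                colour≡ : col c (tour j) (tour (next j)) ≡ x
                colour≡ = trans (cong₂ (col c) (cong (nth y (y ∷ t)) j≡i) (trans (tour-next j) (cong (λ k → nth y (y ∷ t) (suc k)) j≡i))) ce

-- Rainbow path forests as matchings of a linear 3-graph.

module PathForests where
  open FiniteSums
  open Hypergraphs
  open Nibble
  open NearRegularFactor using (Fδ; ∑-Fδ; ∑-Fδ-1; ∑-allFin-1)
  open CyclicOrders
  open import Data.Integer using (ℤ; +_; 0ℤ; 1ℤ; _+_; _*_; _-_; -_; _≤_; _<_; +≤+)
  open import Data.Integer.Tactic.RingSolver using (solve-∀)
  open import Data.List.Relation.Binary.Permutation.Propositional.Properties using (shift)
  open import Data.Nat as ℕ using (ℕ; suc)

  private
    variable
      A B : Set

  ∑-filter : ∀ (d : A → Bool) xs (f : A → ℤ) → ∑ (filter (λ x → d x Bool.≟ true) xs) f ≡ ∑ xs (λ x → b2z (d x) * f x)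
  ∑-filter d [] f = refl
  ∑-filter d (x ∷ xs) f with d x
  ... | true  = cong₂ _+_ (sym (ℤP.*-identityˡ (f x))) (∑-filter d xs f)
  ... | false = trans (∑-filter d xs f) (sym (ℤP.+-identityˡ _))

  ∑-cartesian : ∀ (xs : List A) (ys : List B) (f : A × B → ℤ) → ∑ (cartesianProduct xs ys) f ≡ ∑ xs (λ x → ∑ ys (λ y → f (x , y)))
  ∑-cartesian [] ys f = refl
  ∑-cartesian (x ∷ xs) ys f = trans (∑-++ (map (x ,_) ys) _ f) (cong₂ _+_ (∑-map (x ,_) ys f) (∑-cartesian xs ys f))

  ∑-at-most-one : ∀ (xs : List A) (f : A → ℤ) → Unique xs → (∀ x → f x ≤ 1ℤ) →
    (∀ {x y} → x ∈ xs → y ∈ xs → 0ℤ < f x → 0ℤ < f y → x ≡ y) → ∑ xs f ≤ 1ℤ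
  ∑-at-most-one [] f u b h = 0≤n 1
  ∑-at-most-one (x ∷ xs) f (a ∷ u) b h with 0ℤ ℤP.<? f x
  ... | no np = ℤP.≤-trans (ℤP.+-monoˡ-≤ (∑ xs f) (ℤP.≮⇒≥ np)) (ℤP.≤-trans (ℤP.≤-reflexive (ℤP.+-identityˡ _))
                  (∑-at-most-one xs f u b (λ i j → h (there i) (there j))))
  ... | yes p = ℤP.+-mono-≤ (b x) (ℤP.≤-trans (∑-mono-∈ xs rest) (ℤP.≤-reflexive (∑-0 xs)))
    where rest : ∀ y → y ∈ xs → f y ≤ 0ℤ
          rest y i with 0ℤ ℤP.<? f y
          ... | no nq = ℤP.≮⇒≥ nq
          ... | yes q = ⊥-elim (All.lookup a i (h (here refl) (there i) p q))

  concat-↭ : ∀ {ps qs : List (List A)} → ps ↭ qs → concat ps ↭ concat qs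
  concat-↭ refl = ↭-refl
  concat-↭ (prep p r) = ++⁺ˡ p (concat-↭ r)
  concat-↭ (swap p q r) = ↭-trans (shifts p q) (++⁺ˡ q (++⁺ˡ p (concat-↭ r)))
  concat-↭ (ptrans r s) = ↭-trans (concat-↭ r) (concat-↭ s)

  steps-⊆ˡ : ∀ (p q : List A) {e} → e ∈ steps p → e ∈ steps (p ++ q)
  steps-⊆ˡ (x ∷ y ∷ p) q (here refl) = here refl
  steps-⊆ˡ (x ∷ y ∷ p) q (there i) = there (steps-⊆ˡ (y ∷ p) q i)

  steps-⊆ʳ : ∀ (p q : List A) {e} → e ∈ steps q → e ∈ steps (p ++ q)
  steps-⊆ʳ [] q i = i
  steps-⊆ʳ (x ∷ []) (y ∷ q) i = there i
  steps-⊆ʳ (x ∷ z ∷ p) q i = there (steps-⊆ʳ (z ∷ p) q i)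

  steps-concat : ∀ (ps : List (List A)) {e} → e ∈ concat (map steps ps) → e ∈ steps (concat ps)
  steps-concat (p ∷ ps) i with ∈-++⁻ (steps p) i
  ... | inj₁ j = steps-⊆ˡ p (concat ps) j
  ... | inj₂ j = steps-⊆ʳ p (concat ps) (steps-concat ps j)

  steps⊆cyc : ∀ (l : List A) {e} → e ∈ steps l → e ∈ cyc l
  steps⊆cyc (y ∷ t) i = steps-⊆ˡ (y ∷ t) [ y ] i

  module _ {n : ℕ} where
    headIs : Fin n → List (Fin n) → Bool
    headIs v [] = false
    headIs v (x ∷ _) = ⌊ x Fin.≟ v ⌋

    lastIs : Fin n → List (Fin n) → Bool
    lastIs u [] = false
    lastIs u (x ∷ []) = ⌊ x Fin.≟ u ⌋
    lastIs u (x ∷ y ∷ l) = lastIs u (y ∷ l)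

    ⌊≟⌋⇒≡ : ∀ {x y : Fin n} → ⌊ x Fin.≟ y ⌋ ≡ true → x ≡ y
    ⌊≟⌋⇒≡ {x} {y} with x Fin.≟ y
    ... | yes p = λ _ → p
    ... | no _ = λ ()

    ⌊≟⌋-refl : ∀ (x : Fin n) → ⌊ x Fin.≟ x ⌋ ≡ true
    ⌊≟⌋-refl x with x Fin.≟ x
    ... | yes _ = refl
    ... | no p = ⊥-elim (p refl)

    headIs⇒ : ∀ {v} p → headIs v p ≡ true → Σ (List (Fin n)) λ t → p ≡ v ∷ t
    headIs⇒ (x ∷ t) e = t , cong (_∷ t) (⌊≟⌋⇒≡ e)

    lastIs⇒ : ∀ {u} p → lastIs u p ≡ true → Σ (List (Fin n)) λ T → p ≡ T ∷ʳ u
    lastIs⇒ (x ∷ []) e = [] , cong [_] (⌊≟⌋⇒≡ e)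
    lastIs⇒ (x ∷ y ∷ l) e with lastIs⇒ (y ∷ l) e
    ... | T , q = x ∷ T , cong (x ∷_) q

    headIs-unique : ∀ {v w} p → headIs v p ≡ true → headIs w p ≡ true → v ≡ w
    headIs-unique (x ∷ _) e f = trans (sym (⌊≟⌋⇒≡ e)) (⌊≟⌋⇒≡ f)

    lastIs-unique : ∀ {v w} p → lastIs v p ≡ true → lastIs w p ≡ true → v ≡ w
    lastIs-unique (x ∷ []) e f = trans (sym (⌊≟⌋⇒≡ e)) (⌊≟⌋⇒≡ f)
    lastIs-unique (x ∷ y ∷ l) e f = lastIs-unique (y ∷ l) e f

    headIs-++ : ∀ {v} p q → headIs v p ≡ true → headIs v (p ++ q) ≡ true
    headIs-++ (x ∷ p) q e = e

    lastIs-++ : ∀ {u} p q → lastIs u q ≡ true → lastIs u (p ++ q) ≡ true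
    lastIs-++ [] q e = e
    lastIs-++ (x ∷ []) (y ∷ q) e = e
    lastIs-++ (x ∷ z ∷ p) q e = lastIs-++ (z ∷ p) q e

    ∑-headIs : ∀ p → ∑ (allFin n) (λ v → b2z (headIs v p)) ≤ 1ℤ
    ∑-headIs [] = ℤP.≤-trans (ℤP.≤-reflexive (∑-0 (allFin n))) (0≤n 1)
    ∑-headIs (x ∷ _) = ℤP.≤-reflexive (∑-Fδ-1 x)

    ∑-lastIs : ∀ p → ∑ (allFin n) (λ v → b2z (lastIs v p)) ≤ 1ℤ
    ∑-lastIs [] = ℤP.≤-trans (ℤP.≤-reflexive (∑-0 (allFin n))) (0≤n 1)
    ∑-lastIs (x ∷ []) = ℤP.≤-reflexive (∑-Fδ-1 x)
    ∑-lastIs (x ∷ y ∷ l) = ∑-lastIs (y ∷ l)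

  -- N is any strict upper bound for the colours and makes the colour vertices a finite type. Its
  -- size is unrelated to n, and many colour vertices may be isolated.
  module ColouredDigraph (n N : ℕ) (adj : Fin n → Fin n → Bool)
    (col : Fin n → Fin n → ℕ) (col-sym : ∀ u v → col u v ≡ col v u) (adj-sym : ∀ u v → adj u v ≡ adj v u)
    (proper : ∀ u v w → v ≢ w → adj u v ≡ true → adj u w ≡ true → col u v ≢ col u w)
    (col<N : ∀ u v → col u v ℕ.< N)
    (D : Fin n → Fin n → Bool) (D⊆adj : ∀ u v → D u v ≡ true → adj u v ≡ true) where

    Vtx : Set
    Vtx = Fin n ⊎ Fin n ⊎ Fin N

    pattern outV u = inj₁ u
    pattern inV v = inj₂ (inj₁ v)
    pattern colV c = inj₂ (inj₂ c)

    _≟V_ : DecidableEquality Vtx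
    _≟V_ = ≡-dec Fin._≟_ (≡-dec Fin._≟_ Fin._≟_)

    colF : Fin n → Fin n → Fin N
    colF u v = fromℕ< (col<N u v)

    toℕ-colF : ∀ u v → toℕ (colF u v) ≡ col u v
    toℕ-colF u v = toℕ-fromℕ< (col<N u v)

    Arc : Set
    Arc = Fin n × Fin n

    verts : List Vtx
    verts = map outV (allFin n) ++ map inV (allFin n) ++ map colV (allFin N)

    isArc : Arc → Bool
    isArc (u , v) = D u v

    arcs : List Arc
    arcs = filter (λ e → isArc e Bool.≟ true) (cartesianProduct (allFin n) (allFin n))

    q₁ q₂ q₃ : Arc → Vtx
    q₁ (u , v) = outV u
    q₂ (u , v) = inV v
    q₃ (u , v) = colV (colF u v)

    ∑-arcs : ∀ f → ∑ arcs f ≡ ∑ (allFin n) (λ u → ∑ (allFin n) (λ v → b2z (D u v) * f (u , v)))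
    ∑-arcs f = trans (∑-filter isArc (cartesianProduct (allFin n) (allFin n)) f) (∑-cartesian (allFin n) (allFin n) _)

    ∑-verts : ∀ f → ∑ verts f ≡ ∑ (allFin n) (λ u → f (outV u)) + (∑ (allFin n) (λ v → f (inV v)) + ∑ (allFin N) (λ c → f (colV c)))
    ∑-verts f = trans (∑-++ (map outV (allFin n)) _ f) (cong₂ _+_ (∑-map outV (allFin n) f)
      (trans (∑-++ (map inV (allFin n)) _ f) (cong₂ _+_ (∑-map inV (allFin n) f) (∑-map colV (allFin N) f))))

    δV : Vtx → Vtx → ℤ
    δV x y = b2z ⌊ x ≟V y ⌋

    ⌊⌋-iff : ∀ {P Q : Set} (p : Dec P) (q : Dec Q) → (P → Q) → (Q → P) → b2z ⌊ p ⌋ ≡ b2z ⌊ q ⌋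
    ⌊⌋-iff (yes _) (yes _) _ _ = refl
    ⌊⌋-iff (no _) (no _) _ _ = refl
    ⌊⌋-iff (yes p) (no q) f _ = ⊥-elim (q (f p))
    ⌊⌋-iff (no p) (yes q) _ g = ⊥-elim (p (g q))

    ⌊⌋-no : ∀ {P : Set} (p : Dec P) → ¬ P → b2z ⌊ p ⌋ ≡ 0ℤ
    ⌊⌋-no (yes p) q = ⊥-elim (q p)
    ⌊⌋-no (no _) _ = refl

    δ-out : ∀ u v → δV (outV u) (outV v) ≡ Fδ u v
    δ-out u v = ⌊⌋-iff (outV u ≟V outV v) (u Fin.≟ v) inj₁-injective (cong outV)
    δ-in : ∀ u v → δV (inV u) (inV v) ≡ Fδ u v
    δ-in u v = ⌊⌋-iff (inV u ≟V inV v) (u Fin.≟ v) (λ e → inj₁-injective (inj₂-injective e)) (cong (λ w → inV w))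
    δ-col : ∀ u v → δV (colV u) (colV v) ≡ Fδ u v
    δ-col u v = ⌊⌋-iff (colV u ≟V colV v) (u Fin.≟ v) (λ e → inj₂-injective (inj₂-injective e)) (cong (λ w → colV w))

    once-verts : ∀ y → ∑ verts (δV y) ≡ 1ℤ
    once-verts y = trans (∑-verts (δV y)) (go y)
      where
      z : ∀ {k} (f : Fin k → ℤ) → (∀ i → f i ≡ 0ℤ) → ∑ (allFin k) f ≡ 0ℤ
      z {k} f h = trans (∑-cong (allFin k) h) (∑-0 (allFin k))
      go : ∀ y → ∑ (allFin n) (λ u → δV y (outV u)) + (∑ (allFin n) (λ v → δV y (inV v)) + ∑ (allFin N) (λ c → δV y (colV c))) ≡ 1ℤ
      go (outV u) = cong₂ _+_ (trans (∑-cong (allFin n) (δ-out u)) (∑-Fδ-1 u))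
        (cong₂ _+_ (z _ (λ i → ⌊⌋-no (outV u ≟V inV i) (λ ()))) (z _ (λ i → ⌊⌋-no (outV u ≟V colV i) (λ ()))))
      go (inV u) = cong₂ _+_ (z _ (λ i → ⌊⌋-no (inV u ≟V outV i) (λ ())))
        (cong₂ _+_ (trans (∑-cong (allFin n) (δ-in u)) (∑-Fδ-1 u)) (z _ (λ i → ⌊⌋-no (inV u ≟V colV i) (λ ()))))
      go (colV u) = cong₂ _+_ (z _ (λ i → ⌊⌋-no (colV u ≟V outV i) (λ ())))
        (cong₂ _+_ (z _ (λ i → ⌊⌋-no (colV u ≟V inV i) (λ ()))) (trans (∑-cong (allFin N) (δ-col u)) (∑-Fδ-1 u)))

    incV : Arc → Vtx → ℤ
    incV e x = δV (q₁ e) x + δV (q₂ e) x + δV (q₃ e) x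

    incV-out : ∀ e u → incV e (outV u) ≡ Fδ (proj₁ e) u
    incV-out e u = trans (cong₂ _+_ (cong₂ _+_ (δ-out (proj₁ e) u) (⌊⌋-no (q₂ e ≟V outV u) (λ ()))) (⌊⌋-no (q₃ e ≟V outV u) (λ ())))
                     (trans (ℤP.+-identityʳ _) (ℤP.+-identityʳ _))
    incV-in : ∀ e v → incV e (inV v) ≡ Fδ (proj₂ e) v
    incV-in e v = trans (cong₂ _+_ (cong₂ _+_ (⌊⌋-no (q₁ e ≟V inV v) (λ ())) (δ-in (proj₂ e) v)) (⌊⌋-no (q₃ e ≟V inV v) (λ ())))
                     (trans (ℤP.+-identityʳ _) (ℤP.+-identityˡ _))
    incV-col : ∀ e c → incV e (colV c) ≡ Fδ (colF (proj₁ e) (proj₂ e)) c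
    incV-col e c = trans (cong₂ _+_ (cong₂ _+_ (⌊⌋-no (q₁ e ≟V colV c) (λ ())) (⌊⌋-no (q₂ e ≟V colV c) (λ ()))) (δ-col (colF (proj₁ e) (proj₂ e)) c))
                     (ℤP.+-identityˡ _)

    Fδ-pos : ∀ {k} {x y : Fin k} → Fδ x y ≢ 0ℤ → x ≡ y
    Fδ-pos {x = x} {y} h with x Fin.≟ y
    ... | yes p = p
    ... | no _ = ⊥-elim (h refl)

    colF-eq : ∀ {u v u′ v′} → colF u v ≡ colF u′ v′ → col u v ≡ col u′ v′
    colF-eq {u} {v} {u′} {v′} e = trans (sym (toℕ-colF u v)) (trans (cong toℕ e) (toℕ-colF u′ v′))

    same-tail : ∀ {u v v′} → D u v ≡ true → D u v′ ≡ true → col u v ≡ col u v′ → v ≡ v′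
    same-tail {u} {v} {v′} d d′ c with v Fin.≟ v′
    ... | yes p = p
    ... | no ne = ⊥-elim (proper u v v′ ne (D⊆adj u v d) (D⊆adj u v′ d′) c)

    same-head : ∀ {u u′ v} → D u v ≡ true → D u′ v ≡ true → col u v ≡ col u′ v → u ≡ u′
    same-head {u} {u′} {v} d d′ c with u Fin.≟ u′
    ... | yes p = p
    ... | no ne = ⊥-elim (proper v u u′ ne (trans (adj-sym v u) (D⊆adj u v d)) (trans (adj-sym v u′) (D⊆adj u′ v d′))
                    (trans (col-sym v u) (trans c (col-sym u′ v))))

    data Ends : Arc → Vtx → Set where
      tail : ∀ {u v} → Ends (u , v) (outV u)
      head : ∀ {u v} → Ends (u , v) (inV v)
      hue  : ∀ {u v c} → colF u v ≡ c → Ends (u , v) (colV c)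

    ends : ∀ e x → incV e x ≢ 0ℤ → Ends e x
    ends (u , v) (outV x) h with Fδ-pos {x = u} {x} (λ z → h (trans (incV-out (u , v) x) z))
    ... | refl = tail
    ends (u , v) (inV x) h with Fδ-pos {x = v} {x} (λ z → h (trans (incV-in (u , v) x) z))
    ... | refl = head
    ends (u , v) (colV x) h = hue (Fδ-pos (λ z → h (trans (incV-col (u , v) x) z)))

    -- Linearity. Tail and head determine the arc; tail and colour, or head and colour, determine it
    -- because the colouring is proper; two distinct vertices of the same kind never lie on one arc.
    determined : ∀ {e e′ x y} → x ≢ y → isArc e ≡ true → isArc e′ ≡ true → Ends e x → Ends e′ x → Ends e y → Ends e′ y → e ≡ e′
    determined ne d d′ tail tail tail tail = ⊥-elim (ne refl)
    determined ne d d′ tail tail head head = refl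
    determined ne d d′ tail tail (hue refl) (hue e) = cong (_ ,_) (same-tail d d′ (colF-eq (sym e)))
    determined ne d d′ head head tail tail = refl
    determined ne d d′ head head head head = ⊥-elim (ne refl)
    determined ne d d′ head head (hue refl) (hue e) = cong (_, _) (same-head d d′ (colF-eq (sym e)))
    determined ne d d′ (hue refl) (hue e) tail tail = cong (_ ,_) (same-tail d d′ (colF-eq (sym e)))
    determined ne d d′ (hue refl) (hue e) head head = cong (_, _) (same-head d d′ (colF-eq (sym e)))
    determined ne d d′ (hue refl) (hue e) (hue refl) (hue e′) = ⊥-elim (ne refl)

    incV≤1 : ∀ e x → incV e x ≤ 1ℤ
    incV≤1 e (outV u) = subst (_≤ 1ℤ) (sym (incV-out e u)) (b2z≤1 _)
    incV≤1 e (inV u) = subst (_≤ 1ℤ) (sym (incV-in e u)) (b2z≤1 _)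
    incV≤1 e (colV u) = subst (_≤ 1ℤ) (sym (incV-col e u)) (b2z≤1 _)

    incV≥0 : ∀ e x → 0ℤ ≤ incV e x
    incV≥0 e x = 0≤+ (0≤+ (b2z≥0 ⌊ q₁ e ≟V x ⌋) (b2z≥0 ⌊ q₂ e ≟V x ⌋)) (b2z≥0 ⌊ q₃ e ≟V x ⌋)

    linear-arcs : ∀ x y → x ≢ y → ∑ arcs (λ e → incV e x * incV e y) ≤ 1ℤ
    linear-arcs x y ne = ∑-at-most-one arcs _ (UniqueP.filter⁺ (λ e → isArc e Bool.≟ true) (UniqueP.cartesianProduct⁺ (UniqueP.allFin⁺ n) (UniqueP.allFin⁺ n)))
        (λ e → *-mono-nn (incV≥0 e x) (0≤n 1) (incV≤1 e x) (incV≤1 e y))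
        (λ {e} {e′} i j p q → determined ne (arc i) (arc j) (ends e x (left (incV e y) p)) (ends e′ x (left (incV e′ y) q)) (ends e y (right (incV e x) p)) (ends e′ y (right (incV e′ x) q)))
      where
      arc : ∀ {e} → e ∈ arcs → isArc e ≡ true
      arc i = proj₂ (∈-filter⁻ (λ e → isArc e Bool.≟ true) {xs = cartesianProduct (allFin n) (allFin n)} i)
      left : ∀ {a} b → 0ℤ < a * b → a ≢ 0ℤ
      left b p refl = ℤP.<-irrefl refl p
      right : ∀ a {b} → 0ℤ < a * b → b ≢ 0ℤ
      right a p refl = ℤP.<-irrefl (sym (ℤP.*-zeroʳ a)) p

    ℋ : Hypergraph
    ℋ = record
      { X = Vtx ; E = Arc ; _≟_ = _≟V_ ; xs = verts ; es = arcs ; p₁ = q₁ ; p₂ = q₂ ; p₃ = q₃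
      ; xs-complete = complete
      ; once = once-verts
      ; p₁≢p₂ = λ _ () ; p₁≢p₃ = λ _ () ; p₂≢p₃ = λ _ ()
      ; linear = linear-arcs }
      where
      complete : ∀ x → x ∈ verts
      complete (outV u) = ∈-++⁺ˡ (∈-map⁺ outV (∈-allFin u))
      complete (inV v) = ∈-++⁺ʳ (map outV (allFin n)) (∈-++⁺ˡ (∈-map⁺ inV (∈-allFin v)))
      complete (colV c) = ∈-++⁺ʳ (map outV (allFin n)) (∈-++⁺ʳ (map inV (allFin n)) (∈-map⁺ colV (∈-allFin c)))

    open HypergraphProperties ℋ using (State; _∖_; live; killₑ; deg₀)

    isOut : Vtx → Bool
    isOut (outV _) = true
    isOut (inj₂ _) = false

    ∑-isOut : ∑ verts (λ x → b2z (isOut x)) ≡ + n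
    ∑-isOut = trans (∑-verts _) (trans (cong₂ _+_ (∑-allFin-1 n) (cong₂ _+_ (∑-0 (allFin n)) (∑-0 (allFin N)))) (ℤP.+-identityʳ _))

    deg₀-out : ∀ u → deg₀ (outV u) ≡ ∑ (allFin n) (λ v → b2z (D u v))
    deg₀-out u = trans (∑-arcs (λ e → incV e (outV u)))
      (trans (∑-swap (allFin n) (allFin n) _) (∑-cong (allFin n) (λ v →
        trans (∑-cong (allFin n) (λ w → trans (ℤP.*-comm (b2z (D w v)) _) (cong (_* b2z (D w v)) (trans (incV-out (w , v) u) (flip w u))))) (∑-Fδ u (λ w → b2z (D w v))))))
      where flip : ∀ (w u : Fin n) → Fδ w u ≡ Fδ u w
            flip w u = ⌊⌋-iff (w Fin.≟ u) (u Fin.≟ w) sym sym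

    deg₀-in : ∀ v → deg₀ (inV v) ≡ ∑ (allFin n) (λ u → b2z (D u v))
    deg₀-in v = trans (∑-arcs (λ e → incV e (inV v))) (∑-cong (allFin n) (λ u →
        trans (∑-cong (allFin n) (λ w → trans (ℤP.*-comm (b2z (D u w)) _) (cong (_* b2z (D u w)) (trans (incV-in (u , w) v) (⌊⌋-iff (w Fin.≟ v) (v Fin.≟ w) sym sym))))) (∑-Fδ v (λ w → b2z (D u w)))))

    deg₀-col : ∀ c → deg₀ (colV c) ≡ ∑ (allFin n) (λ u → ∑ (allFin n) (λ v → b2z (D u v) * Fδ (colF u v) c))
    deg₀-col c = trans (∑-arcs (λ e → incV e (colV c))) (∑-cong (allFin n) (λ u → ∑-cong (allFin n) (λ v → cong (_*_ (b2z (D u v))) (incV-col (u , v) c))))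

    Paths : Set
    Paths = List (List (Fin n))

    colour : Arc → ℕ
    colour (u , v) = col u v

    pathArcs : Paths → List Arc
    pathArcs ps = concat (map steps ps)

    -- Single vertices count as paths, so the paths always cover everything. Live copies are tied to
    -- ends of paths in one direction only, since the copies at an end may have been discarded.
    record Fits (ps : Paths) (a : State) : Set where
      field
        covers  : concat ps ↭ allFin n
        rainbow : Unique (map colour (pathArcs ps))
        number  : length (pathArcs ps) ℕ.+ length ps ≡ n
        edges   : ∀ {e} → e ∈ pathArcs ps → adj (proj₁ e) (proj₂ e) ≡ true
        spent   : ∀ {u v} → (u , v) ∈ pathArcs ps → a (colV (colF u v)) ≡ false
        lasts   : ∀ u → a (outV u) ≡ true → Σ (List (Fin n)) λ p → p ∈ ps × lastIs u p ≡ true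
        heads   : ∀ v → a (inV v) ≡ true → Σ (List (Fin n)) λ p → p ∈ ps × headIs v p ≡ true

    -- A live arc starts at the end of a path and leads to the beginning of a path. It closes a
    -- directed cycle exactly when both are the same path.
    closes : Paths → Arc → Bool
    closes [] e = false
    closes (p ∷ ps) e = (headIs (proj₂ e) p ∧ lastIs (proj₁ e) p) ∨ closes ps e

    closes-∈ : ∀ {ps u v p} → p ∈ ps → headIs v p ≡ true → lastIs u p ≡ true → closes ps (u , v) ≡ true
    closes-∈ (here refl) h l rewrite h | l = refl
    closes-∈ {p ∷ ps} (there i) h l = trans (cong (_ ∨_) (closes-∈ i h l)) (BoolP.∨-zeroʳ _)

    -- Each path forbids at most one arc, the one from its last to its first vertex.
    closes-few : ∀ ps → ∑ arcs (λ e → b2z (closes ps e)) ≤ + length ps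
    closes-few ps = ℤP.≤-trans (ℤP.≤-reflexive (∑-arcs _)) (ℤP.≤-trans (∑-mono (allFin n) (λ u → ∑-mono (allFin n) (λ v →
        subst (b2z (D u v) * b2z (closes ps (u , v)) ≤_) (ℤP.*-identityˡ _) (*-monoʳ-nn (b2z≥0 (closes ps (u , v))) (b2z≤1 (D u v)))))) (go ps))
      where
      go : ∀ ps → ∑ (allFin n) (λ u → ∑ (allFin n) (λ v → b2z (closes ps (u , v)))) ≤ + length ps
      go [] = ℤP.≤-reflexive (trans (∑-cong (allFin n) (λ _ → ∑-0 (allFin n))) (∑-0 (allFin n)))
      go (p ∷ ps) = ℤP.≤-trans (∑-mono (allFin n) (λ u → ∑-mono (allFin n) (λ v → t (headIs v p) (lastIs u p) (closes ps (u , v)))))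
        (ℤP.≤-trans (ℤP.≤-reflexive (trans (∑-cong (allFin n) (λ u → ∑-+ (allFin n) _ _)) (∑-+ (allFin n) _ _))) (ℤP.+-mono-≤ one (go ps)))
        where
        t : ∀ h l c → b2z ((h ∧ l) ∨ c) ≤ b2z h * b2z l + b2z c
        t true true c = b2z≥0 c ≤by refl
        t true false c = ℤP.≤-reflexive (sym (ℤP.+-identityˡ (b2z c)))
        t false l c = ℤP.≤-reflexive (sym (ℤP.+-identityˡ (b2z c)))
        one : ∑ (allFin n) (λ u → ∑ (allFin n) (λ v → b2z (headIs v p) * b2z (lastIs u p))) ≤ 1ℤ
        one = ℤP.≤-trans (ℤP.≤-reflexive (trans (∑-cong (allFin n) (λ u → ∑-*ʳ (allFin n) (b2z (lastIs u p)) (λ v → b2z (headIs v p)))) (∑-*ˡ (allFin n) (∑ (allFin n) (λ v → b2z (headIs v p))) (λ u → b2z (lastIs u p)))))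
                (*-mono-nn (∑-0≤ (allFin n) (λ v → b2z≥0 (headIs v p))) (0≤n 1) (∑-headIs p) (∑-lastIs p))

    extract : ∀ {p q : List (Fin n)} {ps} → p ∈ ps → q ∈ ps → p ≢ q → Σ Paths λ rest → ps ↭ p ∷ q ∷ rest
    extract {p} {q} i j ne with ∈-∃++ i
    ... | as , bs , refl with ∈-resp-↭ (shift p as bs) j
    ...   | here e = ⊥-elim (ne (sym e))
    ...   | there k with ∈-∃++ k
    ...     | cs , ds , e = cs ++ ds , ↭-trans (shift p as bs) (prep p (↭-trans (↭-reflexive e) (shift q cs ds)))

    false≢true : false ≢ true
    false≢true ()

    killed : ∀ (a : State) (k : Vtx → Bool) x → (a ∖ k) x ≡ true → a x ≡ true × k x ≡ false
    killed a k x with a x | k x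
    ... | true | false = λ _ → refl , refl
    ... | true | true = λ ()
    ... | false | _ = λ ()

    still-false : ∀ (a : State) (k : Vtx → Bool) x → a x ≡ false → (a ∖ k) x ≡ false
    still-false a k x e = cong (_∧ not (k x)) e

    kills₁ : ∀ u v → killₑ (u , v) (outV u) ≡ true
    kills₁ u v with outV u ≟V outV u
    ... | yes _ = refl
    ... | no p = ⊥-elim (p refl)

    kills₂ : ∀ u v → killₑ (u , v) (inV v) ≡ true
    kills₂ u v with outV u ≟V inV v | inV v ≟V inV v
    ... | no _ | yes _ = refl
    ... | yes () | _
    ... | no _ | no p = ⊥-elim (p refl)

    kills₃ : ∀ u v → killₑ (u , v) (colV (colF u v)) ≡ true
    kills₃ u v with outV u ≟V colV (colF u v) | inV v ≟V colV (colF u v) | colV (colF u v) ≟V colV (colF u v)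
    ... | no _ | no _ | yes _ = refl
    ... | yes () | _ | _
    ... | no _ | yes () | _
    ... | no _ | no _ | no p = ⊥-elim (p refl)

    shrink-paths : ∀ {ps a} k → Fits ps a → Fits ps (a ∖ k)
    shrink-paths {ps} {a} k f = record
      { covers = covers ; rainbow = rainbow ; number = number ; edges = edges
      ; spent = λ i → still-false a k _ (spent i)
      ; lasts = λ u h → lasts u (proj₁ (killed a k (outV u) h))
      ; heads = λ v h → heads v (proj₁ (killed a k (inV v) h)) }
      where open Fits f

    -- The live copies provide a path ending in u and a path beginning in v; the veto makes them
    -- different, so they can be concatenated. Afterwards u is no longer the end of a path and v no
    -- longer the beginning of one, and the arc has killed just these two copies and its colour.
    grow-paths : ∀ {ps a e} → Fits ps a → e ∈ arcs → live a e ≡ true → closes ps e ≡ false →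
                 Σ Paths λ ps′ → Fits ps′ (a ∖ killₑ e) × + n - + length ps′ ≡ + n - + length ps + 1ℤ
    grow-paths {ps} {a} {u , v} f e∈ lv open-arc = (p ++ q) ∷ rest , fits′ , count′
      where
      open Fits f
      ∧⇒ : ∀ x y z → x ∧ y ∧ z ≡ true → x ≡ true × y ≡ true × z ≡ true
      ∧⇒ true true true _ = refl , refl , refl
      alive = ∧⇒ (a (outV u)) (a (inV v)) (a (colV (colF u v))) lv
      P = lasts u (proj₁ alive)
      Q = heads v (proj₁ (proj₂ alive))
      p q : List (Fin n)
      p = proj₁ P
      q = proj₁ Q
      p-last : lastIs u p ≡ true
      p-last = proj₂ (proj₂ P)
      q-head : headIs v q ≡ true
      q-head = proj₂ (proj₂ Q)
      p≢q : p ≢ q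
      p≢q e = false≢true (trans (sym open-arc) (closes-∈ {ps} (proj₁ (proj₂ P)) (subst (λ z → headIs v z ≡ true) (sym e) q-head) p-last))
      R = extract (proj₁ (proj₂ P)) (proj₁ (proj₂ Q)) p≢q
      rest : Paths
      rest = proj₁ R
      ps↭ : ps ↭ p ∷ q ∷ rest
      ps↭ = proj₂ R
      join : steps (p ++ q) ≡ steps p ++ (u , v) ∷ steps q
      join with lastIs⇒ p p-last | headIs⇒ q q-head
      ... | T , e₁ | t , e₂ = trans (cong steps (trans (cong₂ _++_ e₁ e₂) (++-assoc T [ u ] (v ∷ t)))) (trans (steps-++ T u (v ∷ t))
            (cong₂ (λ x y → steps x ++ (u , v) ∷ steps y) (sym e₁) (sym e₂)))
      arcs↭ : pathArcs ((p ++ q) ∷ rest) ↭ (u , v) ∷ pathArcs ps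
      arcs↭ = ↭-trans (↭-reflexive (trans (cong (_++ pathArcs rest) join) (++-assoc (steps p) ((u , v) ∷ steps q) (pathArcs rest))))
        (↭-trans (shift (u , v) (steps p) (steps q ++ pathArcs rest)) (prep (u , v) (↭-sym (concat-↭ (map⁺ steps ps↭)))))
      fresh : ∀ {e} → e ∈ pathArcs ps → colour (u , v) ≢ colour e
      fresh {u′ , v′} i c = false≢true (trans (sym (spent i)) (trans (cong (λ z → a (colV z)) (toℕ-injective (trans (toℕ-colF u′ v′) (trans (sym c) (sym (toℕ-colF u v)))))) (proj₂ (proj₂ alive))))
      fits′ : Fits ((p ++ q) ∷ rest) (a ∖ killₑ (u , v))
      fits′ = record
        { covers = ↭-trans (↭-reflexive (++-assoc p q (concat rest))) (↭-trans (↭-sym (concat-↭ ps↭)) covers)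
        ; rainbow = Unique-resp-↭ (↭-sym (map⁺ colour arcs↭)) (AllP.map⁺ (All.tabulate fresh) ∷ rainbow)
        ; number = trans (cong₂ ℕ._+_ (↭-length arcs↭) refl) (trans (sym (ℕP.+-suc (length (pathArcs ps)) (suc (length rest)))) (trans (cong (length (pathArcs ps) ℕ.+_) (sym (↭-length ps↭))) number))
        ; edges = λ i → edges′ (∈-resp-↭ arcs↭ i)
        ; spent = λ i → spent′ (∈-resp-↭ arcs↭ i)
        ; lasts = λ u′ h → let h₁ , h₂ = killed a (killₑ (u , v)) (outV u′) h ; p′ , i , l = lasts u′ h₁ in lasts′ u′ h₂ p′ (∈-resp-↭ ps↭ i) l
        ; heads = λ v′ h → let h₁ , h₂ = killed a (killₑ (u , v)) (inV v′) h ; p′ , i , l = heads v′ h₁ in heads′ v′ h₂ p′ (∈-resp-↭ ps↭ i) l }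
        where
        edges′ : ∀ {e} → e ∈ (u , v) ∷ pathArcs ps → adj (proj₁ e) (proj₂ e) ≡ true
        edges′ (here refl) = D⊆adj u v (proj₂ (∈-filter⁻ (λ e → isArc e Bool.≟ true) {xs = cartesianProduct (allFin n) (allFin n)} e∈))
        edges′ (there i) = edges i
        spent′ : ∀ {u′ v′} → (u′ , v′) ∈ (u , v) ∷ pathArcs ps → (a ∖ killₑ (u , v)) (colV (colF u′ v′)) ≡ false
        spent′ (here refl) = trans (cong (λ b → a (colV (colF u v)) ∧ not b) (kills₃ u v)) (BoolP.∧-zeroʳ _)
        spent′ (there i) = still-false a (killₑ (u , v)) _ (spent i)
        lasts′ : ∀ u′ → killₑ (u , v) (outV u′) ≡ false → ∀ p′ → p′ ∈ p ∷ q ∷ rest → lastIs u′ p′ ≡ true →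
                 Σ (List (Fin n)) λ z → z ∈ (p ++ q) ∷ rest × lastIs u′ z ≡ true
        lasts′ u′ nk p′ (here refl) l with lastIs-unique p l p-last
        ... | refl = ⊥-elim (false≢true (trans (sym nk) (kills₁ u v)))
        lasts′ u′ nk p′ (there (here refl)) l = p ++ q , here refl , lastIs-++ p q l
        lasts′ u′ nk p′ (there (there i)) l = p′ , there i , l
        heads′ : ∀ v′ → killₑ (u , v) (inV v′) ≡ false → ∀ p′ → p′ ∈ p ∷ q ∷ rest → headIs v′ p′ ≡ true →
                 Σ (List (Fin n)) λ z → z ∈ (p ++ q) ∷ rest × headIs v′ z ≡ true
        heads′ v′ nk p′ (here refl) l = p ++ q , here refl , headIs-++ p q l
        heads′ v′ nk p′ (there (here refl)) l with headIs-unique q l q-head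
        ... | refl = ⊥-elim (false≢true (trans (sym nk) (kills₂ u v)))
        heads′ v′ nk p′ (there (there i)) l = p′ , there i , l
      count′ : + n - + suc (length rest) ≡ + n - + length ps + 1ℤ
      count′ = trans (e (+ n) (+ length rest)) (cong (λ k → + n - + k + 1ℤ) (sym (↭-length ps↭)))
        where e : ∀ n r → n - (1ℤ + r) ≡ n - (+ 2 + r) + 1ℤ
              e = solve-∀

    growth : Growth ℋ (+ n)
    growth = record
      { Str = Paths ; Fits = Fits ; count = λ ps → + n - + length ps ; veto = closes
      ; shrink = shrink-paths ; grow = grow-paths
      ; few = λ {ps} f → ℤP.≤-trans (closes-few ps) (+≤+ (subst (length ps ℕ.≤_) (Fits.number f) (ℕP.m≤n+m (length ps) (length (pathArcs ps))))) }

    singletons : Paths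
    singletons = map [_] (allFin n)

    fits-singletons : Fits singletons (λ _ → true)
    fits-singletons = record
      { covers = ↭-reflexive (concat-map-[ allFin n ])
      ; rainbow = subst (λ l → Unique (map colour l)) (sym none) []
      ; number = trans (cong (λ l → length l ℕ.+ length singletons) none) (trans (length-map [_] (allFin n)) (length-tabulate {n = n} (λ i → i)))
      ; edges = λ i → ⊥-elim (nothing i) ; spent = λ i → ⊥-elim (nothing i)
      ; lasts = λ u _ → [ u ] , ∈-map⁺ [_] (∈-allFin u) , ⌊≟⌋-refl u
      ; heads = λ v _ → [ v ] , ∈-map⁺ [_] (∈-allFin v) , ⌊≟⌋-refl v }
      where
      empty : ∀ (l : List (Fin n)) → pathArcs (map [_] l) ≡ []
      empty [] = refl
      empty (x ∷ l) = empty l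
      none : pathArcs singletons ≡ []
      none = empty (allFin n)
      nothing : ∀ {e} → e ∈ pathArcs singletons → ⊥
      nothing i with subst (_ ∈_) none i
      ... | ()

-- Choice of parameters and verification of their conditions.

module Arithmetic where
  open FiniteSums
  open Nibble using (Parameters)
  open import Data.Integer using (ℤ; +_; 0ℤ; 1ℤ; _+_; _*_; _-_; -_; _≤_; _<_; +≤+; +<+)
  open import Data.Integer.Tactic.RingSolver using (solve-∀)
  open import Data.Nat as ℕ using (ℕ; zero; suc)

  root : ∀ k .{{_ : ℕ.NonZero k}} n → Σ ℕ λ h → h ℕ.^ k ℕ.≤ n × n ℕ.< suc h ℕ.^ k
  root k@(suc _) zero = 0 , ℕ.z≤n , ℕP.m^n>0 1 k
  root k (suc n) with root k n
  ... | h , lo , hi with suc h ℕ.^ k ℕP.≤? suc n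
  ...   | yes le = suc h , le , ℕP.≤-<-trans hi (ℕP.^-monoˡ-< k (ℕP.n<1+n (suc h)))
  ...   | no gt = h , ℕP.m≤n⇒m≤1+n lo , ℕP.≰⇒> gt

  bernoulli : ∀ r j k → r ℕ.^ suc k ℕ.+ suc k ℕ.* (j ℕ.* r ℕ.^ k) ℕ.≤ (r ℕ.+ j) ℕ.^ suc k
  bernoulli r j zero = ℕP.≤-reflexive (eq r j)
    where eq : ∀ r j → r ℕ.* 1 ℕ.+ 1 ℕ.* (j ℕ.* 1) ≡ (r ℕ.+ j) ℕ.* 1
          eq = solveℕ
  bernoulli r j (suc k) = ℕP.≤-trans (ℕP.m≤m+n _ (suc k ℕ.* (j ℕ.* (j ℕ.* r ℕ.^ k))))
    (ℕP.≤-trans (ℕP.≤-reflexive (eq r j (suc k) (r ℕ.^ k))) (ℕP.*-monoʳ-≤ (r ℕ.+ j) (bernoulli r j k)))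
    where eq : ∀ r j k x → r ℕ.* (r ℕ.* x) ℕ.+ (1 ℕ.+ k) ℕ.* (j ℕ.* (r ℕ.* x)) ℕ.+ k ℕ.* (j ℕ.* (j ℕ.* x)) ≡ (r ℕ.+ j) ℕ.* (r ℕ.* x ℕ.+ k ℕ.* (j ℕ.* x))
          eq = solveℕ

  -- Bernoulli's inequality for 1 + j/r, where j/r is at least 1/(k + 1).
  doubling : ∀ r j k → r ℕ.≤ suc k ℕ.* j → 2 ℕ.* r ℕ.^ suc k ℕ.≤ (r ℕ.+ j) ℕ.^ suc k
  doubling r j k le = ℕP.≤-trans (ℕP.≤-trans (ℕP.≤-reflexive (cong (r ℕ.^ suc k ℕ.+_) (ℕP.+-identityʳ _)))
      (ℕP.+-monoʳ-≤ (r ℕ.^ suc k) (ℕP.≤-trans (ℕP.*-monoˡ-≤ (r ℕ.^ k) le) (ℕP.≤-reflexive (ℕP.*-assoc (suc k) j (r ℕ.^ k))))))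
    (bernoulli r j k)

  ^-distribʳ-* : ∀ t a b → (a ℕ.* b) ℕ.^ t ≡ a ℕ.^ t ℕ.* b ℕ.^ t
  ^-distribʳ-* zero a b = refl
  ^-distribʳ-* (suc t) a b = trans (cong (a ℕ.* b ℕ.*_) (^-distribʳ-* t a b)) (eq a b (a ℕ.^ t) (b ℕ.^ t))
    where eq : ∀ a b x y → a ℕ.* b ℕ.* (x ℕ.* y) ≡ a ℕ.* x ℕ.* (b ℕ.* y)
          eq = solveℕ

  -- Repeating the doubling t times gains 2^t, which exceeds n. This provides the growth hypothesis
  -- of `factor`.
  power-growth : ∀ r j k t n → 1 ℕ.≤ r → r ℕ.≤ suc k ℕ.* j → n ℕ.< 2 ℕ.^ t → r ℕ.^ (suc k ℕ.* t) ℕ.* n ℕ.< (r ℕ.+ j) ℕ.^ (suc k ℕ.* t)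
  power-growth r j k t n r≥1 le lt = ℕP.<-≤-trans (ℕP.*-monoʳ-< (r ℕ.^ (suc k ℕ.* t)) {{ℕP.m^n≢0 r (suc k ℕ.* t) {{ℕ.>-nonZero r≥1}}}} lt)
    (ℕP.≤-trans (ℕP.≤-reflexive eq) (ℕP.≤-trans (ℕP.^-monoˡ-≤ t (doubling r j k le)) (ℕP.≤-reflexive (ℕP.^-*-assoc (r ℕ.+ j) (suc k) t))))
    where
    eq : r ℕ.^ (suc k ℕ.* t) ℕ.* 2 ℕ.^ t ≡ (2 ℕ.* r ℕ.^ suc k) ℕ.^ t
    eq = trans (cong (ℕ._* 2 ℕ.^ t) (sym (ℕP.^-*-assoc r (suc k) t))) (trans (ℕP.*-comm ((r ℕ.^ suc k) ℕ.^ t) (2 ℕ.^ t)) (sym (^-distribʳ-* t 2 (r ℕ.^ suc k))))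

  infixl 7 _⊗_
  -- Reified products, so that an inequality between products of naturals is carried over to the
  -- integers in one go.
  data Product : Set where
    ⟨_⟩ : ℕ → Product
    _⊗_ : Product → Product → Product

  valℕ : Product → ℕ
  valℕ ⟨ n ⟩ = n
  valℕ (a ⊗ b) = valℕ a ℕ.* valℕ b

  valℤ : Product → ℤ
  valℤ ⟨ n ⟩ = + n
  valℤ (a ⊗ b) = valℤ a * valℤ b

  val≡ : ∀ a → + valℕ a ≡ valℤ a
  val≡ ⟨ n ⟩ = refl
  val≡ (a ⊗ b) = trans (ℤP.pos-* (valℕ a) (valℕ b)) (cong₂ _*_ (val≡ a) (val≡ b))

  cast-≤ : ∀ a b → valℕ a ℕ.≤ valℕ b → valℤ a ≤ valℤ b
  cast-≤ a b le = subst₂ _≤_ (val≡ a) (val≡ b) (+≤+ le)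

  -- The sizes in the nibble, described only by the inequalities that its conditions need. The
  -- in-degrees exceed r by at most 2j, w is the parameter of `V-delete`, and l, c, f stand for Λ =
  -- nl, C = nc, θ = n²f.
  record Scales (n h : ℕ) : Set where
    field
      j w s l f c r : ℕ
      h≥102 : 102 ℕ.≤ h
      n≥1   : 1 ℕ.≤ n
      j≥1   : 1 ℕ.≤ j
      s≥1   : 1 ℕ.≤ s
      l≥1   : 1 ℕ.≤ l
      w≡hs  : w ≡ h ℕ.* s
      l≡hf  : l ≡ h ℕ.* f
      f≡    : f ≡ h ℕ.* (h ℕ.* (h ℕ.* h))
      l²h²≤c : l ℕ.* l ℕ.* (h ℕ.* h) ℕ.≤ c
      lj≤n  : l ℕ.* j ℕ.≤ n
      c≤n   : c ℕ.≤ n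
      bound₁ : h ℕ.* h ℕ.* (h ℕ.* h) ℕ.* (f ℕ.* (n ℕ.* n)) ℕ.≤ s ℕ.* (j ℕ.* j)
      bound₂ : h ℕ.* h ℕ.* (h ℕ.* h) ℕ.* (w ℕ.* w ℕ.* n) ℕ.≤ s ℕ.* (j ℕ.* j)
      bound₃ : h ℕ.* h ℕ.* (h ℕ.* h) ℕ.* (w ℕ.* (n ℕ.* l)) ℕ.≤ s ℕ.* (j ℕ.* j)
      n≤5r  : n ℕ.≤ 5 ℕ.* r
      r≤n   : r ℕ.≤ n
      D₀≤n  : r ℕ.+ j ℕ.+ j ℕ.≤ n

  module _ {n h : ℕ} (S : Scales n h) (N : ℕ) where
    open Scales S
    private
      n′ h′ j′ w′ s′ l′ f′ c′ r′ D : ℤ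
      n′ = + n
      h′ = + h
      j′ = + j
      w′ = + w
      s′ = + s
      l′ = + l
      f′ = + f
      c′ = + c
      r′ = + r
      D = r′ + (j′ + j′ + j′)
      D₁ : ℕ
      D₁ = r ℕ.+ (j ℕ.+ j ℕ.+ j)
      sub3 : r′ + (j′ + j′ + j′) - r′ ≡ j′ + j′ + j′
      sub3 = e r′ j′
        where e : ∀ r j → r + (j + j + j) - r ≡ j + j + j
              e = solve-∀
      pos : ∀ {k} → 1 ℕ.≤ k → 0ℤ < + k
      pos p = +<+ p
      nn : ∀ k → 0ℤ ≤ + k
      nn = 0≤n
      h4 : ℤ
      h4 = h′ * h′ * (h′ * h′)
      B₁ : h4 * (f′ * (n′ * n′)) ≤ s′ * (j′ * j′)
      B₁ = cast-≤ (⟨ h ⟩ ⊗ ⟨ h ⟩ ⊗ (⟨ h ⟩ ⊗ ⟨ h ⟩) ⊗ (⟨ f ⟩ ⊗ (⟨ n ⟩ ⊗ ⟨ n ⟩))) (⟨ s ⟩ ⊗ (⟨ j ⟩ ⊗ ⟨ j ⟩)) bound₁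
      B₂ : h4 * (w′ * w′ * n′) ≤ s′ * (j′ * j′)
      B₂ = cast-≤ (⟨ h ⟩ ⊗ ⟨ h ⟩ ⊗ (⟨ h ⟩ ⊗ ⟨ h ⟩) ⊗ (⟨ w ⟩ ⊗ ⟨ w ⟩ ⊗ ⟨ n ⟩)) (⟨ s ⟩ ⊗ (⟨ j ⟩ ⊗ ⟨ j ⟩)) bound₂
      B₃ : h4 * (w′ * (n′ * l′)) ≤ s′ * (j′ * j′)
      B₃ = cast-≤ (⟨ h ⟩ ⊗ ⟨ h ⟩ ⊗ (⟨ h ⟩ ⊗ ⟨ h ⟩) ⊗ (⟨ w ⟩ ⊗ (⟨ n ⟩ ⊗ ⟨ l ⟩))) (⟨ s ⟩ ⊗ (⟨ j ⟩ ⊗ ⟨ j ⟩)) bound₃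
      LJ : l′ * j′ ≤ n′
      LJ = cast-≤ (⟨ l ⟩ ⊗ ⟨ j ⟩) ⟨ n ⟩ lj≤n
      LLHH : l′ * l′ * (h′ * h′) ≤ c′
      LLHH = cast-≤ (⟨ l ⟩ ⊗ ⟨ l ⟩ ⊗ (⟨ h ⟩ ⊗ ⟨ h ⟩)) ⟨ c ⟩ l²h²≤c
      W≡ : w′ ≡ h′ * s′
      W≡ = trans (cong +_ w≡hs) (ℤP.pos-* h s)
      L≡ : l′ ≡ h′ * f′
      L≡ = trans (cong +_ l≡hf) (ℤP.pos-* h f)
      F≡ : f′ ≡ h′ * (h′ * (h′ * h′))
      F≡ = trans (cong +_ f≡) (val≡ (⟨ h ⟩ ⊗ (⟨ h ⟩ ⊗ (⟨ h ⟩ ⊗ ⟨ h ⟩))))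
      N5 : n′ ≤ + 5 * r′
      N5 = cast-≤ ⟨ n ⟩ (⟨ 5 ⟩ ⊗ ⟨ r ⟩) n≤5r
      r≤D : r′ ≤ D
      r≤D = 0≤+ (0≤+ (nn j) (nn j)) (nn j) ≤by refl
      N5D : n′ ≤ + 5 * D
      N5D = ℤP.≤-trans N5 (*-monoˡ-nn (0≤n 5) r≤D)
      D≥0 : 0ℤ ≤ D
      D≥0 = ℤP.≤-trans (nn r) r≤D
      H : + 102 ≤ h′
      H = +≤+ h≥102
      J1 : 1ℤ ≤ j′
      J1 = +≤+ j≥1
      w≥1 : 1ℤ ≤ w′
      w≥1 = subst (1ℤ ≤_) (sym W≡) (*-mono-nn {1ℤ} {h′} {1ℤ} {s′} (0≤n 1) (nn s) (ℤP.≤-trans (+≤+ (ℕ.s≤s ℕ.z≤n)) H) (+≤+ s≥1))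
      r≥1 : 1ℤ ≤ r′
      r≥1 = ℤP.i<j⇒suc[i]≤j (ℤP.≰⇒> λ r≤0 → ℤP.<⇒≱ (pos n≥1) (ℤP.≤-trans N5 (*-monoˡ-nn {+ 5} {r′} {0ℤ} (0≤n 5) r≤0)))

      amgm-c : n′ * l′ * (n′ * l′) * (h′ * h′) ≤ + 8 * (D * (n′ * c′))
      amgm-c = 0≤+ (0≤* (0≤sq n′) (gap LLHH)) (0≤* (0≤* (nn n) (nn c)) (0≤+ (gap N5D) (0≤* (0≤n 3) D≥0))) ≤by e n′ l′ h′ c′ D
        where e : ∀ n l h c D → + 8 * (D * (n * c)) ≡ n * l * (n * l) * (h * h) + (n * n * (c - l * l * (h * h)) + n * c * (+ 5 * D - n + + 3 * D))
              e = solve-∀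

      drift-c : (h′ * (h′ * h′)) * (n′ * (n′ * l′ * (j′ + j′ + j′ + + 2) + n′ * c′) + + 36 * ((D + 1ℤ) * (n′ * r′))) ≤ D * (n′ * n′ * f′)
      drift-c = subst (λ F → (h′ * (h′ * h′)) * (n′ * (n′ * l′ * (j′ + j′ + j′ + + 2) + n′ * c′) + + 36 * ((D + 1ℤ) * (n′ * r′))) ≤ D * (n′ * n′ * F)) (sym F≡)
        (ℤP.≤-trans (*-monoˡ-nn h³≥0 bracket) (0≤* (0≤* h³≥0 (0≤* D≥0 (0≤sq n′))) (gap H) ≤by e₁ h′ D n′))
        where
        h³≥0 : 0ℤ ≤ h′ * (h′ * h′)
        h³≥0 = 0≤* (nn h) (0≤sq h′)
        e₁ : ∀ h D n → D * (n * n * (h * (h * (h * h)))) ≡ h * (h * h) * (+ 102 * (D * (n * n))) + h * (h * h) * (D * (n * n)) * (h - + 102)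
        e₁ = solve-∀
        -- 102 = 30 + 72. The first product is at most 6n³, hence at most 30Dn² by n ≤ 5D; the
        -- second is at most 72Dn². The hypothesis h ≥ 102 then absorbs the constant.
        bracket : n′ * (n′ * l′ * (j′ + j′ + j′ + + 2) + n′ * c′) + + 36 * ((D + 1ℤ) * (n′ * r′)) ≤ + 102 * (D * (n′ * n′))
        bracket = 0≤+ (0≤+ (0≤+ (0≤* (0≤* (0≤sq n′) (0≤* (0≤n 2) (nn l))) (gap J1)) (0≤* (0≤* (0≤n 5) (0≤sq n′)) (gap LJ)))
                        (0≤+ (0≤* (0≤sq n′) (gap (+≤+ c≤n))) (0≤* (0≤* (0≤n 6) (0≤sq n′)) (gap N5D))))
                   (0≤+ (0≤* (0≤* (0≤n 36) (0≤* D≥0 (nn n))) (gap (+≤+ r≤n)))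
                     (0≤+ (0≤* (0≤* (0≤n 36) (0≤* D≥0 (nn n))) (gap (+≤+ r≤n))) (0≤* (0≤* (0≤n 36) (0≤* (nn n) (nn r))) (gap (ℤP.≤-trans r≥1 r≤D)))))
                 ≤by e₂ n′ l′ j′ c′ D r′
          where e₂ : ∀ n l j c D r → + 102 * (D * (n * n)) ≡ n * (n * l * (j + j + j + + 2) + n * c) + + 36 * ((D + 1ℤ) * (n * r)) +
                       (n * n * (+ 2 * l) * (j - 1ℤ) + + 5 * (n * n) * (n - l * j) + (n * n * (n - c) + + 6 * (n * n) * (+ 5 * D - n))
                        + (+ 36 * (D * n) * (n - r) + (+ 36 * (D * n) * (n - r) + + 36 * (n * r) * (D - 1ℤ))))
                e₂ = solve-∀

      delete-c : (h′ * h′) * (h′ * h′) * (n′ * n′ * f′ + n′ * n′ * f′ + (w′ * w′ + w′) * (+ 3 * (r′ + j′ + j′)) + w′ * (n′ * l′)) ≤ w′ * (j′ * j′)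
      delete-c = 0≤+ (0≤+ (0≤+ (0≤* (0≤n 2) (gap B₁)) (0≤* (0≤n 6) (gap B₂))) (0≤+ (gap B₃) slack))
                   (0≤+ (0≤* (0≤* (0≤* h4≥0 (0≤n 3)) (0≤+ (0≤* (nn w) (nn w)) (nn w))) (gap (+≤+ D₀≤n)))
                        (0≤* (0≤* (0≤* h4≥0 (0≤n 3)) (0≤* (nn w) (nn n))) (gap w≥1)))
                 ≤by e h′ n′ f′ w′ r′ j′ l′ s′
        where
        h4≥0 : 0ℤ ≤ h4
        h4≥0 = 0≤sq (h′ * h′)
        -- The three bounds are used 2, 6 and 1 times, which makes 9 copies of sj²; one factor h in
        -- w = hs is more than enough.
        slack : 0ℤ ≤ w′ * (j′ * j′) - + 9 * (s′ * (j′ * j′))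
        slack = subst (λ W → 0ℤ ≤ W * (j′ * j′) - + 9 * (s′ * (j′ * j′))) (sym W≡)
          (subst (0ℤ ≤_) (e₃ h′ s′ j′) (0≤* (0≤* (nn s) (0≤sq j′)) (0≤+ (gap H) (0≤n 93))))
          where e₃ : ∀ h s j → s * (j * j) * (h - + 102 + + 93) ≡ h * s * (j * j) - + 9 * (s * (j * j))
                e₃ = solve-∀
        e : ∀ h n f w r j l s → w * (j * j) ≡
          (h * h) * (h * h) * (n * n * f + n * n * f + (w * w + w) * (+ 3 * (r + j + j)) + w * (n * l)) +
          (+ 2 * (s * (j * j) - h * h * (h * h) * (f * (n * n))) + + 6 * (s * (j * j) - h * h * (h * h) * (w * w * n)) +
            (s * (j * j) - h * h * (h * h) * (w * (n * l)) + (w * (j * j) - + 9 * (s * (j * j))))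
           + (h * h * (h * h) * + 3 * (w * w + w) * (n - (r + j + j)) + h * h * (h * h) * + 3 * (w * n) * (w - 1ℤ)))
        e = solve-∀

      -- Λ = nhf is chosen so that Λn/h and θ are equal, each one half of β.
      start-c : n′ * l′ * n′ + h′ * (n′ * n′ * f′) ≤ h′ * (n′ * n′ * f′ + n′ * n′ * f′)
      start-c = ℤP.≤-reflexive (trans (cong (λ L → n′ * L * n′ + h′ * (n′ * n′ * f′)) L≡) (e n′ h′ f′))
        where e : ∀ n h f → n * (h * f) * n + h * (n * n * f) ≡ h * (n * n * f + n * n * f)
              e = solve-∀

    parameters : Parameters
    parameters = record
      -- Only lower bounds are imposed on mT, so it may be as large as the number of colours
      -- demands.
      { h = h ; mT = suc (N ℕ.+ (r ℕ.+ j ℕ.+ j)) ; D₁ = D₁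
      ; n = n′ ; r = r′ ; D₀ = + (r ℕ.+ j ℕ.+ j) ; ι = j′ ; w = w′ ; Λ = n′ * l′ ; C = n′ * c′
      ; θ = n′ * n′ * f′ ; β = n′ * n′ * f′ + n′ * n′ * f′ ; M = n′ * r′ ; N = + N
      ; h≥1 = ℕP.≤-trans (ℕ.s≤s ℕ.z≤n) h≥102 ; mT≥1 = ℕ.s≤s ℕ.z≤n
      ; D₁≥1 = ℕP.≤-trans j≥1 (ℕP.≤-trans (ℕP.m≤n+m j (j ℕ.+ j)) (ℕP.m≤n+m (j ℕ.+ j ℕ.+ j) r))
      ; n≥0 = nn n ; M≥0 = 0≤* (nn n) (nn r)
      ; Λ≥1 = *-mono-nn {1ℤ} {n′} {1ℤ} {l′} (0≤n 1) (nn l) (+≤+ n≥1) (+≤+ l≥1)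
      ; C≥0 = 0≤* (nn n) (nn c) ; θ≥0 = 0≤* (0≤sq n′) (nn f)
      ; w≥1 = w≥1 ; ι≥0 = nn j ; D₀≥0 = nn _
      ; β≥0 = 0≤+ (0≤* (0≤sq n′) (nn f)) (0≤* (0≤sq n′) (nn f))
      ; r≤D₁ = r≤D ; D₀+ι = ℤP.≤-reflexive (cong +_ (trans (ℕP.+-assoc (r ℕ.+ j) j j) (trans (ℕP.+-assoc r j (j ℕ.+ j)) (cong (r ℕ.+_) (sym (ℕP.+-assoc j j j))))))
      ; N≤mT = +≤+ (ℕP.m≤n⇒m≤1+n (ℕP.m≤m+n N _)) ; D₀≤mT = +≤+ (ℕP.m≤n⇒m≤1+n (ℕP.m≤n+m _ N))
      ; amgm-condition = amgm-c
      ; drift-condition = subst (λ Q → (h′ * (h′ * h′)) * (n′ * (n′ * l′ * (Q + + 2) + n′ * c′) + + 36 * ((D + 1ℤ) * (n′ * r′))) ≤ D * (n′ * n′ * f′)) (sym sub3) drift-c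
      ; delete-condition = delete-c
      ; start-condition = start-c }

    -- Λ g ≤ β with Λ = n h f and β = 2 n² f
    unscale : ∀ g → n′ * l′ * + g ≤ n′ * n′ * f′ + n′ * n′ * f′ → h ℕ.* g ℕ.≤ 2 ℕ.* n
    unscale g le = ℤP.drop‿+≤+ (subst₂ _≤_ (sym (ℤP.pos-* h g)) (sym (ℤP.pos-* 2 n))
      (cancelˡ {n′ * f′} nf>0 (subst₂ _≤_ (trans (cong (λ L → n′ * L * + g) L≡) (e₁ n′ h′ f′ (+ g))) (e₂ n′ f′) le)))
      where
      e₁ : ∀ n h f g → n * (h * f) * g ≡ n * f * (h * g)
      e₁ = solve-∀
      e₂ : ∀ n f → n * n * f + n * n * f ≡ n * f * (+ 2 * n)
      e₂ = solve-∀
      f≥1 : 1 ℕ.≤ f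
      f≥1 = subst (1 ℕ.≤_) (sym f≡) (ℕP.*-mono-≤ {1} {h} h≥1 (ℕP.*-mono-≤ {1} {h} h≥1 (ℕP.*-mono-≤ {1} {h} h≥1 h≥1)))
        where h≥1 : 1 ℕ.≤ h
              h≥1 = ℕP.≤-trans (ℕ.s≤s ℕ.z≤n) h≥102
      nf>0 : 0ℤ < n′ * f′
      nf>0 = ℤP.<-≤-trans (+<+ (ℕ.s≤s ℕ.z≤n)) (*-mono-nn {1ℤ} {n′} {1ℤ} {f′} (0≤n 1) (nn f) (+≤+ n≥1) (+≤+ f≥1))

-- Assembly: exponents, degrees of the 3-graph, and counting of colours.

module RainbowTours where
  open import Defs hiding (sym)
  open FiniteSums
  open Hypergraphs
  open Nibble
  open NearRegularFactor
  open CyclicOrders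
  open HamiltonCycles
  open PathForests
  open Arithmetic
  open RandomDeletion using (bool-cases)
  open import Data.Integer using (ℤ; +_; 0ℤ; 1ℤ; +≤+) renaming (_≤_ to _≤ℤ_; _*_ to _*ℤ_; _+_ to _+ℤ_; _-_ to _-ℤ_)
  open import Data.Integer.Tactic.RingSolver using (solve-∀)
  open import Data.Nat using (ℕ; zero; suc; _+_; _*_; _∸_; _^_; _≤_; _<_; _⊔_; z≤n; s≤s; _/_; >-nonZero)
  open import Data.Nat.Properties
  open import Data.Nat.DivMod using (m≡m%n+[m/n]*n; m%n<n; m/n*n≤m; m/n≤m; /-monoˡ-≤; m*n/n≡m)

  -- Reflection: products of powers of h are compared by evaluating their exponents.
  data Monomial : Set where
    ′h  : Monomial
    ′h^ : ℕ → Monomial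
    _·_ : Monomial → Monomial → Monomial

  infixl 7 _·_

  exponent : Monomial → ℕ
  exponent ′h = 1
  exponent (′h^ k) = k
  exponent (a · b) = exponent a + exponent b

  ⟦_⟧ : Monomial → ℕ → ℕ
  ⟦ ′h ⟧ h = h
  ⟦ ′h^ k ⟧ h = h ^ k
  ⟦ a · b ⟧ h = ⟦ a ⟧ h * ⟦ b ⟧ h

  ⟦⟧-^ : ∀ a h → ⟦ a ⟧ h ≡ h ^ exponent a
  ⟦⟧-^ ′h h = sym (*-identityʳ h)
  ⟦⟧-^ (′h^ k) h = refl
  ⟦⟧-^ (a · b) h = trans (cong₂ _*_ (⟦⟧-^ a h) (⟦⟧-^ b h)) (sym (^-distribˡ-+-* h (exponent a) (exponent b)))

  ⟦⟧-mono : ∀ a b h → 1 ≤ h → exponent a ≤ exponent b → ⟦ a ⟧ h ≤ ⟦ b ⟧ h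
  ⟦⟧-mono a b h h≥1 le = subst₂ _≤_ (sym (⟦⟧-^ a h)) (sym (⟦⟧-^ b h)) (^-monoʳ-≤ h {{>-nonZero h≥1}} le)

  suc≤2* : ∀ {h} → 1 ≤ h → suc h ≤ 2 * h
  suc≤2* {h} h≥1 = ≤-trans (+-monoˡ-≤ h h≥1) (≤-reflexive (cong (λ t → h + t) (sym (+-identityʳ h))))

  -- Rounding the k-th root down costs a factor of at most 2^k, which is absorbed by one more factor
  -- h.
  next-power : ∀ k {n h} → 1 ≤ h → 2 ^ k ≤ h → n < suc h ^ k → n ≤ h ^ suc k
  next-power k {n} {h} h≥1 2^k≤h hi = ≤-trans (<⇒≤ (<-≤-trans hi (^-monoˡ-≤ k (suc≤2* h≥1))))
    (≤-trans (≤-reflexive (^-distribʳ-* k 2 h)) (*-monoˡ-≤ (h ^ k) 2^k≤h))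

  module _ (n h : ℕ) (h≥102 : 102 ≤ h) (lo : h ^ 43 ≤ n) (n≤h^44 : n ≤ h ^ 44) where
    private
      dec≤ : ∀ {a b} → {_ : (a ℕ.≤ᵇ b) ≡ true} → a ≤ b
      dec≤ {a} {b} {e} = ≤ᵇ⇒≤ a b (subst Bool.T (sym e) _)
      h≥1 : 1 ≤ h
      h≥1 = ≤-trans (s≤s z≤n) h≥102
      mono : ∀ a b → {_ : (exponent a ℕ.≤ᵇ exponent b) ≡ true} → ⟦ a ⟧ h ≤ ⟦ b ⟧ h
      mono a b {e} = ⟦⟧-mono a b h h≥1 (dec≤ {exponent a} {exponent b} {e})
      r : ℕ
      r = n / 4
      h≤n : ⟦ ′h^ 38 ⟧ h ≤ n
      h≤n = ≤-trans (mono (′h^ 38) (′h^ 43) {refl}) lo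
    12≤n : 12 ≤ n
    12≤n = ≤-trans (dec≤ {12} {102} {refl}) (≤-trans h≥102 (≤-trans (mono ′h (′h^ 43) {refl}) lo))

    private
      r≥3 : 3 ≤ r
      r≥3 = /-monoˡ-≤ 4 12≤n
      4r≤n : r * 4 ≤ n
      4r≤n = m/n*n≤m n 4
      n≤5r : n ≤ 5 * r
      n≤5r = ≤-trans (≤-reflexive (m≡m%n+[m/n]*n n 4)) (≤-trans (+-mono-≤ (≤-trans (ℕ.s≤s⁻¹ (m%n<n n 4)) r≥3) (≤-reflexive (*-comm r 4))) ≤-refl)
      D₀≤n : r + h ^ 37 + h ^ 37 ≤ n
      D₀≤n = *-cancelˡ-≤ 2 (≤-trans (≤-reflexive (e r (h ^ 37))) (≤-trans (+-mono-≤ (≤-trans (*-monoʳ-≤ r {2} {4} (s≤s (s≤s z≤n))) 4r≤n)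
         (≤-trans (*-monoˡ-≤ (h ^ 37) (≤-trans (dec≤ {4} {102} {refl}) h≥102)) h≤n)) (≤-reflexive (cong (λ t → n + t) (sym (+-identityʳ n))))))
        where e : ∀ r j → 2 * (r + j + j) ≡ r * 2 + 4 * j
              e = solveℕ

    scales : Scales n h
    scales = record
      -- With n replaced by h^44 in upper bounds, the exponents agree exactly in `bound₁`, 4 + 4 +
      -- 88 = 22 + 74, and in `l²h²≤c`, 10 + 2 = 12. The condition `lj≤n`, 5 + 37 ≤ 43, holds j well
      -- below n.
      { j = h ^ 37 ; w = h ^ 23 ; s = h ^ 22 ; l = h ^ 5 ; f = h ^ 4 ; c = h ^ 12 ; r = r
      ; h≥102 = h≥102
      ; n≥1 = ≤-trans (s≤s z≤n) 12≤n
      ; j≥1 = mono (′h^ 0) (′h^ 37) {refl} ; s≥1 = mono (′h^ 0) (′h^ 22) {refl} ; l≥1 = mono (′h^ 0) (′h^ 5) {refl}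
      ; w≡hs = refl ; l≡hf = refl
      ; f≡ = cong (λ t → h * (h * (h * t))) (*-identityʳ h)
      ; l²h²≤c = mono (′h^ 5 · ′h^ 5 · (′h · ′h)) (′h^ 12) {refl}
      ; lj≤n = ≤-trans (mono (′h^ 5 · ′h^ 37) (′h^ 43) {refl}) lo
      ; c≤n = ≤-trans (mono (′h^ 12) (′h^ 43) {refl}) lo
      ; bound₁ = ≤-trans (*-monoʳ-≤ (h * h * (h * h)) (*-monoʳ-≤ (h ^ 4) (*-mono-≤ n≤h^44 n≤h^44)))
          (mono (′h · ′h · (′h · ′h) · (′h^ 4 · (′h^ 44 · ′h^ 44))) (′h^ 22 · (′h^ 37 · ′h^ 37)) {refl})
      ; bound₂ = ≤-trans (*-monoʳ-≤ (h * h * (h * h)) (*-monoʳ-≤ (h ^ 23 * h ^ 23) n≤h^44))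
          (mono (′h · ′h · (′h · ′h) · (′h^ 23 · ′h^ 23 · ′h^ 44)) (′h^ 22 · (′h^ 37 · ′h^ 37)) {refl})
      ; bound₃ = ≤-trans (*-monoʳ-≤ (h * h * (h * h)) (*-monoʳ-≤ (h ^ 23) (*-monoˡ-≤ (h ^ 5) n≤h^44)))
          (mono (′h · ′h · (′h · ′h) · (′h^ 23 · (′h^ 44 · ′h^ 5))) (′h^ 22 · (′h^ 37 · ′h^ 37)) {refl})
      ; n≤5r = n≤5r ; r≤n = m/n≤m n 4 ; D₀≤n = D₀≤n }

    -- The exponent is split as h^37 = h^35 · h². A block of h^35 factors doubles, since r ≤ h^72,
    -- and h² doublings exceed n ≤ h^44 < 2^(44h).
    j-growth : r ^ (h ^ 37) * n < (r + h ^ 37) ^ (h ^ 37)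
    j-growth = subst (λ k → r ^ k * n < (r + h ^ 37) ^ k) J≡
        (power-growth r (h ^ 37) (ℕ.pred (h ^ 35)) (h * h) n (≤-trans (s≤s z≤n) r≥3)
          (subst (λ k → r ≤ k * h ^ 37) (sym pred≡) (≤-trans (m/n≤m n 4) (≤-trans n≤h^44 (mono (′h^ 44) (′h^ 35 · ′h^ 37) {refl})))) n<2^)
      where
      pred≡ : suc (ℕ.pred (h ^ 35)) ≡ h ^ 35
      pred≡ = suc-pred (h ^ 35) {{>-nonZero (mono (′h^ 0) (′h^ 35) {refl})}}
      J≡ : suc (ℕ.pred (h ^ 35)) * (h * h) ≡ h ^ 37
      J≡ = trans (cong (_* (h * h)) pred≡) (⟦⟧-^ (′h^ 35 · (′h · ′h)) h)
      n<2^ : n < 2 ^ (h * h)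
      n<2^ = ≤-<-trans n≤h^44 (<-≤-trans (^-monoˡ-< 44 h<2^h) (≤-trans (≤-reflexive (^-*-assoc 2 h 44)) (^-monoʳ-≤ 2 (*-monoʳ-≤ h (≤-trans (dec≤ {44} {102} {refl}) h≥102)))))
        where h<2^h : h < 2 ^ h
              h<2^h = go h
                where go : ∀ k → k < 2 ^ k
                      go zero = s≤s z≤n
                      go (suc k) = ≤-trans (+-mono-≤ {1} {2 ^ k} (m^n>0 2 k) (go k)) (≤-reflexive (cong (λ t → 2 ^ k + t) (sym (+-identityʳ (2 ^ k)))))

  bounded : ∀ n (f : Fin n → ℕ) → Σ ℕ λ N → ∀ i → f i < N
  bounded zero f = 0 , λ ()
  bounded (suc n) f = let N , b = bounded n (λ i → f (suc i)) in
    suc (f zero) ⊔ N , λ { zero → m≤m⊔n (suc (f zero)) N ; (suc i) → ≤-trans (b i) (m≤n⊔m (suc (f zero)) N) }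

  bounded₂ : ∀ n (f : Fin n → Fin n → ℕ) → Σ ℕ λ N → ∀ i j → f i j < N
  bounded₂ n f = let N , b = bounded n (λ i → proj₁ (bounded n (f i))) in
    N , λ i j → ≤-trans (proj₂ (bounded n (f i)) j) (<⇒≤ (b i))

  module _ {n : ℕ} (G : Graph n) (c : EdgeColouring G) where

    degree-∑ : ∀ v → + degree G v ≡ ∑ (allFin n) (λ u → b2z (adj G v u))
    degree-∑ v = trans (length-filter-∑ (λ u → adj G v u Bool.≟ true) (allFin n)) (∑-cong (allFin n) (λ u → cong b2z (⌊≟true⌋ (adj G v u))))

    ordered : ℕ → Fin n → Fin n → Bool
    ordered k u v = ⌊ (toℕ u <? toℕ v) ×-dec ((adj G u v Bool.≟ true) ×-dec (col c u v ℕ.≟ k)) ⌋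

    colourClassSize-∑ : ∀ k → + colourClassSize c k ≡ ∑ (allFin n) (λ u → ∑ (allFin n) (λ v → b2z (ordered k u v)))
    colourClassSize-∑ k = trans (length-filter-∑ _ (cartesianProduct (allFin n) (allFin n))) (∑-cartesian (allFin n) (allFin n) _)

    ordered-either : ∀ k u v → adj G u v ≡ true → col c u v ≡ k → 1ℤ ≤ℤ b2z (ordered k u v) +ℤ b2z (ordered k v u)
    ordered-either k u v a e with <-cmp (toℕ u) (toℕ v)
    ... | tri< lt _ _ = ℤP.≤-trans (ℤP.≤-reflexive (cong b2z (sym (is-true lt a e)))) (b2z≥0 (ordered k v u) ≤by refl)
      where is-true : toℕ u < toℕ v → adj G u v ≡ true → col c u v ≡ k → ordered k u v ≡ true
            is-true p q r with toℕ u <? toℕ v | adj G u v Bool.≟ true | col c u v ℕ.≟ k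
            ... | yes _ | yes _ | yes _ = refl
            ... | no x | _ | _ = ⊥-elim (x p)
            ... | yes _ | no x | _ = ⊥-elim (x q)
            ... | yes _ | yes _ | no x = ⊥-elim (x r)
    ... | tri> _ _ gt = ℤP.≤-trans (ℤP.≤-reflexive (cong b2z (sym (is-true gt (trans (Graph.sym G v u) a) (trans (colSym c v u) e)))))
                          (b2z≥0 (ordered k u v) ≤by ℤP.+-comm (b2z (ordered k u v)) (b2z (ordered k v u)))
      where is-true : toℕ v < toℕ u → adj G v u ≡ true → col c v u ≡ k → ordered k v u ≡ true
            is-true p q r with toℕ v <? toℕ u | adj G v u Bool.≟ true | col c v u ℕ.≟ k
            ... | yes _ | yes _ | yes _ = refl
            ... | no x | _ | _ = ⊥-elim (x p)
            ... | yes _ | no x | _ = ⊥-elim (x q)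
            ... | yes _ | yes _ | no x = ⊥-elim (x r)
    ... | tri≈ _ eq _ with toℕ-injective eq
    ...   | refl with trans (sym a) (Graph.irrefl G u)
    ...     | ()

    module _ (N : ℕ) (proper : Proper c) (col<N : ∀ u v → col c u v < N)
      (D : Fin n → Fin n → Bool) (D⊆adj : ∀ u v → D u v ≡ true → adj G u v ≡ true) where
      open ColouredDigraph n N (adj G) (col c) (colSym c) (Graph.sym G) proper col<N D D⊆adj
      open HypergraphProperties ℋ using (deg₀; State)

      -- An edge may be present in D in both directions, hence the factor 2.
      colour-degree : ∀ k → deg₀ (colV k) ≤ℤ + 2 *ℤ + colourClassSize c (toℕ k)
      colour-degree k = ℤP.≤-trans (ℤP.≤-reflexive (deg₀-col k)) (ℤP.≤-trans
          (∑-mono (allFin n) (λ u → ∑-mono (allFin n) (λ v → pt u v))) (ℤP.≤-reflexive total))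
        where
        κ : ℕ
        κ = toℕ k
        S : ℤ
        S = ∑ (allFin n) (λ u → ∑ (allFin n) (λ v → b2z (ordered κ u v)))
        total : ∑ (allFin n) (λ u → ∑ (allFin n) (λ v → b2z (ordered κ u v) +ℤ b2z (ordered κ v u))) ≡ + 2 *ℤ + colourClassSize c κ
        total = trans (∑-cong (allFin n) (λ u → ∑-+ (allFin n) _ _)) (trans (∑-+ (allFin n) _ _)
          (trans (cong (S +ℤ_) (∑-swap (allFin n) (allFin n) _)) (trans (twice S) (cong (+ 2 *ℤ_) (sym (colourClassSize-∑ κ))))))
          where twice : ∀ s → s +ℤ s ≡ + 2 *ℤ s
                twice = solve-∀
        nonneg : ∀ u v → 0ℤ ≤ℤ b2z (ordered κ u v) +ℤ b2z (ordered κ v u)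
        nonneg u v = 0≤+ (b2z≥0 (ordered κ u v)) (b2z≥0 (ordered κ v u))
        pt : ∀ u v → b2z (D u v) *ℤ Fδ (colF u v) k ≤ℤ b2z (ordered κ u v) +ℤ b2z (ordered κ v u)
        pt u v = bool-cases (D u v) arc (λ d → subst (λ b → b2z b *ℤ Fδ (colF u v) k ≤ℤ b2z (ordered κ u v) +ℤ b2z (ordered κ v u)) (sym d) (nonneg u v))
          where
          arc : D u v ≡ true → b2z (D u v) *ℤ Fδ (colF u v) k ≤ℤ b2z (ordered κ u v) +ℤ b2z (ordered κ v u)
          arc d with colF u v Fin.≟ k
          ... | yes e = ℤP.≤-trans (ℤP.≤-reflexive (cong (λ b → b2z b *ℤ 1ℤ) d)) (ordered-either κ u v (D⊆adj u v d) (trans (sym (toℕ-colF u v)) (cong toℕ e)))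
          ... | no _ = ℤP.≤-trans (ℤP.≤-reflexive (ℤP.*-zeroʳ (b2z (D u v)))) (nonneg u v)

      module _ (dirac : ∀ u → + n ≤ℤ + 2 *ℤ ∑ (allFin n) (λ v → b2z (adj G u v))) where
        open Closing n (adj G) (Graph.sym G) (Graph.irrefl G) (col c) (colSym c) dirac

        -- The pairs that show distinct colours are distinct, so at most length ps of the n cyclic pairs are gaps.
        tour-from-paths : ∀ {ps a} → Fits ps a → Outcome (n ∸ (length ps + length ps))
        tour-from-paths {ps} {a} fits = subst Outcome number′ (close-up (length ps) l C covers few-gaps rainbow shows)
          where
          open Fits fits
          l : List (Fin n)
          l = concat ps
          C : List ℕ
          C = map colour (pathArcs ps)
          length-C : length C + length ps ≡ n
          length-C = trans (cong (_+ length ps) (length-map colour (pathArcs ps))) number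
          number′ : length C ∸ length ps ≡ n ∸ (length ps + length ps)
          number′ = trans (cong (_∸ length ps) (trans (sym (m+n∸n≡m (length C) (length ps))) (cong (_∸ length ps) length-C))) (∸-+-assoc n (length ps) (length ps))
          on-tour : ∀ {e} → e ∈ pathArcs ps → e ∈ cyc l
          on-tour i = steps⊆cyc l (steps-concat ps i)
          shows : All.All (Shows (cyc l)) C
          shows = AllP.map⁺ (All.tabulate (λ {e} i → e , on-tour i , edges i , refl))
          good : List Pair
          good = filter (λ e → isEdge e Bool.≟ true) (cyc l)
          C≤good : length C ≤ length good
          C≤good = subst (length C ≤_) (length-map colour good) (Unique-⊆-length rainbow sub)
            where sub : ∀ {x} → x ∈ C → x ∈ map colour good
                  sub i with ∈-map⁻ colour i
                  ... | e , j , refl = ∈-map⁺ colour (∈-filter⁺ (λ e → isEdge e Bool.≟ true) (on-tour j) (edges j))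
          length-cyc : ∀ l → length (cyc l) ≡ length l
          length-cyc [] = refl
          length-cyc (y ∷ t) = trans (length-steps y (t ∷ʳ y)) (trans (length-++ t) (+-comm (length t) 1))
          gaps+good : gaps (cyc l) +ℤ + length good ≡ + n
          gaps+good = trans (cong (gaps (cyc l) +ℤ_) (length-filter-∑ (λ e → isEdge e Bool.≟ true) (cyc l)))
            (trans (sym (∑-+ (cyc l) _ _)) (trans (∑-cong (cyc l) (λ e → t (isEdge e))) (trans (∑-const (cyc l) 1ℤ) (trans (ℤP.*-identityʳ _)
              (cong +_ (trans (length-cyc l) (trans (↭-length covers) (length-tabulate {n = n} (λ i → i)))))))))
            where t : ∀ b → b2z (not b) +ℤ b2z ⌊ b Bool.≟ true ⌋ ≡ 1ℤ
                  t true = refl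
                  t false = refl
          few-gaps : gaps (cyc l) ≤ℤ + length ps
          few-gaps = gap (+≤+ C≤good) ≤by trans (e₁ (+ length C) (+ length ps) (+ n) (cong +_ length-C)) (trans (cong (_-ℤ + length C) (sym gaps+good)) (e₂ (gaps (cyc l)) (+ length good) (+ length C)))
            where e₁ : ∀ a b c → a +ℤ b ≡ c → b ≡ c -ℤ a
                  e₁ a b _ refl = e a b
                    where e : ∀ a b → b ≡ a +ℤ b -ℤ a
                          e = solve-∀
                  e₂ : ∀ g a b → g +ℤ a -ℤ b ≡ g +ℤ (a -ℤ b)
                  e₂ = solve-∀

  module _ {n : ℕ} (G : Graph n) (c : EdgeColouring G) (proper : Proper c) (bounded-c : GloballyNOver8Bounded c)
    (2deg≥n : ∀ v → n ≤ 2 * degree G v) (h : ℕ) (h≥ : 102 ≤ h) (lo : h ^ 43 ≤ n) (hi : n ≤ h ^ 44) where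
    private
      r j : ℕ
      r = n / 4
      j = h ^ 37
      dirac : ∀ u → + n ≤ℤ + 2 *ℤ ∑ (allFin n) (λ v → b2z (adj G u v))
      dirac u = subst (+ n ≤ℤ_) (trans (ℤP.pos-* 2 (degree G u)) (cong (+ 2 *ℤ_) (degree-∑ G c u))) (+≤+ (2deg≥n u))
      4r≤n : + 4 *ℤ + r ≤ℤ + n
      4r≤n = subst (_≤ℤ + n) (trans (cong +_ (*-comm r 4)) (ℤP.pos-* 4 r)) (+≤+ (m/n*n≤m n 4))
      open RegularFactor n (adj G) (Graph.sym G) dirac r 4r≤n
      R : Σ OutRegular λ R → ∀ v → indeg (OutRegular.D R) v ≤ℤ + (r + j + j)
      R = factor j (j-growth n h h≥ lo hi)
      D = OutRegular.D (proj₁ R)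
      D⊆adj = OutRegular.sub (proj₁ R)
      out = OutRegular.out (proj₁ R)
      B = bounded₂ n (col c)
      N = proj₁ B
      module CD = ColouredDigraph n N (adj G) (col c) (colSym c) (Graph.sym G) proper (proj₂ B) D D⊆adj
      module HP = HypergraphProperties CD.ℋ
      S : Scales n h
      S = scales n h h≥ lo hi
      -- The place of the constant 8: from 8x ≤ n follows 2x ≤ ⌊n/4⌋, so the colour vertices respect
      -- the same degree bound as the out-copies, with no rounding error.
      class≤r : ∀ k → + 2 *ℤ + colourClassSize c k ≤ℤ + r
      class≤r k = subst (_≤ℤ + r) (ℤP.pos-* 2 (colourClassSize c k)) (+≤+ (≤-trans (≤-reflexive (sym (m*n/n≡m (2 * colourClassSize c k) 4)))
          (/-monoˡ-≤ 4 (≤-trans (≤-reflexive (e (colourClassSize c k))) (bounded-c k)))))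
        where e : ∀ k → 2 * k * 4 ≡ 8 * k
              e = solveℕ
      r≤D₀ : + r ≤ℤ + (r + j + j)
      r≤D₀ = +≤+ (≤-trans (m≤m+n r j) (m≤m+n (r + j) j))
      degrees : ∀ x → HP.deg₀ x ≤ℤ + (r + j + j)
      degrees (inj₁ u) = ℤP.≤-trans (ℤP.≤-reflexive (trans (CD.deg₀-out u) (out u))) r≤D₀
      degrees (inj₂ (inj₁ v)) = ℤP.≤-trans (ℤP.≤-reflexive (CD.deg₀-in v)) (proj₂ R v)
      degrees (inj₂ (inj₂ k)) = ℤP.≤-trans (colour-degree G c N proper (proj₂ B) D D⊆adj k) (ℤP.≤-trans (class≤r (toℕ k)) r≤D₀)
      out-degrees : ∀ x → CD.isOut x ≡ true → + r ≤ℤ HP.deg₀ x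
      out-degrees (inj₁ u) _ = ℤP.≤-reflexive (sym (trans (CD.deg₀-out u) (out u)))
      length-arcs : + length CD.arcs ≡ + n *ℤ + r
      length-arcs = trans (sym (trans (∑-const CD.arcs 1ℤ) (ℤP.*-identityʳ _))) (trans (CD.∑-arcs (λ _ → 1ℤ))
        (trans (∑-cong (allFin n) (λ u → trans (∑-cong (allFin n) (λ v → ℤP.*-identityʳ (b2z (D u v)))) (out u)))
          (trans (∑-const (allFin n) (+ r)) (cong (λ k → + k *ℤ + r) (length-tabulate {n = n} (λ i → i))))))
      module Proc = Process (parameters S (length CD.verts)) CD.ℋ CD.isOut (λ _ → refl) (λ _ → refl) (λ _ → refl)
        CD.∑-isOut refl length-arcs out-degrees degrees CD.growth

    rainbow-paths : Σ CD.Paths λ ps → Σ HP.State λ a → CD.Fits ps a × h * length ps ≤ 2 * n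
    rainbow-paths = let ps , a , fits , le = Proc.near-perfect CD.singletons CD.fits-singletons count₀
                    in ps , a , fits , unscale S (length CD.verts) (length ps) (subst (λ t → + n *ℤ + (h ^ 5) *ℤ t ≤ℤ + n *ℤ + n *ℤ + (h ^ 4) +ℤ + n *ℤ + n *ℤ + (h ^ 4)) (e (+ n) (+ length ps)) le)
      where
      e : ∀ n k → n -ℤ (n -ℤ k) ≡ k
      e = solve-∀
      count₀ : + n -ℤ + length CD.singletons ≡ 0ℤ
      count₀ = trans (cong (λ k → + n -ℤ + k) (trans (length-map _ (allFin n)) (length-tabulate {n = n} (λ i → i)))) (e₀ (+ n))
        where e₀ : ∀ n → n -ℤ n ≡ 0ℤ
              e₀ = solve-∀

    tour : Σ ℕ λ g → h * g ≤ 2 * n × Closing.Outcome n (adj G) (Graph.sym G) (Graph.irrefl G) (col c) (colSym c) dirac (n ∸ (g + g))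
    tour = let ps , a , fits , le = rainbow-paths in
      length ps , le , tour-from-paths G c N proper (proj₂ B) D D⊆adj dirac fits

    many-colours : Σ (HamiltonCycle G) λ H → h * (n ∸ numColours c H) ≤ 4 * n
    many-colours = go n G c refl dirac tour
      where
      -- The number of vertices is generalised so that it can be matched as a successor, the form in
      -- which `hamilton` is stated.
      go : ∀ m (G : Graph m) (c : EdgeColouring G) → m ≡ n → (dirac : ∀ u → + m ≤ℤ + 2 *ℤ ∑ (allFin m) (λ v → b2z (adj G u v))) →
           (Σ ℕ λ g → h * g ≤ 2 * m × Closing.Outcome m (adj G) (Graph.sym G) (Graph.irrefl G) (col c) (colSym c) dirac (m ∸ (g + g))) →
           Σ (HamiltonCycle G) λ H → h * (m ∸ numColours c H) ≤ 4 * m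
      3≤n : 3 ≤ n
      3≤n = ≤-trans (s≤s (s≤s (s≤s z≤n))) (12≤n n h h≥ lo hi)
      go zero G c eq _ _ = ⊥-elim (<⇒≢ (≤-trans (s≤s z≤n) 3≤n) eq)
      -- With g paths the forest shows n - g colours, and closing up loses at most g more; 2g is at
      -- most 4n/h.
      go (suc m) G c eq dirac (g , le , o) = let H , b = hamilton G c (subst (3 ≤_) (sym eq) 3≤n) dirac o in
        H , ≤-trans (*-monoʳ-≤ h (m≤n+o⇒m∸n≤o (suc m) (numColours c H) (≤-trans (m≤n+m∸n (suc m) (g + g)) (≤-trans (+-monoʳ-≤ (g + g) b) (≤-reflexive (+-comm (g + g) (numColours c H)))))))
              (≤-trans (≤-reflexive (*-distribˡ-+ h g g)) (≤-trans (+-mono-≤ le le) (≤-reflexive (e (suc m)))))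
        where e : ∀ n → 2 * n + 2 * n ≡ 4 * n
              e = solveℕ

  root-≥ : ∀ k {T n h} → T ^ k ≤ n → n < suc h ^ k → T ≤ h
  root-≥ k T^k≤n hi = ≮⇒≥ (λ h<T → <⇒≱ hi (≤-trans (^-monoˡ-≤ k h<T) T^k≤n))

  -- For p/q < 1/k, from x ≤ 4n/h and n ≤ (2h)^k follows x n^(p/q) ≤ (4n/h)(2h) = 8n. Everything is
  -- raised to the power q to avoid fractional exponents.
  final-bound : ∀ k n h x p q → 1 ≤ h → n < suc h ^ k → h * x ≤ 4 * n → p * k < 1 * q → x ^ q * n ^ p ≤ 8 ^ q * n ^ q
  final-bound k n h x p q h≥1 hi hx pq = *-cancelˡ-≤ (h ^ q) {{m^n≢0 h q {{>-nonZero h≥1}}}} (begin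
      h ^ q * (x ^ q * n ^ p)           ≡⟨ *-assoc (h ^ q) (x ^ q) (n ^ p) ⟨
      h ^ q * x ^ q * n ^ p             ≡⟨ cong (_* n ^ p) (^-distribʳ-* q h x) ⟨
      (h * x) ^ q * n ^ p               ≤⟨ *-mono-≤ (^-monoˡ-≤ q hx) n^p≤ ⟩
      (4 * n) ^ q * (2 * h) ^ q         ≡⟨ cong₂ _*_ (^-distribʳ-* q 4 n) (^-distribʳ-* q 2 h) ⟩
      4 ^ q * n ^ q * (2 ^ q * h ^ q)   ≡⟨ e (4 ^ q) (n ^ q) (2 ^ q) (h ^ q) ⟩
      h ^ q * (4 ^ q * 2 ^ q * n ^ q)   ≡⟨ cong (λ t → h ^ q * (t * n ^ q)) (^-distribʳ-* q 4 2) ⟨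
      h ^ q * (8 ^ q * n ^ q)           ∎)
    where
    open ≤-Reasoning
    e : ∀ a b c d → a * b * (c * d) ≡ d * (a * c * b)
    e = solveℕ
    n^p≤ : n ^ p ≤ (2 * h) ^ q
    n^p≤ = begin
      n ^ p                ≤⟨ ^-monoˡ-≤ p (≤-trans (<⇒≤ hi) (^-monoˡ-≤ k (suc≤2* h≥1))) ⟩
      ((2 * h) ^ k) ^ p   ≡⟨ ^-*-assoc (2 * h) k p ⟩
      (2 * h) ^ (k * p)   ≤⟨ ^-monoʳ-≤ (2 * h) {{>-nonZero (≤-trans h≥1 (m≤m+n h (h + 0)))}} (≤-trans (≤-reflexive (*-comm k p)) (≤-trans (<⇒≤ pq) (≤-reflexive (*-identityˡ q)))) ⟩
      (2 * h) ^ q          ∎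

  rainbow-hamilton : ∀ T → 102 ≤ T → 2 ^ 43 ≤ T → ∀ {n} → T ^ 43 ≤ n → (G : Graph n) → (∀ v → n ≤ 2 * degree G v) →
    ∀ (c : EdgeColouring G) → Proper c → GloballyNOver8Bounded c →
    Σ (HamiltonCycle G) λ H → ∀ p q → p * 43 < 1 * q → (n ∸ numColours c H) ^ q * n ^ p ≤ 8 ^ q * n ^ q
  rainbow-hamilton T T≥102 T≥2^43 {n} T^43≤n G δ c proper bounded-c = from-root (proj₁ R) (proj₁ (proj₂ R)) (proj₂ (proj₂ R))
    where
    R : Σ ℕ λ h → h ^ 43 ≤ n × n < suc h ^ 43
    R = root 43 n
    from-root : ∀ h → h ^ 43 ≤ n → n < suc h ^ 43 →
      Σ (HamiltonCycle G) λ H → ∀ p q → p * 43 < 1 * q → (n ∸ numColours c H) ^ q * n ^ p ≤ 8 ^ q * n ^ q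
    from-root h lo hi = proj₁ cycle , λ p q pq → final-bound 43 n h (n ∸ numColours c (proj₁ cycle)) p q h≥1 hi (proj₂ cycle) pq
      where
      T≤h : T ≤ h
      T≤h = root-≥ 43 {T} {n} {h} T^43≤n hi
      h≥102 : 102 ≤ h
      h≥102 = ≤-trans T≥102 T≤h
      h≥1 : 1 ≤ h
      h≥1 = ≤-trans (s≤s z≤n) h≥102
      cycle : Σ (HamiltonCycle G) λ H → h * (n ∸ numColours c H) ≤ 4 * n
      cycle = many-colours G c proper bounded-c δ h h≥102 lo (next-power 43 {n} {h} h≥1 (≤-trans T≥2^43 T≤h) hi)

open import Defs
open import Data.Nat using (ℕ; _+_; _*_; _∸_; _^_; _≤_; _<_; s≤s; z≤n; >-nonZero)
open import Data.Nat.Properties using (m≤m+n; m≤n+m; *-cancelˡ-≤; *-monoˡ-≤; ≤-trans; ≤-reflexive)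
open RainbowTours using (rainbow-hamilton)

theorem4p1 : Σ ℕ λ a₀ → Σ ℕ λ d₀ → 0 < a₀ × 0 < d₀ ×
    (∀ (p q : ℕ) → 0 < p → 0 < q → p * d₀ < a₀ * q →
    ∀ (r s : ℕ) → 0 < r → 0 < s → 2 * r ≤ s →
    Σ ℕ λ b → Σ ℕ λ n₀ →
    ∀ (n : ℕ) → n₀ ≤ n →
    ∀ (G : Graph n) →
    (∀ v → (s + 2 * r) * n ≤ 2 * s * degree G v) →
    ∀ (c : EdgeColouring G) → Proper c → GloballyNOver8Bounded c →
    Σ (HamiltonCycle G) λ H →
    (n ∸ numColours c H) ^ q * n ^ p ≤ b ^ q * n ^ q)
-- β₀ = 1/43, with β = p/q, and b = 8 from `final-bound`. The threshold makes the 43rd root of n,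
-- rounded down, at least 102, as the parameter conditions demand, and at least 2^43, as
-- `next-power` demands.
theorem4p1 = 1 , 43 , s≤s z≤n , s≤s z≤n , λ p q _ _ pq r s _ s>0 _ →
  8 , (102 + 2 ^ 43) ^ 43 , λ n n₀≤n G δ c proper bounded-c →
    let H , few = rainbow-hamilton (102 + 2 ^ 43) (m≤m+n 102 (2 ^ 43)) (m≤n+m (2 ^ 43) 102) n₀≤n G
          (λ v → *-cancelˡ-≤ s {{>-nonZero s>0}} (≤-trans (*-monoˡ-≤ n (m≤m+n s (2 * r))) (≤-trans (δ v) (≤-reflexive (e s (degree G v))))))
          c proper bounded-c
    in H , few p q pq
  where e : ∀ s d → 2 * s * d ≡ s * (2 * d)
        e = solveℕ
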